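{- For a positive integer $n$, let $H_{n}(x,y)$ denote the generating function $H_n(x,y)=\sum_{A} x^{r(A)}y^{s(A)}$, where the sum runs over all $n\times n$ alternating sign matrices $A=(a_{ij})_{0\le i,j\le n-1}$ that are invariant under the half-turn, i.e. satisfy $a_{ij}=a_{n-1-i,\,n-1-j}$ for all $i,j$; here $s(A)$ is the column index $s$ with $a_{0s}=1$, and $r(A)$ is the number of orbits of the entries equal to $-1$ under the action of the two-element group generated by the half-turn $(i,j)\mapsto(n-1-i,n-1-j)$. Then for every positive integer $n$, \[ \frac{H_{4n}(2,1)}{H_{4n-2}(2,1)}=2^{2n-1}\,\frac{\binom{4n}{2n}}{\binom{2n}{n}},\qquad \frac{H_{4n+2}(2,1)}{H_{4n}(2,1)}=2^{2n+1}\,\frac{\binom{4n}{2n}}{\binom{2n}{n}},\qquad H_{2n+1}(2,1)=2^{n}\,H_{2n}(2,1). \]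
   Context: An alternating sign matrix is a square matrix all of whose entries are $1$, $-1$ or $0$, every row and column has sum $1$, and in every row and column the non-zero entries alternate in sign. Entries of an $n\times n$ matrix are indexed $a_{ij}$ with $0\le i,j\le n-1$. Every alternating sign matrix has exactly one entry equal to $1$ in its top row (row $0$). Concretely, $r(A)$ equals half the number of $-1$ entries of $A$, except when $n=2m+1$ is odd and $a_{mm}=-1$, in which case the number of $-1$ entries is odd, say $2l+1$, and $r(A)=l+1$. -}

module Defs where

open import Data.Bool using (Bool; true; false; _∧_; _∨_; not; if_then_else_)
open import Data.Nat using (ℕ; zero; suc; _+_; _*_; _^_; _<ᵇ_; _≡ᵇ_)
open import Data.Integer as ℤ using (ℤ)
open import Data.Fin using (Fin; toℕ; opposite)
open import Data.Nat.ListAction using (sum)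
open import Data.List using (List; []; _∷_; map; concatMap; filterᵇ; length; allFin; foldr)
open import Relation.Nullary.Decidable using (⌊_⌋)

data Entry : Set where
  neg zer pos : Entry

value : Entry → ℤ
value neg = ℤ.-[1+ 0 ]
value zer = ℤ.+ 0
value pos = ℤ.+ 1

isNeg isZer isPos : Entry → Bool
isNeg neg = true
isNeg _   = false
isZer zer = true
isZer _   = false
isPos pos = true
isPos _   = false

sameSign : Entry → Entry → Bool
sameSign neg neg = true
sameSign zer zer = true
sameSign pos pos = true
sameSign _   _   = false

Matrix : ℕ → Set
Matrix n = Fin n → Fin n → Entry

line : ∀ {n} → (Fin n → Entry) → List Entry
line {n} f = map f (allFin n)

lineSum : List Entry → ℤ
lineSum = foldr (λ e s → value e ℤ.+ s) (ℤ.+ 0)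

alternates : List Entry → Bool
alternates []           = true
alternates (x ∷ [])     = true
alternates (x ∷ y ∷ xs) = not (sameSign x y) ∧ alternates (y ∷ xs)

goodLine : List Entry → Bool
goodLine l = ⌊ lineSum l ℤ.≟ ℤ.+ 1 ⌋ ∧ alternates (filterᵇ (λ e → not (isZer e)) l)

allᵇ : ∀ {A : Set} → (A → Bool) → List A → Bool
allᵇ p = foldr (λ a b → p a ∧ b) true

isASM : ∀ {n} → Matrix n → Bool
isASM {n} A = allᵇ (λ i → goodLine (line (λ j → A i j))) (allFin n)
            ∧ allᵇ (λ j → goodLine (line (λ i → A i j))) (allFin n)

eqEntry : Entry → Entry → Bool
eqEntry = sameSign

isHalfTurnSym : ∀ {n} → Matrix n → Bool
isHalfTurnSym {n} A =
  allᵇ (λ i → allᵇ (λ j → eqEntry (A i j) (A (opposite i) (opposite j))) (allFin n)) (allFin n)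

allFuns : ∀ {A : Set} → List A → (k : ℕ) → List (Fin k → A)
allFuns as zero    = (λ ()) ∷ []
allFuns as (suc k) =
  concatMap (λ a → map (λ f → λ { Fin.zero → a ; (Fin.suc i) → f i }) (allFuns as k)) as

allMatrices : (n : ℕ) → List (Matrix n)
allMatrices n = allFuns (allFuns (neg ∷ zer ∷ pos ∷ []) n) n

HTSASMs : (n : ℕ) → List (Matrix n)
HTSASMs n = filterᵇ (λ A → isASM A ∧ isHalfTurnSym A) (allMatrices n)

lexLeq : ∀ {n} → Fin n → Fin n → Fin n → Fin n → Bool
lexLeq i j i' j' = (toℕ i <ᵇ toℕ i') ∨ ((toℕ i ≡ᵇ toℕ i') ∧ ((toℕ j <ᵇ toℕ j') ∨ (toℕ j ≡ᵇ toℕ j')))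

-- r(A): number of orbits of the (-1)-entries under the half-turn group;
-- each orbit {(i,j),(n-1-i,n-1-j)} is counted once via its lexicographically
-- smallest member.
r : ∀ {n} → Matrix n → ℕ
r {n} A = length (filterᵇ (λ p → isNeg (A (proj₁' p) (proj₂' p))
                               ∧ lexLeq (proj₁' p) (proj₂' p) (opposite (proj₁' p)) (opposite (proj₂' p)))
                          (concatMap (λ i → map (λ j → pair i j) (allFin n)) (allFin n)))
  where
    data Pos : Set where
      pair : Fin n → Fin n → Pos
    proj₁' : Pos → Fin n
    proj₁' (pair i _) = i
    proj₂' : Pos → Fin n
    proj₂' (pair _ j) = j

firstPos : List Entry → ℕ
firstPos []       = 0
firstPos (e ∷ es) = if isPos e then 0 else suc (firstPos es)

s : ∀ {n} → Matrix n → ℕ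
s {zero}  A = 0
s {suc n} A = firstPos (line (λ j → A Fin.zero j))

H : ℕ → ℕ → ℕ → ℕ
H n x y = sum (map (λ A → x ^ r A * y ^ s A) (HTSASMs n))

{-# OPTIONS --safe #-}

-- A half-turn invariant matrix is determined by its upper half, which is a sequence
-- of column states; H is thus a power of the row transfer D applied to a boundary
-- functional.
--
-- Even size: transposed to the exterior algebra, a row acts on v₁ ∧ … ∧ v_p as
-- 1 ∧ Gv₁ ∧ … ∧ Gv_p, so m rows produce a wedge of the polynomials q₀, …, q_(m-1) of
-- degrees 0, …, m - 1, each even or odd about the centre (this is the 2-enumeration
-- of monotone triangles). The boundary functional asks for one column of each mirror
-- pair; it folds ℤ²ᵐ to ℤᵐ and yields a determinant with entries
-- (1 + (-1)^(i + j)) q_i(2 j + 1), which elimination turns into a product.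
--
-- Odd size: letting every particle hop to a neighbouring midpoint intertwines the
-- transfer on n + 1 columns with twice the transfer on n columns, and pulls the
-- boundary functional of size 2 m back to that of size 2 m + 1.
module Submission where

open import Data.Bool using (Bool; true; false; not; _∧_; _∨_; if_then_else_)
open import Data.Bool.Properties using (∧-assoc; ∧-comm; ∧-identityʳ; ∧-zeroʳ; not-involutive)
open import Data.Fin as Fin using (Fin; toℕ; fromℕ; inject₁; opposite)
open import Data.Fin.Properties using (toℕ-fromℕ; toℕ-inject₁; toℕ-injective; opposite-prop)
open import Data.Nat using (ℕ; zero; suc; _!; _<_; s≤s)
open import Data.Product using (_×_; _,_; proj₁; proj₂; ∃)
open import Data.Sum using (inj₁; inj₂)
open import Data.Vec using (Vec; []; _∷_; _∷ʳ_; replicate; reverse; map; zipWith; toList; lookup; tabulate; initLast)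
open import Function using (_∘_; id)
open import Relation.Binary using (DecidableEquality)
open import Relation.Nullary using (Dec; yes; no; does; contradiction)
open import Relation.Nullary.Decidable using (dec-true; dec-false)
open import Relation.Binary.PropositionalEquality using (_≡_; _≢_; refl; sym; trans; cong; cong₂; subst; module ≡-Reasoning)

-- The weight 2 of an entry -1 is what lets a row act on wedges factor by factor. Between two
-- consecutive occupied columns of the new state lies one occupied column of the old state; it
-- counts 2 strictly inside and 1 at either end, so its sum is a difference of two trapezoidal sums
-- `G`, and the leading factor 1 of the wedge produces these differences. The same factor absorbs
-- the constant of every summation, so the polynomials may be centred anywhere; centring them on the
-- columns gives mirror columns opposite abscissae, and parity then turns folding into a factor 0 or
-- 2. Summation of polynomials creates denominators. To stay in the integers they are kept on the
-- other side, and they accumulate to `superfactorial`. Consecutive even sizes differ by one pivot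
-- `tri m m`, whose shape depends on the parity of `m`: hence two ratios with the same binomials. In
-- odd size the middle row carries weights of its own, so the boundary functional is no longer a
-- choice of one column from each mirror pair, and folding does not apply directly.

module RowTransfer where

  -- Row transfer on column states and its intertwining with hopping

  open import Data.Nat using (_+_; _*_; _^_)
  open import Data.Nat.Properties using (+-assoc; +-identityʳ; *-assoc; *-comm; *-identityˡ; *-zeroʳ; *-distribˡ-+)
  open import Data.Nat.Tactic.RingSolver using (solve-∀)

  -- Reduces to two successors, so that removing the first and the last of `double (suc m)` rows or
  -- columns leaves exactly `double m`.
  double : ℕ → ℕ
  double zero    = zero
  double (suc m) = suc (suc (double m))

  -- A state records, column by column, whether the partial column sum is 1.
  State : ℕ → Set
  State = Vec Bool

  infixl 9 _at_

  _at_ : ∀ {X : Set} {n} → (State (suc n) → X) → Bool → State n → X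
  (f at b) S = f (b ∷ S)

  -- D h f S sums f over the states reached from S by one row, a row weighing 2 per
  -- entry -1; h is the partial sum of the row on entering the current column.
  D : ∀ {n} → Bool → (State n → ℕ) → State n → ℕ
  D true  f []          = f []
  D false f []          = 0
  D false f (false ∷ S) = D false (f at false) S + D true (f at true) S
  D false f (true ∷ S)  = D false (f at true) S
  D true  f (false ∷ S) = D true (f at false) S
  D true  f (true ∷ S)  = 2 * D false (f at false) S + D true (f at true) S

  D-cong : ∀ {n} h {f g : State n → ℕ} → (∀ S → f S ≡ g S) → ∀ S → D h f S ≡ D h g S
  D-cong true  e []          = e []
  D-cong false e []          = refl
  D-cong false e (false ∷ S) = cong₂ _+_ (D-cong false (λ T → e (false ∷ T)) S) (D-cong true (λ T → e (true ∷ T)) S)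
  D-cong false e (true ∷ S)  = D-cong false (λ T → e (true ∷ T)) S
  D-cong true  e (false ∷ S) = D-cong true (λ T → e (false ∷ T)) S
  D-cong true  e (true ∷ S)  =
    cong₂ (λ x y → 2 * x + y) (D-cong false (λ T → e (false ∷ T)) S) (D-cong true (λ T → e (true ∷ T)) S)

  D-lin : ∀ {n} h a (f g : State n → ℕ) S → D h (λ T → a * f T + g T) S ≡ a * D h f S + D h g S
  D-lin true  a f g []          = refl
  D-lin false a f g []          = sym (trans (+-identityʳ _) (*-zeroʳ a))
  D-lin false a f g (false ∷ S)
    rewrite D-lin false a (f at false) (g at false) S | D-lin true a (f at true) (g at true) S =
    lemma a (D false (f at false) S) (D false (g at false) S) (D true (f at true) S) (D true (g at true) S)
    where
    lemma : ∀ a x y z w → a * x + y + (a * z + w) ≡ a * (x + z) + (y + w)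
    lemma = solve-∀
  D-lin false a f g (true ∷ S)  = D-lin false a (f at true) (g at true) S
  D-lin true  a f g (false ∷ S) = D-lin true a (f at false) (g at false) S
  D-lin true  a f g (true ∷ S)
    rewrite D-lin false a (f at false) (g at false) S | D-lin true a (f at true) (g at true) S =
    lemma a (D false (f at false) S) (D false (g at false) S) (D true (f at true) S) (D true (g at true) S)
    where
    lemma : ∀ a x y z w → 2 * (a * x + y) + (a * z + w) ≡ a * (2 * x + z) + (2 * y + w)
    lemma = solve-∀

  D-zero : ∀ {n} h (S : State n) → D h (λ _ → 0) S ≡ 0
  D-zero true  []          = refl
  D-zero false []          = refl
  D-zero false (false ∷ S) = cong₂ _+_ (D-zero false S) (D-zero true S)
  D-zero false (true ∷ S)  = D-zero false S
  D-zero true  (false ∷ S) = D-zero true S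
  D-zero true  (true ∷ S)  = cong₂ (λ x y → 2 * x + y) (D-zero false S) (D-zero true S)

  D-+ : ∀ {n} h (f g : State n → ℕ) S → D h (λ T → f T + g T) S ≡ D h f S + D h g S
  D-+ h f g S = begin
    D h (λ T → f T + g T) S     ≡⟨ D-cong h (λ T → cong (_+ g T) (sym (*-identityˡ (f T)))) S ⟩
    D h (λ T → 1 * f T + g T) S ≡⟨ D-lin h 1 f g S ⟩
    1 * D h f S + D h g S       ≡⟨ cong (_+ D h g S) (*-identityˡ (D h f S)) ⟩
    D h f S + D h g S           ∎
    where open ≡-Reasoning

  D-* : ∀ {n} h a (f : State n → ℕ) S → D h (λ T → a * f T) S ≡ a * D h f S
  D-* h a f S = begin
    D h (λ T → a * f T) S            ≡⟨ D-cong h (λ T → sym (+-identityʳ (a * f T))) S ⟩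
    D h (λ T → a * f T + 0) S        ≡⟨ D-lin h a f (λ _ → 0) S ⟩
    a * D h f S + D h (λ _ → 0) S    ≡⟨ cong (a * D h f S +_) (D-zero h S) ⟩
    a * D h f S + 0                  ≡⟨ +-identityʳ _ ⟩
    a * D h f S                      ∎
    where open ≡-Reasoning

  -- Each particle of a state on n + 1 sites moves to one of the two neighbouring
  -- midpoints; P b f S sums f over the outcomes on n midpoints, where b tells
  -- whether a particle waits to move right into the current midpoint.
  P : ∀ {n} → Bool → (State n → ℕ) → State n → ℕ
  P false f []          = f []
  P true  f []          = 0
  P true  f (b ∷ S)     = P b (f at true) S
  P false f (false ∷ S) = P false (f at false) S
  P false f (true ∷ S)  = P true (f at false) S + P false (f at true) S

  P-cong : ∀ {n} c {f g : State n → ℕ} → (∀ S → f S ≡ g S) → ∀ S → P c f S ≡ P c g S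
  P-cong false e []          = e []
  P-cong true  e []          = refl
  P-cong true  e (b ∷ S)     = P-cong b (λ T → e (true ∷ T)) S
  P-cong false e (false ∷ S) = P-cong false (λ T → e (false ∷ T)) S
  P-cong false e (true ∷ S)  = cong₂ _+_ (P-cong true (λ T → e (false ∷ T)) S) (P-cong false (λ T → e (true ∷ T)) S)

  P-lin : ∀ {n} c a (f g : State n → ℕ) S → P c (λ T → a * f T + g T) S ≡ a * P c f S + P c g S
  P-lin false a f g []          = refl
  P-lin true  a f g []          = sym (trans (+-identityʳ _) (*-zeroʳ a))
  P-lin true  a f g (b ∷ S)     = P-lin b a (f at true) (g at true) S
  P-lin false a f g (false ∷ S) = P-lin false a (f at false) (g at false) S
  P-lin false a f g (true ∷ S)
    rewrite P-lin true a (f at false) (g at false) S | P-lin false a (f at true) (g at true) S =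
    lemma a (P true (f at false) S) (P true (g at false) S) (P false (f at true) S) (P false (g at true) S)
    where
    lemma : ∀ a x y z w → a * x + y + (a * z + w) ≡ a * (x + z) + (y + w)
    lemma = solve-∀

  P-+ : ∀ {n} c (f g : State n → ℕ) S → P c (λ T → f T + g T) S ≡ P c f S + P c g S
  P-+ c f g S = begin
    P c (λ T → f T + g T) S     ≡⟨ P-cong c (λ T → cong (_+ g T) (sym (*-identityˡ (f T)))) S ⟩
    P c (λ T → 1 * f T + g T) S ≡⟨ P-lin c 1 f g S ⟩
    1 * P c f S + P c g S       ≡⟨ cong (_+ P c g S) (*-identityˡ (P c f S)) ⟩
    P c f S + P c g S           ∎
    where open ≡-Reasoning

  hop : ∀ {n} → (State n → ℕ) → State (suc n) → ℕ
  hop f (b ∷ S) = P b f S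

  -- The fields `e₀` and `e₁` are the relation `D-hop` with the first site split off, empty or
  -- occupied. The fields `e₂` and `e₃`, which involve rows of partial sum 1, make the induction
  -- over the sites close.
  record Intertwined {n} (f : State n → ℕ) (S : State n) : Set where
    field
      e₀ : D false (P false f) S + D true (P true f) S ≡ 2 * P false (D false f) S
      e₁ : D false (P true f) S ≡ 2 * P true (D false f) S
      e₂ : D true (P false f) S ≡ P false (D true f) S
      e₃ : D false (P false f) S ≡ P true (D true f) S

  intertwined : ∀ {n} (f : State n → ℕ) (S : State n) → Intertwined f S
  intertwined f [] = record { e₀ = refl ; e₁ = refl ; e₂ = refl ; e₃ = refl }
  intertwined f (false ∷ S) = record
    { e₀ = trans (cong (λ x → D false (P false f₀) S + x + D true (P false f₁) S) (D-+ true (P true f₀) (P false f₁) S))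
          (trans (l₀ (D false (P false f₀) S) (D true (P true f₀) S) (D true (P false f₁) S))
          (trans (cong₂ (λ x y → x + 2 * y) I₀.e₀ I₁.e₂)
          (trans (sym (*-distribˡ-+ 2 (P false (D false f₀) S) _))
                 (cong (2 *_) (sym (P-+ false (D false f₀) (D true f₁) S))))))
    ; e₁ = I₁.e₀
    ; e₂ = I₀.e₂
    ; e₃ = trans (cong (D false (P false f₀) S +_) (D-+ true (P true f₀) (P false f₁) S))
          (trans (sym (+-assoc (D false (P false f₀) S) _ _))
          (trans (cong₂ _+_ I₀.e₀ I₁.e₂)
                 (sym (P-lin false 2 (D false f₀) (D true f₁) S))))
    }
    where
    f₀ = f at false
    f₁ = f at true
    module I₀ = Intertwined (intertwined f₀ S)
    module I₁ = Intertwined (intertwined f₁ S)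
    l₀ : ∀ x y z → x + (y + z) + z ≡ x + y + 2 * z
    l₀ = solve-∀
  intertwined f (true ∷ S) = record
    { e₀ = trans (cong (_+ (2 * D false (P false f₁) S + D true (P true f₁) S)) (D-+ false (P true f₀) (P false f₁) S))
          (trans (l₀ (D false (P true f₀) S) (D false (P false f₁) S) (D true (P true f₁) S))
          (trans (cong₂ _+_ (cong₂ _+_ I₀.e₁ (cong (2 *_) I₁.e₃)) I₁.e₀)
          (trans (l₁ (P true (D false f₀) S) (P true (D true f₁) S) (P false (D false f₁) S))
                 (cong (λ x → 2 * (x + P false (D false f₁) S)) (sym (P-+ true (D false f₀) (D true f₁) S))))))
    ; e₁ = I₁.e₁
    ; e₂ = trans (cong (2 * D false (P false f₀) S +_) (D-+ true (P true f₀) (P false f₁) S))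
          (trans (l₂ (D false (P false f₀) S) (D true (P true f₀) S) (D true (P false f₁) S))
          (trans (cong₂ _+_ I₀.e₃ (cong₂ _+_ I₀.e₀ I₁.e₂))
                 (cong (P true (D true f₀) S +_) (sym (P-lin false 2 (D false f₀) (D true f₁) S)))))
    ; e₃ = trans (D-+ false (P true f₀) (P false f₁) S)
          (trans (cong₂ _+_ I₀.e₁ I₁.e₃)
                 (sym (P-lin true 2 (D false f₀) (D true f₁) S)))
    }
    where
    f₀ = f at false
    f₁ = f at true
    module I₀ = Intertwined (intertwined f₀ S)
    module I₁ = Intertwined (intertwined f₁ S)
    l₀ : ∀ x y z → x + y + (2 * y + z) ≡ x + 2 * y + (y + z)
    l₀ = solve-∀
    l₁ : ∀ x y z → 2 * x + 2 * y + 2 * z ≡ 2 * (x + y + z)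
    l₁ = solve-∀
    l₂ : ∀ x y z → 2 * x + (y + z) ≡ x + (x + y + z)
    l₂ = solve-∀

  D-hop : ∀ {n} (f : State n → ℕ) S → D false (hop f) S ≡ 2 * hop (D false f) S
  D-hop f (false ∷ S) = Intertwined.e₀ (intertwined f S)
  D-hop f (true ∷ S)  = Intertwined.e₁ (intertwined f S)

  iterD : ∀ {n} → ℕ → (State n → ℕ) → State n → ℕ
  iterD zero    f = f
  iterD (suc k) f = D false (iterD k f)

  iterD-cong : ∀ {n} k {f g : State n → ℕ} → (∀ S → f S ≡ g S) → ∀ S → iterD k f S ≡ iterD k g S
  iterD-cong zero    e = e
  iterD-cong (suc k) e = D-cong false (iterD-cong k e)

  iterD-hop : ∀ {n} k (f : State n → ℕ) S → iterD k (hop f) S ≡ 2 ^ k * hop (iterD k f) S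
  iterD-hop zero    f S = sym (*-identityˡ _)
  iterD-hop (suc k) f S = begin
    D false (iterD k (hop f)) S                   ≡⟨ D-cong false (iterD-hop k f) S ⟩
    D false (λ T → 2 ^ k * hop (iterD k f) T) S   ≡⟨ D-* false (2 ^ k) (hop (iterD k f)) S ⟩
    2 ^ k * D false (hop (iterD k f)) S           ≡⟨ cong (2 ^ k *_) (D-hop (iterD k f) S) ⟩
    2 ^ k * (2 * hop (iterD (suc k) f) S)         ≡⟨ sym (*-assoc (2 ^ k) 2 _) ⟩
    2 ^ k * 2 * hop (iterD (suc k) f) S           ≡⟨ cong (_* hop (iterD (suc k) f) S) (*-comm (2 ^ k) 2) ⟩
    2 ^ suc k * hop (iterD (suc k) f) S           ∎
    where open ≡-Reasoning

  empty : ∀ {n} → State n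
  empty = replicate _ false

  P-empty : ∀ n (f : State n → ℕ) → P false f empty ≡ f empty
  P-empty zero    f = refl
  P-empty (suc n) f = P-empty n (f at false)

  -- The start state has no particle, so there hopping only removes a column; each row passed leaves
  -- a factor 2.
  iterD-hop-empty : ∀ {n} k (f : State n → ℕ) → iterD k (hop f) empty ≡ 2 ^ k * iterD k f empty
  iterD-hop-empty {n} k f = trans (iterD-hop k f empty) (cong (2 ^ k *_) (P-empty n (iterD k f)))

-- Wedge products and the transposed row transfer

module ExteriorAlgebra where

  open RowTransfer
  import Data.Nat as ℕ
  import Data.Nat.Properties as ℕₚ
  open import Data.Integer using (ℤ; +_; _+_; _-_; _*_; -_; 0ℤ; 1ℤ; -1ℤ)
  open import Data.Integer.Properties
  open import Data.Integer.Tactic.RingSolver using (solve-∀)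

  -- Ω n is the exterior algebra of ℤⁿ in the basis of wedges of unit vectors: the
  -- true entries of a state are the factors.
  Ω : ℕ → Set
  Ω n = State n → ℤ

  -- W v is left multiplication by the vector v.
  W : ∀ {n} → (ℕ → ℤ) → Ω n → Ω n
  W v ω []          = 0ℤ
  W v ω (false ∷ S) = W (v ∘ suc) (ω at false) S
  W v ω (true ∷ S)  = v 0 * ω (false ∷ S) - W (v ∘ suc) (ω at true) S

  W-cong : ∀ {n} v {ω η : Ω n} → (∀ S → ω S ≡ η S) → ∀ S → W v ω S ≡ W v η S
  W-cong v e []          = refl
  W-cong v e (false ∷ S) = W-cong (v ∘ suc) (λ T → e (false ∷ T)) S
  W-cong v e (true ∷ S)  = cong₂ (λ x y → v 0 * x - y) (e (false ∷ S)) (W-cong (v ∘ suc) (λ T → e (true ∷ T)) S)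

  W-lin : ∀ {n} v a b (ω η : Ω n) S → W v (λ T → a * ω T + b * η T) S ≡ a * W v ω S + b * W v η S
  W-lin v a b ω η [] = lemma a b
    where
    lemma : ∀ a b → 0ℤ ≡ a * 0ℤ + b * 0ℤ
    lemma = solve-∀
  W-lin v a b ω η (false ∷ S) = W-lin (v ∘ suc) a b (ω at false) (η at false) S
  W-lin v a b ω η (true ∷ S)
    rewrite W-lin (v ∘ suc) a b (ω at true) (η at true) S =
    lemma (v 0) a b (ω (false ∷ S)) (η (false ∷ S)) (W (v ∘ suc) (ω at true) S) (W (v ∘ suc) (η at true) S)
    where
    lemma : ∀ v a b x y z w → v * (a * x + b * y) - (a * z + b * w) ≡ a * (v * x - z) + b * (v * y - w)
    lemma = solve-∀

  W-sub : ∀ {n} v a (ω η : Ω n) S → W v (λ T → a * ω T - η T) S ≡ a * W v ω S - W v η S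
  W-sub v a ω η S = begin
    W v (λ T → a * ω T - η T) S        ≡⟨ W-cong v (λ T → lemma (a * ω T) (η T)) S ⟩
    W v (λ T → a * ω T + -1ℤ * η T) S  ≡⟨ W-lin v a -1ℤ ω η S ⟩
    a * W v ω S + -1ℤ * W v η S        ≡⟨ lemma (a * W v ω S) (W v η S) ⟨
    a * W v ω S - W v η S              ∎
    where
    open ≡-Reasoning
    lemma : ∀ x y → x - y ≡ x + -1ℤ * y
    lemma = solve-∀

  W-congˡ : ∀ {n} {u v : ℕ → ℤ} → (∀ t → u t ≡ v t) → (ω : Ω n) → ∀ S → W u ω S ≡ W v ω S
  W-congˡ e ω []          = refl
  W-congˡ e ω (false ∷ S) = W-congˡ (e ∘ suc) (ω at false) S
  W-congˡ e ω (true ∷ S)  = cong₂ (λ x y → x * ω (false ∷ S) - y) (e 0) (W-congˡ (e ∘ suc) (ω at true) S)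

  W-linˡ : ∀ {n} a (u v : ℕ → ℤ) (ω : Ω n) S → W (λ t → u t + a * v t) ω S ≡ W u ω S + a * W v ω S
  W-linˡ a u v ω [] = lemma a
    where
    lemma : ∀ a → 0ℤ ≡ 0ℤ + a * 0ℤ
    lemma = solve-∀
  W-linˡ a u v ω (false ∷ S) = W-linˡ a (u ∘ suc) (v ∘ suc) (ω at false) S
  W-linˡ a u v ω (true ∷ S)
    rewrite W-linˡ a (u ∘ suc) (v ∘ suc) (ω at true) S =
    lemma a (u 0) (v 0) (ω (false ∷ S)) (W (u ∘ suc) (ω at true) S) (W (v ∘ suc) (ω at true) S)
    where
    lemma : ∀ a u v x y z → (u + a * v) * x - (y + a * z) ≡ u * x - y + a * (v * x - z)
    lemma = solve-∀

  W-zero : ∀ {n} v (S : State n) → W v (λ _ → 0ℤ) S ≡ 0ℤ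
  W-zero v []          = refl
  W-zero v (false ∷ S) = W-zero (v ∘ suc) S
  W-zero v (true ∷ S)  rewrite W-zero (v ∘ suc) S | *-zeroʳ (v 0) = refl

  W-zeroˡ : ∀ {n} {v : ℕ → ℤ} → (∀ t → v t ≡ 0ℤ) → (ω : Ω n) → ∀ S → W v ω S ≡ 0ℤ
  W-zeroˡ e ω []          = refl
  W-zeroˡ e ω (false ∷ S) = W-zeroˡ (e ∘ suc) (ω at false) S
  W-zeroˡ e ω (true ∷ S)  rewrite e 0 | W-zeroˡ (e ∘ suc) (ω at true) S = refl

  W-square : ∀ {n} v (ω : Ω n) S → W v (W v ω) S ≡ 0ℤ
  W-square v ω []          = refl
  W-square v ω (false ∷ S) = W-square (v ∘ suc) (ω at false) S
  W-square v ω (true ∷ S)  = begin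
    v 0 * W v′ ω₀ S - W v′ (λ T → v 0 * ω₀ T - W v′ ω₁ T) S
      ≡⟨ cong (λ x → v 0 * W v′ ω₀ S - x) (W-sub v′ (v 0) ω₀ (W v′ ω₁) S) ⟩
    v 0 * W v′ ω₀ S - (v 0 * W v′ ω₀ S - W v′ (W v′ ω₁) S)
      ≡⟨ cong (λ x → v 0 * W v′ ω₀ S - (v 0 * W v′ ω₀ S - x)) (W-square v′ ω₁ S) ⟩
    v 0 * W v′ ω₀ S - (v 0 * W v′ ω₀ S - 0ℤ)
      ≡⟨ lemma (v 0 * W v′ ω₀ S) ⟩
    0ℤ ∎
    where
    open ≡-Reasoning
    v′ = v ∘ suc
    ω₀ = ω at false
    ω₁ = ω at true
    lemma : ∀ x → x - (x - 0ℤ) ≡ 0ℤ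
    lemma = solve-∀

  W-anticomm : ∀ {n} u v (ω : Ω n) S → W u (W v ω) S ≡ - W v (W u ω) S
  W-anticomm u v ω []          = refl
  W-anticomm u v ω (false ∷ S) = W-anticomm (u ∘ suc) (v ∘ suc) (ω at false) S
  W-anticomm u v ω (true ∷ S)  = begin
    u 0 * W v′ ω₀ S - W u′ (λ T → v 0 * ω₀ T - W v′ ω₁ T) S
      ≡⟨ cong (λ x → u 0 * W v′ ω₀ S - x) (W-sub u′ (v 0) ω₀ (W v′ ω₁) S) ⟩
    u 0 * W v′ ω₀ S - (v 0 * W u′ ω₀ S - W u′ (W v′ ω₁) S)
      ≡⟨ cong (λ x → u 0 * W v′ ω₀ S - (v 0 * W u′ ω₀ S - x)) (W-anticomm u′ v′ ω₁ S) ⟩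
    u 0 * W v′ ω₀ S - (v 0 * W u′ ω₀ S - - W v′ (W u′ ω₁) S)
      ≡⟨ lemma (u 0 * W v′ ω₀ S) (v 0 * W u′ ω₀ S) (W v′ (W u′ ω₁) S) ⟩
    - (v 0 * W u′ ω₀ S - (u 0 * W v′ ω₀ S - W v′ (W u′ ω₁) S))
      ≡⟨ cong (λ x → - (v 0 * W u′ ω₀ S - x)) (W-sub v′ (u 0) ω₀ (W u′ ω₁) S) ⟨
    - (v 0 * W u′ ω₀ S - W v′ (λ T → u 0 * ω₀ T - W u′ ω₁ T) S) ∎
    where
    open ≡-Reasoning
    u′ = u ∘ suc
    v′ = v ∘ suc
    ω₀ = ω at false
    ω₁ = ω at true
    lemma : ∀ x y z → x - (y - - z) ≡ - (y - (x - z))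
    lemma = solve-∀

  -- R h is the transpose of D h.
  R : ∀ {n} → Bool → Ω n → Ω n
  R false ω []          = 0ℤ
  R true  ω []          = ω []
  R false ω (false ∷ T) = R false (ω at false) T
  R false ω (true ∷ T)  = R true (ω at false) T + R false (ω at true) T
  R true  ω (false ∷ T) = R true (ω at false) T + + 2 * R false (ω at true) T
  R true  ω (true ∷ T)  = R true (ω at true) T

  R-cong : ∀ {n} h {ω η : Ω n} → (∀ S → ω S ≡ η S) → ∀ T → R h ω T ≡ R h η T
  R-cong false e []          = refl
  R-cong true  e []          = e []
  R-cong false e (false ∷ T) = R-cong false (λ S → e (false ∷ S)) T
  R-cong false e (true ∷ T)  = cong₂ _+_ (R-cong true (λ S → e (false ∷ S)) T) (R-cong false (λ S → e (true ∷ S)) T)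
  R-cong true  e (false ∷ T) =
    cong₂ (λ x y → x + + 2 * y) (R-cong true (λ S → e (false ∷ S)) T) (R-cong false (λ S → e (true ∷ S)) T)
  R-cong true  e (true ∷ T)  = R-cong true (λ S → e (true ∷ S)) T

  R-lin : ∀ {n} h a b (ω η : Ω n) T → R h (λ S → a * ω S + b * η S) T ≡ a * R h ω T + b * R h η T
  R-lin false a b ω η [] = lemma a b
    where
    lemma : ∀ a b → 0ℤ ≡ a * 0ℤ + b * 0ℤ
    lemma = solve-∀
  R-lin true  a b ω η [] = refl
  R-lin false a b ω η (false ∷ T) = R-lin false a b (ω at false) (η at false) T
  R-lin false a b ω η (true ∷ T)
    rewrite R-lin true a b (ω at false) (η at false) T | R-lin false a b (ω at true) (η at true) T =
    lemma a b (R true (ω at false) T) (R true (η at false) T) (R false (ω at true) T) (R false (η at true) T)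
    where
    lemma : ∀ a b x y z w → a * x + b * y + (a * z + b * w) ≡ a * (x + z) + b * (y + w)
    lemma = solve-∀
  R-lin true  a b ω η (false ∷ T)
    rewrite R-lin true a b (ω at false) (η at false) T | R-lin false a b (ω at true) (η at true) T =
    lemma a b (R true (ω at false) T) (R true (η at false) T) (R false (ω at true) T) (R false (η at true) T)
    where
    lemma : ∀ a b x y z w → a * x + b * y + + 2 * (a * z + b * w) ≡ a * (x + + 2 * z) + b * (y + + 2 * w)
    lemma = solve-∀
  R-lin true  a b ω η (true ∷ T)  = R-lin true a b (ω at true) (η at true) T

  R-sub : ∀ {n} h a (ω η : Ω n) T → R h (λ S → a * ω S - η S) T ≡ a * R h ω T - R h η T
  R-sub h a ω η T = begin
    R h (λ S → a * ω S - η S) T        ≡⟨ R-cong h (λ S → lemma (a * ω S) (η S)) T ⟩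
    R h (λ S → a * ω S + -1ℤ * η S) T  ≡⟨ R-lin h a -1ℤ ω η T ⟩
    a * R h ω T + -1ℤ * R h η T        ≡⟨ lemma (a * R h ω T) (R h η T) ⟨
    a * R h ω T - R h η T              ∎
    where
    open ≡-Reasoning
    lemma : ∀ x y → x - y ≡ x + -1ℤ * y
    lemma = solve-∀

  R-* : ∀ {n} h a (ω : Ω n) T → R h (λ S → a * ω S) T ≡ a * R h ω T
  R-* h a ω T = begin
    R h (λ S → a * ω S) T               ≡⟨ R-cong h (λ S → lemma (a * ω S) (ω S)) T ⟩
    R h (λ S → a * ω S + 0ℤ * ω S) T    ≡⟨ R-lin h a 0ℤ ω ω T ⟩
    a * R h ω T + 0ℤ * R h ω T          ≡⟨ lemma (a * R h ω T) (R h ω T) ⟨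
    a * R h ω T                         ∎
    where
    open ≡-Reasoning
    lemma : ∀ x y → x ≡ x + 0ℤ * y
    lemma = solve-∀

  -- R false sends v₁ ∧ … ∧ v_p to 1 ∧ Gv₁ ∧ … ∧ Gv_p, where G is the trapezoidal
  -- sum; the multiplier k avoids the denominators that G introduces.
  module _ (k : ℤ) where

    -- Here `g` is `k` times the trapezoidal sum of `v`, shifted by a constant `c`. In `e₀` the
    -- shift is invisible because `R false ω` already contains the factor 1, and the minus sign
    -- comes from moving a vector past that factor. In `e₁` the shift shows; it has to be recorded
    -- since the induction over the columns changes it.
    record RW {n} (c : ℤ) (v g : ℕ → ℤ) (ω : Ω n) (T : State n) : Set where
      field
        e₀ : k * R false (W v ω) T ≡ - W g (R false ω) T
        e₁ : k * R true (W v ω) T ≡ W g (R true ω) T - c * R false ω T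

    R-W : ∀ {n} c (v g : ℕ → ℤ) → g 0 ≡ c + k * v 0 → (∀ t → g (suc t) ≡ g t + k * (v t + v (suc t))) →
          (ω : Ω n) (T : State n) → RW c v g ω T
    R-W c v g g₀ gₛ ω [] = record { e₀ = *-zeroʳ k ; e₁ = lemma k c }
      where
      lemma : ∀ k c → k * 0ℤ ≡ 0ℤ - c * 0ℤ
      lemma = solve-∀
    R-W c v g g₀ gₛ ω (b ∷ T) = go b
      where
      open ≡-Reasoning
      v′ = v ∘ suc
      g′ = g ∘ suc
      ω₀ = ω at false
      ω₁ = ω at true
      -- Column 0 is an endpoint of the trapezoidal sum only at column 0 itself; for all later
      -- columns it is interior and counts twice.
      c′ = c + + 2 * (k * v 0)
      g₀′ : g′ 0 ≡ c′ + k * v′ 0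
      g₀′ = trans (gₛ 0) (trans (cong (_+ k * (v 0 + v 1)) g₀) (lemma c k (v 0) (v 1)))
        where
        lemma : ∀ c k x y → c + k * x + k * (x + y) ≡ c + + 2 * (k * x) + k * y
        lemma = solve-∀
      ih : ∀ η → RW c′ v′ g′ η T
      ih η = R-W c′ v′ g′ g₀′ (gₛ ∘ suc) η T
      module I₀ = RW (ih ω₀)
      module I₁ = RW (ih ω₁)
      go : ∀ b → RW c v g ω (b ∷ T)
      go false = record
        { e₀ = I₀.e₀
        ; e₁ = begin
            k * (R true (W v′ ω₀) T + + 2 * R false (λ S → v 0 * ω₀ S - W v′ ω₁ S) T)
              ≡⟨ cong (λ x → k * (R true (W v′ ω₀) T + + 2 * x)) (R-sub false (v 0) ω₀ (W v′ ω₁) T) ⟩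
            k * (R true (W v′ ω₀) T + + 2 * (v 0 * R false ω₀ T - R false (W v′ ω₁) T))
              ≡⟨ l₁ k (v 0) (R true (W v′ ω₀) T) (R false ω₀ T) (R false (W v′ ω₁) T) ⟩
            k * R true (W v′ ω₀) T + + 2 * (k * v 0 * R false ω₀ T) - + 2 * (k * R false (W v′ ω₁) T)
              ≡⟨ cong₂ (λ x y → x + + 2 * (k * v 0 * R false ω₀ T) - + 2 * y) I₀.e₁ I₁.e₀ ⟩
            W g′ (R true ω₀) T - c′ * R false ω₀ T + + 2 * (k * v 0 * R false ω₀ T) - + 2 * - W g′ (R false ω₁) T
              ≡⟨ l₂ k c (v 0) (W g′ (R true ω₀) T) (R false ω₀ T) (W g′ (R false ω₁) T) ⟩
            1ℤ * W g′ (R true ω₀) T + + 2 * W g′ (R false ω₁) T - c * R false ω₀ T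
              ≡⟨ cong (_- c * R false ω₀ T) (W-lin g′ 1ℤ (+ 2) (R true ω₀) (R false ω₁) T) ⟨
            W g′ (λ S → 1ℤ * R true ω₀ S + + 2 * R false ω₁ S) T - c * R false ω₀ T
              ≡⟨ cong (_- c * R false ω₀ T)
                   (W-cong g′ (λ S → cong (_+ + 2 * R false ω₁ S) (*-identityˡ (R true ω₀ S))) T) ⟩
            W g′ (λ S → R true ω₀ S + + 2 * R false ω₁ S) T - c * R false ω₀ T ∎
        }
        where
        l₁ : ∀ k v x y z → k * (x + + 2 * (v * y - z)) ≡ k * x + + 2 * (k * v * y) - + 2 * (k * z)
        l₁ = solve-∀
        l₂ : ∀ k c v x y z → x - (c + + 2 * (k * v)) * y + + 2 * (k * v * y) - + 2 * - z
                           ≡ 1ℤ * x + + 2 * z - c * y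
        l₂ = solve-∀
      go true = record
        { e₀ = begin
            k * (R true (W v′ ω₀) T + R false (λ S → v 0 * ω₀ S - W v′ ω₁ S) T)
              ≡⟨ cong (λ x → k * (R true (W v′ ω₀) T + x)) (R-sub false (v 0) ω₀ (W v′ ω₁) T) ⟩
            k * (R true (W v′ ω₀) T + (v 0 * R false ω₀ T - R false (W v′ ω₁) T))
              ≡⟨ l₁ k (v 0) (R true (W v′ ω₀) T) (R false ω₀ T) (R false (W v′ ω₁) T) ⟩
            k * R true (W v′ ω₀) T + k * v 0 * R false ω₀ T - k * R false (W v′ ω₁) T
              ≡⟨ cong₂ (λ x y → x + k * v 0 * R false ω₀ T - y) I₀.e₁ I₁.e₀ ⟩
            W g′ (R true ω₀) T - c′ * R false ω₀ T + k * v 0 * R false ω₀ T - - W g′ (R false ω₁) T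
              ≡⟨ l₂ k c (v 0) (W g′ (R true ω₀) T) (R false ω₀ T) (W g′ (R false ω₁) T) ⟩
            - ((c + k * v 0) * R false ω₀ T - (1ℤ * W g′ (R true ω₀) T + 1ℤ * W g′ (R false ω₁) T))
              ≡⟨ cong₂ (λ x y → - (x * R false ω₀ T - y)) g₀ (W-lin g′ 1ℤ 1ℤ (R true ω₀) (R false ω₁) T) ⟨
            - (g 0 * R false ω₀ T - W g′ (λ S → 1ℤ * R true ω₀ S + 1ℤ * R false ω₁ S) T)
              ≡⟨ cong (λ x → - (g 0 * R false ω₀ T - x))
                   (W-cong g′ (λ S → cong₂ _+_ (*-identityˡ (R true ω₀ S)) (*-identityˡ (R false ω₁ S))) T) ⟩
            - (g 0 * R false ω₀ T - W g′ (λ S → R true ω₀ S + R false ω₁ S) T) ∎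
        ; e₁ = begin
            k * R true (λ S → v 0 * ω₀ S - W v′ ω₁ S) T
              ≡⟨ cong (k *_) (R-sub true (v 0) ω₀ (W v′ ω₁) T) ⟩
            k * (v 0 * R true ω₀ T - R true (W v′ ω₁) T)
              ≡⟨ l₃ k (v 0) (R true ω₀ T) (R true (W v′ ω₁) T) ⟩
            k * v 0 * R true ω₀ T - k * R true (W v′ ω₁) T
              ≡⟨ cong (λ x → k * v 0 * R true ω₀ T - x) I₁.e₁ ⟩
            k * v 0 * R true ω₀ T - (W g′ (R true ω₁) T - c′ * R false ω₁ T)
              ≡⟨ l₄ k c (v 0) (R true ω₀ T) (W g′ (R true ω₁) T) (R false ω₁ T) ⟩
            (c + k * v 0) * (R true ω₀ T + + 2 * R false ω₁ T) - W g′ (R true ω₁) T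
              - c * (R true ω₀ T + R false ω₁ T)
              ≡⟨ cong (λ x → x * (R true ω₀ T + + 2 * R false ω₁ T) - W g′ (R true ω₁) T
                   - c * (R true ω₀ T + R false ω₁ T)) g₀ ⟨
            g 0 * (R true ω₀ T + + 2 * R false ω₁ T) - W g′ (R true ω₁) T
              - c * (R true ω₀ T + R false ω₁ T) ∎
        }
        where
        l₁ : ∀ k v x y z → k * (x + (v * y - z)) ≡ k * x + k * v * y - k * z
        l₁ = solve-∀
        l₂ : ∀ k c v x y z → x - (c + + 2 * (k * v)) * y + k * v * y - - z
                           ≡ - ((c + k * v) * y - (1ℤ * x + 1ℤ * z))
        l₂ = solve-∀
        l₃ : ∀ k v x y → k * (v * x - y) ≡ k * v * x - k * y
        l₃ = solve-∀
        l₄ : ∀ k c v x y z → k * v * x - (y - (c + + 2 * (k * v)) * z)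
                           ≡ (c + k * v) * (x + + 2 * z) - y - c * (x + z)
        l₄ = solve-∀

  -- Pairing of functionals on states with the exterior algebra

  pair : ∀ {n} → (State n → ℕ) → Ω n → ℤ
  pair {zero}  f ω = + f [] * ω []
  pair {suc n} f ω = pair (f at false) (ω at false) + pair (f at true) (ω at true)

  pair-cong : ∀ {n} {f g : State n → ℕ} {ω η : Ω n} → (∀ S → f S ≡ g S) → (∀ S → ω S ≡ η S) → pair f ω ≡ pair g η
  pair-cong {zero}  e d = cong₂ (λ x y → + x * y) (e []) (d [])
  pair-cong {suc n} e d =
    cong₂ _+_ (pair-cong (λ S → e (false ∷ S)) (λ S → d (false ∷ S))) (pair-cong (λ S → e (true ∷ S)) (λ S → d (true ∷ S)))

  pair-linˡ : ∀ {n} a (f g : State n → ℕ) (ω : Ω n) →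
              pair (λ S → a ℕ.* f S ℕ.+ g S) ω ≡ + a * pair f ω + pair g ω
  pair-linˡ {zero} a f g ω = begin
    + (a ℕ.* f [] ℕ.+ g []) * ω []            ≡⟨ cong (_* ω []) (pos-+ (a ℕ.* f []) (g [])) ⟩
    (+ (a ℕ.* f []) + + g []) * ω []          ≡⟨ cong (λ x → (x + + g []) * ω []) (pos-* a (f [])) ⟩
    (+ a * + f [] + + g []) * ω []            ≡⟨ lemma (+ a) (+ f []) (+ g []) (ω []) ⟩
    + a * (+ f [] * ω []) + + g [] * ω []     ∎
    where
    open ≡-Reasoning
    lemma : ∀ a x y w → (a * x + y) * w ≡ a * (x * w) + y * w
    lemma = solve-∀
  pair-linˡ {suc n} a f g ω
    rewrite pair-linˡ a (f at false) (g at false) (ω at false) | pair-linˡ a (f at true) (g at true) (ω at true) =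
    lemma (+ a) (pair (f at false) (ω at false)) (pair (g at false) (ω at false))
                (pair (f at true) (ω at true)) (pair (g at true) (ω at true))
    where
    lemma : ∀ a x y z w → a * x + y + (a * z + w) ≡ a * (x + z) + (y + w)
    lemma = solve-∀

  pair-+ˡ : ∀ {n} (f g : State n → ℕ) (ω : Ω n) → pair (λ S → f S ℕ.+ g S) ω ≡ pair f ω + pair g ω
  pair-+ˡ f g ω = begin
    pair (λ S → f S ℕ.+ g S) ω          ≡⟨ pair-cong (λ S → cong (ℕ._+ g S) (sym (ℕₚ.*-identityˡ (f S)))) (λ _ → refl) ⟩
    pair (λ S → 1 ℕ.* f S ℕ.+ g S) ω    ≡⟨ pair-linˡ 1 f g ω ⟩
    1ℤ * pair f ω + pair g ω            ≡⟨ cong (_+ pair g ω) (*-identityˡ (pair f ω)) ⟩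
    pair f ω + pair g ω                 ∎
    where open ≡-Reasoning

  pair-linʳ : ∀ {n} a (f : State n → ℕ) (ω η : Ω n) → pair f (λ S → ω S + a * η S) ≡ pair f ω + a * pair f η
  pair-linʳ {zero} a f ω η = lemma (+ f []) a (ω []) (η [])
    where
    lemma : ∀ f a x y → f * (x + a * y) ≡ f * x + a * (f * y)
    lemma = solve-∀
  pair-linʳ {suc n} a f ω η
    rewrite pair-linʳ a (f at false) (ω at false) (η at false) | pair-linʳ a (f at true) (ω at true) (η at true) =
    lemma a (pair (f at false) (ω at false)) (pair (f at false) (η at false))
            (pair (f at true) (ω at true)) (pair (f at true) (η at true))
    where
    lemma : ∀ a x y z w → x + a * y + (z + a * w) ≡ x + z + a * (y + w)
    lemma = solve-∀

  pair-+ʳ : ∀ {n} (f : State n → ℕ) (ω η : Ω n) → pair f (λ S → ω S + η S) ≡ pair f ω + pair f η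
  pair-+ʳ f ω η = begin
    pair f (λ S → ω S + η S)          ≡⟨ pair-cong (λ _ → refl) (λ S → cong (λ x → ω S + x) (sym (*-identityˡ (η S)))) ⟩
    pair f (λ S → ω S + 1ℤ * η S)     ≡⟨ pair-linʳ 1ℤ f ω η ⟩
    pair f ω + 1ℤ * pair f η          ≡⟨ cong (λ x → pair f ω + x) (*-identityˡ (pair f η)) ⟩
    pair f ω + pair f η               ∎
    where open ≡-Reasoning

  pair-zero : ∀ {n} (f : State n → ℕ) → pair f (λ _ → 0ℤ) ≡ 0ℤ
  pair-zero {zero}  f = *-zeroʳ (+ f [])
  pair-zero {suc n} f = cong₂ _+_ (pair-zero (f at false)) (pair-zero (f at true))

  pair-zeroˡ : ∀ {n} (ω : Ω n) → pair (λ _ → 0) ω ≡ 0ℤ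
  pair-zeroˡ {zero}  ω = refl
  pair-zeroˡ {suc n} ω = cong₂ _+_ (pair-zeroˡ (ω at false)) (pair-zeroˡ (ω at true))

  pair-D : ∀ {n} h (f : State n → ℕ) (ω : Ω n) → pair (D h f) ω ≡ pair f (R h ω)
  pair-D {zero} true  f ω = refl
  pair-D {zero} false f ω = sym (*-zeroʳ (+ f []))
  pair-D {suc n} false f ω = begin
    pair (λ S → D false f₀ S ℕ.+ D true f₁ S) ω₀ + pair (D false f₁) ω₁
      ≡⟨ cong (_+ pair (D false f₁) ω₁) (pair-+ˡ (D false f₀) (D true f₁) ω₀) ⟩
    pair (D false f₀) ω₀ + pair (D true f₁) ω₀ + pair (D false f₁) ω₁
      ≡⟨ cong₂ _+_ (cong₂ _+_ (pair-D false f₀ ω₀) (pair-D true f₁ ω₀)) (pair-D false f₁ ω₁) ⟩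
    pair f₀ (R false ω₀) + pair f₁ (R true ω₀) + pair f₁ (R false ω₁)
      ≡⟨ +-assoc (pair f₀ (R false ω₀)) _ _ ⟩
    pair f₀ (R false ω₀) + (pair f₁ (R true ω₀) + pair f₁ (R false ω₁))
      ≡⟨ cong (λ x → pair f₀ (R false ω₀) + x) (pair-+ʳ f₁ (R true ω₀) (R false ω₁)) ⟨
    pair f₀ (R false ω₀) + pair f₁ (λ S → R true ω₀ S + R false ω₁ S) ∎
    where
    open ≡-Reasoning
    f₀ = f at false
    f₁ = f at true
    ω₀ = ω at false
    ω₁ = ω at true
  pair-D {suc n} true f ω = begin
    pair (D true f₀) ω₀ + pair (λ S → 2 ℕ.* D false f₀ S ℕ.+ D true f₁ S) ω₁
      ≡⟨ cong (λ x → pair (D true f₀) ω₀ + x) (pair-linˡ 2 (D false f₀) (D true f₁) ω₁) ⟩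
    pair (D true f₀) ω₀ + (+ 2 * pair (D false f₀) ω₁ + pair (D true f₁) ω₁)
      ≡⟨ cong₂ _+_ (pair-D true f₀ ω₀) (cong₂ (λ x y → + 2 * x + y) (pair-D false f₀ ω₁) (pair-D true f₁ ω₁)) ⟩
    pair f₀ (R true ω₀) + (+ 2 * pair f₀ (R false ω₁) + pair f₁ (R true ω₁))
      ≡⟨ +-assoc (pair f₀ (R true ω₀)) _ _ ⟨
    pair f₀ (R true ω₀) + + 2 * pair f₀ (R false ω₁) + pair f₁ (R true ω₁)
      ≡⟨ cong (_+ pair f₁ (R true ω₁)) (pair-linʳ (+ 2) f₀ (R true ω₀) (R false ω₁)) ⟨
    pair f₀ (λ S → R true ω₀ S + + 2 * R false ω₁ S) + pair f₁ (R true ω₁) ∎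
    where
    open ≡-Reasoning
    f₀ = f at false
    f₁ = f at true
    ω₀ = ω at false
    ω₁ = ω at true

  δ : ∀ {n} → Ω n
  δ []          = 1ℤ
  δ (false ∷ S) = δ S
  δ (true ∷ S)  = 0ℤ

  pair-δ : ∀ {n} (f : State n → ℕ) → pair f δ ≡ + f empty
  pair-δ {zero}  f = *-identityʳ (+ f [])
  pair-δ {suc n} f = trans (cong₂ _+_ (pair-δ (f at false)) (pair-zero (f at true))) (+-identityʳ _)

  iterR : ∀ {n} → ℕ → Ω n → Ω n
  iterR zero    ω = ω
  iterR (suc k) ω = R false (iterR k ω)

  iterR-R : ∀ {n} k (ω : Ω n) S → iterR k (R false ω) S ≡ iterR (suc k) ω S
  iterR-R zero    ω S = refl
  iterR-R (suc k) ω S = R-cong false (iterR-R k ω) S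

  pair-iterD : ∀ {n} k (f : State n → ℕ) (ω : Ω n) → pair (iterD k f) ω ≡ pair f (iterR k ω)
  pair-iterD zero    f ω = refl
  pair-iterD (suc k) f ω = begin
    pair (D false (iterD k f)) ω    ≡⟨ pair-D false (iterD k f) ω ⟩
    pair (iterD k f) (R false ω)    ≡⟨ pair-iterD k f (R false ω) ⟩
    pair f (iterR k (R false ω))    ≡⟨ pair-cong (λ _ → refl) (iterR-R k ω) ⟩
    pair f (iterR (suc k) ω)        ∎
    where open ≡-Reasoning

  -- The wedge of polynomials produced by successive rows

  Ψ : ∀ {n} → (ℕ → ℕ → ℤ) → ℕ → Ω n
  Ψ F zero    = δ
  Ψ F (suc k) = W (F k) (Ψ F k)

  Ψ-cong : ∀ {n} {F G : ℕ → ℕ → ℤ} → (∀ i t → F i t ≡ G i t) → ∀ k (S : State n) → Ψ F k S ≡ Ψ G k S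
  Ψ-cong e zero    S = refl
  Ψ-cong {F = F} {G} e (suc k) S = trans (W-cong (F k) (Ψ-cong e k) S) (W-congˡ (e k) (Ψ G k) S)

  R-zero : ∀ {n} h (T : State n) → R h (λ _ → 0ℤ) T ≡ 0ℤ
  R-zero false []          = refl
  R-zero true  []          = refl
  R-zero false (false ∷ T) = R-zero false T
  R-zero false (true ∷ T)  = cong₂ _+_ (R-zero true T) (R-zero false T)
  R-zero true  (false ∷ T) = cong₂ (λ x y → x + + 2 * y) (R-zero true T) (R-zero false T)
  R-zero true  (true ∷ T)  = R-zero true T

  R-true-δ : ∀ {n} (T : State n) → R true δ T ≡ δ T
  R-true-δ []          = refl
  R-true-δ (false ∷ T) = trans (cong₂ (λ x y → x + + 2 * y) (R-true-δ T) (R-zero false T)) (+-identityʳ _)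
  R-true-δ (true ∷ T)  = R-zero true T

  -- The first row has a single entry 1, in an arbitrary column; this is the origin of the factor 1
  -- that every row adds.
  R-δ : ∀ {n} (T : State n) → R false δ T ≡ W (λ _ → 1ℤ) δ T
  R-δ []          = refl
  R-δ (false ∷ T) = R-δ T
  R-δ (true ∷ T)
    rewrite R-true-δ T | R-zero false T | W-zero (λ _ → 1ℤ) T | *-identityˡ (δ T) = refl

  -- i ! times the coefficient of zⁱ in (1 + z)ᵗ / (1 - z)ᵗ⁺¹, as a polynomial in
  -- Y = 2 t + 1.
  poly : ℕ → ℤ → ℤ
  poly zero          Y = 1ℤ
  poly (suc zero)    Y = Y
  poly (suc (suc i)) Y = Y * poly (suc i) Y + + suc i * + suc i * poly i Y

  -- With `f_t = (1 + z)ᵗ / (1 - z)ᵗ⁺¹` this compares coefficients in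
  -- `(1 - z) f_t = (1 + z) f_(t-1)`. In the proof, the defect of the identity at one index is a
  -- combination of its defects at the two preceding indices.
  poly-step : ∀ i Y → poly (suc i) Y ≡ poly (suc i) (Y - + 2) + + suc i * (poly i Y + poly i (Y - + 2))
  poly-step zero Y = lemma Y
    where
    lemma : ∀ Y → Y ≡ Y - + 2 + 1ℤ * (1ℤ + 1ℤ)
    lemma = solve-∀
  poly-step (suc zero) Y = lemma Y
    where
    lemma : ∀ Y → Y * Y + 1ℤ * 1ℤ * 1ℤ ≡ (Y - + 2) * (Y - + 2) + 1ℤ * 1ℤ * 1ℤ + + 2 * (Y + (Y - + 2))
    lemma = solve-∀
  poly-step (suc (suc i)) Y = i-j≡0⇒i≡j _ _ (begin
    Y * c₁ + s * s * c - ((Y - + 2) * d₁ + s * s * d + (1ℤ + s) * (c₁ + d₁))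
      ≡⟨ lemma Y (+ i) (poly i Y) (poly i Z) c d ⟩
    (s * (+ 1 + + i)) * (c - (d + (1ℤ + + i) * (poly i Y + poly i Z))) + (Y - 1ℤ) * (c₁ - (d₁ + s * (c + d)))
      ≡⟨ cong₂ (λ x y → (s * (+ 1 + + i)) * x + (Y - 1ℤ) * y)
           (i≡j⇒i-j≡0 {c} (poly-step i Y)) (i≡j⇒i-j≡0 {c₁} (poly-step (suc i) Y)) ⟩
    (s * (+ 1 + + i)) * 0ℤ + (Y - 1ℤ) * 0ℤ
      ≡⟨ cong₂ _+_ (*-zeroʳ (s * (+ 1 + + i))) (*-zeroʳ (Y - 1ℤ)) ⟩
    0ℤ ∎)
    where
    open ≡-Reasoning
    s = 1ℤ + (1ℤ + + i)
    Z = Y - + 2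
    c = poly (suc i) Y
    d = poly (suc i) Z
    c₁ = poly (suc (suc i)) Y
    d₁ = poly (suc (suc i)) Z
    lemma : ∀ Y i a b c d → let s = 1ℤ + (1ℤ + i) ; c₁ = Y * c + (1ℤ + i) * (1ℤ + i) * a ; d₁ = (Y - + 2) * d + (1ℤ + i) * (1ℤ + i) * b in
      Y * c₁ + s * s * c - ((Y - + 2) * d₁ + s * s * d + (1ℤ + s) * (c₁ + d₁))
      ≡ (s * (1ℤ + i)) * (c - (d + (1ℤ + i) * (a + b))) + (Y - 1ℤ) * (c₁ - (d₁ + s * (c + d)))
    lemma = solve-∀

  -- The recursion changes `y`, so that dropping the first column turns `F y i` into `F (y - 2) i`
  -- by computation.
  abscissa : ℤ → ℕ → ℤ
  abscissa y zero    = y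
  abscissa y (suc t) = abscissa (y - + 2) t

  abscissa-suc : ∀ y t → abscissa y (suc t) ≡ abscissa y t - + 2
  abscissa-suc y zero    = refl
  abscissa-suc y (suc t) = abscissa-suc (y - + 2) t

  F : ℤ → ℕ → ℕ → ℤ
  F y i t = poly i (abscissa y t)

  -- By `poly-step`, a trapezoidal sum of `poly i` is `poly (suc i)` up to the factor `suc i`.
  -- Abscissae fall as columns advance, whence the multiplier `- suc i`, whose sign cancels the one
  -- in `e₀`.
  R-W-F : ∀ {n} y i (ω : Ω n) T → + suc i * R false (W (F y i) ω) T ≡ W (F y (suc i)) (R false ω) T
  R-W-F y i ω T = neg-injective (begin
    - (+ suc i * R false (W (F y i) ω) T)      ≡⟨ neg-distribˡ-* (+ suc i) _ ⟩
    - + suc i * R false (W (F y i) ω) T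
      ≡⟨ RW.e₀ (R-W (- + suc i) (F y (suc i) 0 - (- + suc i) * F y i 0) (F y i) (F y (suc i)) start step ω T) ⟩
    - W (F y (suc i)) (R false ω) T            ∎)
    where
    open ≡-Reasoning
    -- The only demand on the constant `c`; it can be met for every centre `y`.
    start : F y (suc i) 0 ≡ F y (suc i) 0 - (- + suc i) * F y i 0 + (- + suc i) * F y i 0
    start = lemma (F y (suc i) 0) ((- + suc i) * F y i 0)
      where
      lemma : ∀ x z → x ≡ x - z + z
      lemma = solve-∀
    step : ∀ t → F y (suc i) (suc t) ≡ F y (suc i) t + (- + suc i) * (F y i t + F y i (suc t))
    step t rewrite abscissa-suc y t = begin
      g                                            ≡⟨ lemma g (+ suc i) (p + q) ⟩
      g + + suc i * (p + q) + (- + suc i) * (p + q) ≡⟨ cong (_+ (- + suc i) * (p + q)) (poly-step i (abscissa y t)) ⟨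
      F y (suc i) t + (- + suc i) * (p + q)        ∎
      where
      g = poly (suc i) (abscissa y t - + 2)
      p = poly i (abscissa y t)
      q = poly i (abscissa y t - + 2)
      lemma : ∀ g k z → g ≡ g + k * z + (- k) * z
      lemma = solve-∀

  W-* : ∀ {n} v a (ω : Ω n) S → W v (λ T → a * ω T) S ≡ a * W v ω S
  W-* v a ω S = begin
    W v (λ T → a * ω T) S               ≡⟨ W-cong v (λ T → lemma (a * ω T) (ω T)) S ⟩
    W v (λ T → a * ω T + 0ℤ * ω T) S    ≡⟨ W-lin v a 0ℤ ω ω S ⟩
    a * W v ω S + 0ℤ * W v ω S          ≡⟨ lemma (a * W v ω S) (W v ω S) ⟨
    a * W v ω S                         ∎
    where
    open ≡-Reasoning
    lemma : ∀ x y → x ≡ x + 0ℤ * y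
    lemma = solve-∀

  -- Each factor `F y i` becomes `F y (suc i)` at the cost of `suc i`, these costs multiply to
  -- `k !`, and the new row contributes `F y 0`.
  R-Ψ : ∀ {n} y k (T : State n) → + (k !) * R false (Ψ (F y) k) T ≡ Ψ (F y) (suc k) T
  R-Ψ y zero    T = trans (*-identityˡ _) (R-δ T)
  R-Ψ y (suc k) T = begin
    + (suc k ℕ.* k !) * R false (W (F y k) (Ψ (F y) k)) T
      ≡⟨ cong (_* R false (W (F y k) (Ψ (F y) k)) T) (trans (pos-* (suc k) (k !)) (*-comm (+ suc k) (+ (k !)))) ⟩
    + (k !) * + suc k * R false (W (F y k) (Ψ (F y) k)) T
      ≡⟨ *-assoc (+ (k !)) (+ suc k) _ ⟩
    + (k !) * (+ suc k * R false (W (F y k) (Ψ (F y) k)) T)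
      ≡⟨ cong (+ (k !) *_) (R-W-F y k (Ψ (F y) k) T) ⟩
    + (k !) * W (F y (suc k)) (R false (Ψ (F y) k)) T
      ≡⟨ W-* (F y (suc k)) (+ (k !)) (R false (Ψ (F y) k)) T ⟨
    W (F y (suc k)) (λ S → + (k !) * R false (Ψ (F y) k) S) T
      ≡⟨ W-cong (F y (suc k)) (R-Ψ y k) T ⟩
    W (F y (suc k)) (Ψ (F y) (suc k)) T ∎
    where open ≡-Reasoning

  superfactorial : ℕ → ℕ
  superfactorial zero    = 1
  superfactorial (suc k) = k ! ℕ.* superfactorial k

  -- The left side does not involve `y`: the wedge does not see where the polynomials are centred,
  -- and `selected` exploits this freedom.
  iterR-δ : ∀ {n} y k (T : State n) → + superfactorial k * iterR k δ T ≡ Ψ (F y) k T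
  iterR-δ y zero    T = *-identityˡ _
  iterR-δ y (suc k) T = begin
    + (k ! ℕ.* superfactorial k) * R false (iterR k δ) T
      ≡⟨ cong (_* R false (iterR k δ) T) (pos-* (k !) (superfactorial k)) ⟩
    + (k !) * + superfactorial k * R false (iterR k δ) T
      ≡⟨ *-assoc (+ (k !)) _ _ ⟩
    + (k !) * (+ superfactorial k * R false (iterR k δ) T)
      ≡⟨ cong (+ (k !) *_) (R-* false (+ superfactorial k) (iterR k δ) T) ⟨
    + (k !) * R false (λ S → + superfactorial k * iterR k δ S) T
      ≡⟨ cong (+ (k !) *_) (R-cong false (iterR-δ y k) T) ⟩
    + (k !) * R false (Ψ (F y) k) T
      ≡⟨ R-Ψ y k T ⟩
    Ψ (F y) (suc k) T ∎
    where open ≡-Reasoning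

  -- Signs and the folding of mirror columns

  χ : ℕ → ℤ
  χ zero    = 1ℤ
  χ (suc m) = - χ m

  sgn : ∀ {n} → State n → ℤ
  sgn []          = 1ℤ
  sgn (false ∷ S) = sgn S
  sgn (true ∷ S)  = - sgn S

  χ-square : ∀ m → χ m * χ m ≡ 1ℤ
  χ-square zero    = refl
  χ-square (suc m) = trans (lemma (χ m)) (χ-square m)
    where
    lemma : ∀ x → - x * - x ≡ x * x
    lemma = solve-∀

  sgn-square : ∀ {n} (S : State n) → sgn S * sgn S ≡ 1ℤ
  sgn-square []          = refl
  sgn-square (false ∷ S) = sgn-square S
  sgn-square (true ∷ S)  = trans (lemma (sgn S)) (sgn-square S)
    where
    lemma : ∀ x → - x * - x ≡ x * x
    lemma = solve-∀

  sgn-∷ʳ-false : ∀ {n} (S : State n) → sgn (S ∷ʳ false) ≡ sgn S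
  sgn-∷ʳ-false []          = refl
  sgn-∷ʳ-false (false ∷ S) = sgn-∷ʳ-false S
  sgn-∷ʳ-false (true ∷ S)  = cong -_ (sgn-∷ʳ-false S)

  sgn-∷ʳ-true : ∀ {n} (S : State n) → sgn (S ∷ʳ true) ≡ - sgn S
  sgn-∷ʳ-true []          = refl
  sgn-∷ʳ-true (false ∷ S) = sgn-∷ʳ-true S
  sgn-∷ʳ-true (true ∷ S)  = cong -_ (sgn-∷ʳ-true S)

  W-∷ʳ-false : ∀ {n} v (ω : Ω (suc n)) S → W v ω (S ∷ʳ false) ≡ W v (λ T → ω (T ∷ʳ false)) S
  W-∷ʳ-false v ω []          = refl
  W-∷ʳ-false v ω (false ∷ S) = W-∷ʳ-false (v ∘ suc) (ω at false) S
  W-∷ʳ-false v ω (true ∷ S)  = cong (λ x → v 0 * ω (false ∷ (S ∷ʳ false)) - x) (W-∷ʳ-false (v ∘ suc) (ω at true) S)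

  -- The sign `sgn S` is that of moving the last unit vector past the factors in `S`.
  W-∷ʳ-true : ∀ {n} v (ω : Ω (suc n)) S →
              W v ω (S ∷ʳ true) ≡ W v (λ T → ω (T ∷ʳ true)) S + v n * (sgn S * ω (S ∷ʳ false))
  W-∷ʳ-true v ω [] = lemma (v 0) (ω (false ∷ []))
    where
    lemma : ∀ x y → x * y - 0ℤ ≡ 0ℤ + x * (1ℤ * y)
    lemma = solve-∀
  W-∷ʳ-true v ω (false ∷ S) = W-∷ʳ-true (v ∘ suc) (ω at false) S
  W-∷ʳ-true {suc n} v ω (true ∷ S)
    rewrite W-∷ʳ-true (v ∘ suc) (ω at true) S =
    lemma (v 0 * ω (false ∷ (S ∷ʳ true))) (W (v ∘ suc) (λ T → ω (true ∷ (T ∷ʳ true))) S)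
          (v (suc n)) (sgn S) (ω (true ∷ (S ∷ʳ false)))
    where
    lemma : ∀ x y v s z → x - (y + v * (s * z)) ≡ x - y + v * (- s * z)
    lemma = solve-∀

  W-sgn : ∀ {n} v (ω : Ω n) S → W v (λ T → sgn T * ω T) S ≡ - (sgn S * W v ω S)
  W-sgn v ω []          = refl
  W-sgn v ω (false ∷ S) = W-sgn (v ∘ suc) (ω at false) S
  W-sgn v ω (true ∷ S)  = begin
    v 0 * (sgn S * ω₀) - W v′ (λ T → - sgn T * ω (true ∷ T)) S
      ≡⟨ cong (λ x → v 0 * (sgn S * ω₀) - x) (W-cong v′ (λ T → l₁ (sgn T) (ω (true ∷ T))) S) ⟩
    v 0 * (sgn S * ω₀) - W v′ (λ T → -1ℤ * (sgn T * ω (true ∷ T))) S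
      ≡⟨ cong (λ x → v 0 * (sgn S * ω₀) - x) (W-* v′ -1ℤ (λ T → sgn T * ω (true ∷ T)) S) ⟩
    v 0 * (sgn S * ω₀) - -1ℤ * W v′ (λ T → sgn T * ω (true ∷ T)) S
      ≡⟨ cong (λ x → v 0 * (sgn S * ω₀) - -1ℤ * x) (W-sgn v′ (ω at true) S) ⟩
    v 0 * (sgn S * ω₀) - -1ℤ * - (sgn S * W v′ (ω at true) S)
      ≡⟨ l₂ (v 0) (sgn S) ω₀ (W v′ (ω at true) S) ⟩
    - (- sgn S * (v 0 * ω₀ - W v′ (ω at true) S)) ∎
    where
    open ≡-Reasoning
    v′ = v ∘ suc
    ω₀ = ω (false ∷ S)
    l₁ : ∀ s x → - s * x ≡ -1ℤ * (s * x)
    l₁ = solve-∀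
    l₂ : ∀ v s x y → v * (s * x) - -1ℤ * - (s * y) ≡ - (- s * (v * x - y))
    l₂ = solve-∀

  inner : ∀ {X : Set} {n} → (State (suc (suc n)) → X) → Bool → Bool → State n → X
  inner ω a b I = ω (a ∷ (I ∷ʳ b))

  -- The map of exterior algebras induced by fold, which merges the columns j and
  -- n - 1 - j. The sign makes every choice of one column per pair count +1 at full.
  Fold : ∀ m → Ω (double m) → Ω m
  Fold zero    ω []          = ω []
  Fold (suc m) ω (false ∷ U) = Fold m (inner ω false false) U
  Fold (suc m) ω (true ∷ U)  = Fold m (inner ω true false) U + χ m * (sgn U * Fold m (inner ω false true) U)

  Fold-cong : ∀ m {ω η : Ω (double m)} → (∀ S → ω S ≡ η S) → ∀ U → Fold m ω U ≡ Fold m η U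
  Fold-cong zero    e []          = e []
  Fold-cong (suc m) e (false ∷ U) = Fold-cong m (λ I → e (false ∷ (I ∷ʳ false))) U
  Fold-cong (suc m) e (true ∷ U)  =
    cong₂ (λ x y → x + χ m * (sgn U * y)) (Fold-cong m (λ I → e (true ∷ (I ∷ʳ false))) U)
                                          (Fold-cong m (λ I → e (false ∷ (I ∷ʳ true))) U)

  Fold-lin : ∀ m a b (ω η : Ω (double m)) U → Fold m (λ S → a * ω S + b * η S) U ≡ a * Fold m ω U + b * Fold m η U
  Fold-lin zero    a b ω η []          = refl
  Fold-lin (suc m) a b ω η (false ∷ U) = Fold-lin m a b (inner ω false false) (inner η false false) U
  Fold-lin (suc m) a b ω η (true ∷ U)
    rewrite Fold-lin m a b (inner ω true false) (inner η true false) U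
          | Fold-lin m a b (inner ω false true) (inner η false true) U =
    lemma a b (χ m) (sgn U) (Fold m (inner ω true false) U) (Fold m (inner η true false) U)
                            (Fold m (inner ω false true) U) (Fold m (inner η false true) U)
    where
    lemma : ∀ a b k s x y z w → a * x + b * y + k * (s * (a * z + b * w)) ≡ a * (x + k * (s * z)) + b * (y + k * (s * w))
    lemma = solve-∀

  Fold-sgn : ∀ m (ω : Ω (double m)) U → Fold m (λ S → sgn S * ω S) U ≡ sgn U * Fold m ω U
  Fold-sgn zero    ω []          = refl
  Fold-sgn (suc m) ω (false ∷ U) =
    trans (Fold-cong m (λ I → cong (_* inner ω false false I) (sgn-∷ʳ-false I)) U) (Fold-sgn m (inner ω false false) U)
  Fold-sgn (suc m) ω (true ∷ U)  = begin
    Fold m (λ I → - sgn (I ∷ʳ false) * ω₁₀ I) U + χ m * (sgn U * Fold m (λ I → sgn (I ∷ʳ true) * ω₀₁ I) U)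
      ≡⟨ cong₂ (λ x y → x + χ m * (sgn U * y))
           (Fold-cong m (λ I → cong (λ x → - x * ω₁₀ I) (sgn-∷ʳ-false I)) U)
           (Fold-cong m (λ I → cong (_* ω₀₁ I) (sgn-∷ʳ-true I)) U) ⟩
    Fold m (λ I → - sgn I * ω₁₀ I) U + χ m * (sgn U * Fold m (λ I → - sgn I * ω₀₁ I) U)
      ≡⟨ cong₂ (λ x y → x + χ m * (sgn U * y)) (negated ω₁₀) (negated ω₀₁) ⟩
    - (sgn U * Fold m ω₁₀ U) + χ m * (sgn U * - (sgn U * Fold m ω₀₁ U))
      ≡⟨ lemma (χ m) (sgn U) (Fold m ω₁₀ U) (Fold m ω₀₁ U) ⟩
    - sgn U * (Fold m ω₁₀ U + χ m * (sgn U * Fold m ω₀₁ U)) ∎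
    where
    open ≡-Reasoning
    ω₁₀ = inner ω true false
    ω₀₁ = inner ω false true
    lemma : ∀ k s x y → - (s * x) + k * (s * - (s * y)) ≡ - s * (x + k * (s * y))
    lemma = solve-∀
    l₁ : ∀ s x → - s * x ≡ -1ℤ * (s * x) + 0ℤ * x
    l₁ = solve-∀
    l₂ : ∀ s x → -1ℤ * (s * x) + 0ℤ * x ≡ - (s * x)
    l₂ = solve-∀
    negated : ∀ η → Fold m (λ I → - sgn I * η I) U ≡ - (sgn U * Fold m η U)
    negated η = begin
      Fold m (λ I → - sgn I * η I) U
        ≡⟨ Fold-cong m (λ I → l₁ (sgn I) (η I)) U ⟩
      Fold m (λ I → -1ℤ * (sgn I * η I) + 0ℤ * η I) U
        ≡⟨ Fold-lin m -1ℤ 0ℤ (λ I → sgn I * η I) η U ⟩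
      -1ℤ * Fold m (λ I → sgn I * η I) U + 0ℤ * Fold m η U
        ≡⟨ cong (λ x → -1ℤ * x + 0ℤ * Fold m η U) (Fold-sgn m η U) ⟩
      -1ℤ * (sgn U * Fold m η U) + 0ℤ * Fold m η U
        ≡⟨ l₂ (sgn U) (Fold m η U) ⟩
      - (sgn U * Fold m η U) ∎

  fold : ℕ → (ℕ → ℤ) → ℕ → ℤ
  fold zero    v t       = 0ℤ
  fold (suc m) v zero    = v 0 + χ m * v (suc (double m))
  fold (suc m) v (suc t) = fold m (v ∘ suc) t

  -- A map of exterior algebras respects left multiplication. When `v` hits the last column, the
  -- sign of moving that unit vector past the factors in `U` meets the sign built into `Fold`, and
  -- the two square to 1.
  Fold-W : ∀ m v (ω : Ω (double m)) U → Fold m (W v ω) U ≡ W (fold m v) (Fold m ω) U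
  Fold-W zero    v ω []          = refl
  Fold-W (suc m) v ω (false ∷ U) =
    trans (Fold-cong m (W-∷ʳ-false (v ∘ suc) (ω at false)) U) (Fold-W m (v ∘ suc) (inner ω false false) U)
  Fold-W (suc m) v ω (true ∷ U)  = begin
    Fold m (λ I → v 0 * ω₀₀ I - W v′ (ω at true) (I ∷ʳ false)) U
      + χ m * (sgn U * Fold m (λ I → W v′ (ω at false) (I ∷ʳ true)) U)
      ≡⟨ cong₂ (λ x y → x + χ m * (sgn U * y)) first second ⟩
    v 0 * X - W w (Fold m ω₁₀) U + χ m * (sgn U * (W w (Fold m ω₀₁) U + v n * (sgn U * X)))
      ≡⟨ l₁ (v 0) X (W w (Fold m ω₁₀) U) (χ m) (sgn U) (W w (Fold m ω₀₁) U) (v n) ⟩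
    v 0 * X - W w (Fold m ω₁₀) U + χ m * (sgn U * W w (Fold m ω₀₁) U) + χ m * v n * X * (sgn U * sgn U)
      ≡⟨ cong (λ x → v 0 * X - W w (Fold m ω₁₀) U + χ m * (sgn U * W w (Fold m ω₀₁) U) + χ m * v n * X * x) (sgn-square U) ⟩
    v 0 * X - W w (Fold m ω₁₀) U + χ m * (sgn U * W w (Fold m ω₀₁) U) + χ m * v n * X * 1ℤ
      ≡⟨ l₂ (v 0) X (W w (Fold m ω₁₀) U) (χ m) (sgn U * W w (Fold m ω₀₁) U) (v n) ⟩
    (v 0 + χ m * v n) * X - (1ℤ * W w (Fold m ω₁₀) U + χ m * - (sgn U * W w (Fold m ω₀₁) U))
      ≡⟨ cong (λ x → (v 0 + χ m * v n) * X - x) third ⟨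
    (v 0 + χ m * v n) * X - W w (λ S → Fold m ω₁₀ S + χ m * (sgn S * Fold m ω₀₁ S)) U ∎
    where
    open ≡-Reasoning
    n = suc (double m)
    v′ = v ∘ suc
    w = fold m v′
    ω₀₀ = inner ω false false
    ω₁₀ = inner ω true false
    ω₀₁ = inner ω false true
    X = Fold m ω₀₀ U
    l₀ : ∀ x y → x - y ≡ x + -1ℤ * y
    l₀ = solve-∀
    l₁ : ∀ a x y k s z b → a * x - y + k * (s * (z + b * (s * x))) ≡ a * x - y + k * (s * z) + k * b * x * (s * s)
    l₁ = solve-∀
    l₂ : ∀ a x y k z b → a * x - y + k * z + k * b * x * 1ℤ ≡ (a + k * b) * x - (1ℤ * y + k * - z)
    l₂ = solve-∀
    first : Fold m (λ I → v 0 * ω₀₀ I - W v′ (ω at true) (I ∷ʳ false)) U ≡ v 0 * X - W w (Fold m ω₁₀) U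
    first = begin
      Fold m (λ I → v 0 * ω₀₀ I - W v′ (ω at true) (I ∷ʳ false)) U
        ≡⟨ Fold-cong m (λ I → trans (cong (λ x → v 0 * ω₀₀ I - x) (W-∷ʳ-false v′ (ω at true) I))
                                    (l₀ (v 0 * ω₀₀ I) (W v′ ω₁₀ I))) U ⟩
      Fold m (λ I → v 0 * ω₀₀ I + -1ℤ * W v′ ω₁₀ I) U
        ≡⟨ Fold-lin m (v 0) -1ℤ ω₀₀ (W v′ ω₁₀) U ⟩
      v 0 * X + -1ℤ * Fold m (W v′ ω₁₀) U
        ≡⟨ l₀ (v 0 * X) (Fold m (W v′ ω₁₀) U) ⟨
      v 0 * X - Fold m (W v′ ω₁₀) U
        ≡⟨ cong (λ x → v 0 * X - x) (Fold-W m v′ ω₁₀ U) ⟩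
      v 0 * X - W w (Fold m ω₁₀) U ∎
    second : Fold m (λ I → W v′ (ω at false) (I ∷ʳ true)) U ≡ W w (Fold m ω₀₁) U + v n * (sgn U * X)
    second = begin
      Fold m (λ I → W v′ (ω at false) (I ∷ʳ true)) U
        ≡⟨ Fold-cong m (λ I → trans (W-∷ʳ-true v′ (ω at false) I)
                                    (cong (_+ v n * (sgn I * ω₀₀ I)) (sym (*-identityˡ (W v′ ω₀₁ I))))) U ⟩
      Fold m (λ I → 1ℤ * W v′ ω₀₁ I + v n * (sgn I * ω₀₀ I)) U
        ≡⟨ Fold-lin m 1ℤ (v n) (W v′ ω₀₁) (λ I → sgn I * ω₀₀ I) U ⟩
      1ℤ * Fold m (W v′ ω₀₁) U + v n * Fold m (λ I → sgn I * ω₀₀ I) U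
        ≡⟨ cong₂ (λ x y → x + v n * y) (trans (*-identityˡ _) (Fold-W m v′ ω₀₁ U)) (Fold-sgn m ω₀₀ U) ⟩
      W w (Fold m ω₀₁) U + v n * (sgn U * X) ∎
    third : W w (λ S → Fold m ω₁₀ S + χ m * (sgn S * Fold m ω₀₁ S)) U
          ≡ 1ℤ * W w (Fold m ω₁₀) U + χ m * - (sgn U * W w (Fold m ω₀₁) U)
    third = begin
      W w (λ S → Fold m ω₁₀ S + χ m * (sgn S * Fold m ω₀₁ S)) U
        ≡⟨ W-cong w (λ S → cong (_+ χ m * (sgn S * Fold m ω₀₁ S)) (sym (*-identityˡ (Fold m ω₁₀ S)))) U ⟩
      W w (λ S → 1ℤ * Fold m ω₁₀ S + χ m * (sgn S * Fold m ω₀₁ S)) U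
        ≡⟨ W-lin w 1ℤ (χ m) (Fold m ω₁₀) (λ S → sgn S * Fold m ω₀₁ S) U ⟩
      1ℤ * W w (Fold m ω₁₀) U + χ m * W w (λ S → sgn S * Fold m ω₀₁ S) U
        ≡⟨ cong (λ x → 1ℤ * W w (Fold m ω₁₀) U + χ m * x) (W-sgn w (Fold m ω₀₁) U) ⟩
      1ℤ * W w (Fold m ω₁₀) U + χ m * - (sgn U * W w (Fold m ω₀₁) U) ∎

  δ-∷ʳ-false : ∀ {n} (S : State n) → δ (S ∷ʳ false) ≡ δ S
  δ-∷ʳ-false []          = refl
  δ-∷ʳ-false (false ∷ S) = δ-∷ʳ-false S
  δ-∷ʳ-false (true ∷ S)  = refl

  δ-∷ʳ-true : ∀ {n} (S : State n) → δ (S ∷ʳ true) ≡ 0ℤ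
  δ-∷ʳ-true []          = refl
  δ-∷ʳ-true (false ∷ S) = δ-∷ʳ-true S
  δ-∷ʳ-true (true ∷ S)  = refl

  Fold-zero : ∀ m U → Fold m (λ _ → 0ℤ) U ≡ 0ℤ
  Fold-zero m U = Fold-lin m 0ℤ 0ℤ (λ _ → 0ℤ) (λ _ → 0ℤ) U

  Fold-δ : ∀ m U → Fold m δ U ≡ δ U
  Fold-δ zero    []          = refl
  Fold-δ (suc m) (false ∷ U) = trans (Fold-cong m δ-∷ʳ-false U) (Fold-δ m U)
  Fold-δ (suc m) (true ∷ U)
    rewrite Fold-zero m U | Fold-cong m δ-∷ʳ-true U | Fold-zero m U | *-zeroʳ (sgn U) | *-zeroʳ (χ m) = refl

  Fold-Ψ : ∀ m G k U → Fold m (Ψ G k) U ≡ Ψ (λ i → fold m (G i)) k U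
  Fold-Ψ m G zero    U = Fold-δ m U
  Fold-Ψ m G (suc k) U = trans (Fold-W m (G k) (Ψ G k) U) (W-cong (fold m (G k)) (Fold-Ψ m G k) U)

  full : ∀ {n} → State n
  full = replicate _ true

  sgn-full : ∀ m → sgn (full {m}) ≡ χ m
  sgn-full zero    = refl
  sgn-full (suc m) = cong -_ (sgn-full m)

  pair-snoc : ∀ {n} (f : State (suc n) → ℕ) (ω : Ω (suc n)) →
              pair f ω ≡ pair (λ S → f (S ∷ʳ false)) (λ S → ω (S ∷ʳ false)) + pair (λ S → f (S ∷ʳ true)) (λ S → ω (S ∷ʳ true))
  pair-snoc {zero}  f ω = refl
  pair-snoc {suc n} f ω
    rewrite pair-snoc (f at false) (ω at false) | pair-snoc (f at true) (ω at true) =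
    lemma (pair (inner f false false) (inner ω false false)) (pair (inner f false true) (inner ω false true))
          (pair (inner f true false) (inner ω true false)) (pair (inner f true true) (inner ω true true))
    where
    lemma : ∀ x y z w → x + y + (z + w) ≡ x + z + (y + w)
    lemma = solve-∀

  -- Such an `f` is the indicator of the states with exactly one occupied column in each mirror
  -- pair, described through the outermost pair.
  record Selector (f : ∀ m → State (double m) → ℕ) : Set where
    field
      base : f 0 [] ≡ 1
      ff   : ∀ m I → f (suc m) (false ∷ (I ∷ʳ false)) ≡ 0
      ft   : ∀ m I → f (suc m) (false ∷ (I ∷ʳ true)) ≡ f m I
      tf   : ∀ m I → f (suc m) (true ∷ (I ∷ʳ false)) ≡ f m I
      tt   : ∀ m I → f (suc m) (true ∷ (I ∷ʳ true)) ≡ 0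

  pair-selector : ∀ {f} → Selector f → ∀ m (ω : Ω (double m)) → pair (f m) ω ≡ Fold m ω full
  pair-selector {f} sel zero    ω rewrite Selector.base sel = *-identityˡ (ω [])
  pair-selector {f} sel (suc m) ω = begin
    pair (f (suc m) at false) (ω at false) + pair (f (suc m) at true) (ω at true)
      ≡⟨ cong₂ _+_ (pair-snoc (f (suc m) at false) (ω at false)) (pair-snoc (f (suc m) at true) (ω at true)) ⟩
    pair (inner (f (suc m)) false false) (inner ω false false) + pair (inner (f (suc m)) false true) (inner ω false true)
      + (pair (inner (f (suc m)) true false) (inner ω true false) + pair (inner (f (suc m)) true true) (inner ω true true))
      ≡⟨ cong₂ _+_
           (cong₂ _+_ (trans (pair-cong {ω = inner ω false false} (ff m) (λ _ → refl)) (pair-zeroˡ (inner ω false false)))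
                      (trans (pair-cong (ft m) (λ _ → refl)) (pair-selector sel m (inner ω false true))))
           (cong₂ _+_ (trans (pair-cong (tf m) (λ _ → refl)) (pair-selector sel m (inner ω true false)))
                      (trans (pair-cong {ω = inner ω true true} (tt m) (λ _ → refl)) (pair-zeroˡ (inner ω true true)))) ⟩
    0ℤ + y + (x + 0ℤ)
      ≡⟨ l₁ x y ⟩
    x + 1ℤ * y
      ≡⟨ cong (λ z → x + z * y) (trans (cong (χ m *_) (sgn-full m)) (χ-square m)) ⟨
    x + χ m * sgn (full {m}) * y
      ≡⟨ cong (λ z → x + z) (*-assoc (χ m) (sgn (full {m})) y) ⟩
    x + χ m * (sgn (full {m}) * y) ∎
    where
    open ≡-Reasoning
    open Selector sel
    x = Fold m (inner ω true false) full
    y = Fold m (inner ω false true) full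
    l₁ : ∀ x y → 0ℤ + y + (x + 0ℤ) ≡ x + 1ℤ * y
    l₁ = solve-∀

  -- Centred columns, parity, and elimination among the folded polynomials

  odd : ℕ → ℤ
  odd j = + (1 ℕ.+ 2 ℕ.* j)

  poly-neg : ∀ i Y → poly i (- Y) ≡ χ i * poly i Y
  poly-neg zero          Y = refl
  poly-neg (suc zero)    Y = lemma Y
    where
    lemma : ∀ Y → - Y ≡ -1ℤ * Y
    lemma = solve-∀
  poly-neg (suc (suc i)) Y
    rewrite poly-neg (suc i) Y | poly-neg i Y =
    lemma (+ suc i) (χ i) Y (poly (suc i) Y) (poly i Y)
    where
    lemma : ∀ k c Y p q → - Y * (- c * p) + k * k * (c * q) ≡ - - c * (Y * p + k * k * q)
    lemma = solve-∀

  abscissa-formula : ∀ y t → abscissa y t ≡ y - + 2 * + t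
  abscissa-formula y zero    = lemma y
    where
    lemma : ∀ y → y ≡ y - + 2 * 0ℤ
    lemma = solve-∀
  abscissa-formula y (suc t) = trans (abscissa-formula (y - + 2) t) (lemma y (+ t))
    where
    lemma : ∀ y t → y - + 2 - + 2 * t ≡ y - + 2 * (1ℤ + t)
    lemma = solve-∀

  double≡2* : ∀ m → + double m ≡ + 2 * + m
  double≡2* zero    = refl
  double≡2* (suc m) = trans (cong (λ x → 1ℤ + (1ℤ + x)) (double≡2* m)) (lemma (+ m))
    where
    lemma : ∀ x → 1ℤ + (1ℤ + + 2 * x) ≡ + 2 * (1ℤ + x)
    lemma = solve-∀

  odd≡ : ∀ m → odd m ≡ 1ℤ + + 2 * + m
  odd≡ m = trans (pos-+ 1 (2 ℕ.* m)) (cong (λ x → 1ℤ + x) (pos-* 2 m))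

  -- The folded vector at the mirror pair with abscissae `± odd j`: twice `poly i (odd j)` if `i`
  -- and `j` have the same parity, and 0 otherwise.
  folded : ℕ → ℕ → ℤ
  folded i j = (1ℤ + χ i * χ j) * poly i (odd j)

  -- Pairs are indexed from the centre outwards but coordinates start with the outermost pair, so
  -- enlarging `m` by one adds a coordinate in front.
  reversed : ℕ → (ℕ → ℤ) → ℕ → ℤ
  reversed zero    u t       = 0ℤ
  reversed (suc m) u zero    = u m
  reversed (suc m) u (suc t) = reversed m u t

  -- For `y = 2 m - 1` the abscissae are symmetric about 0, so mirror columns carry values of
  -- `poly i` that agree up to the sign `χ i`.
  fold-F : ∀ m y i → y ≡ + 2 * + m - 1ℤ → ∀ t → fold m (F y i) t ≡ reversed m (folded i) t
  fold-F zero    y i e t       = refl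
  fold-F (suc m) y i e zero    = begin
    poly i y + χ m * poly i (abscissa y (suc (double m)))
      ≡⟨ cong₂ (λ a b → poly i a + χ m * poly i b) y≡ last≡ ⟩
    poly i (odd m) + χ m * poly i (- odd m)
      ≡⟨ cong (λ x → poly i (odd m) + χ m * x) (poly-neg i (odd m)) ⟩
    poly i (odd m) + χ m * (χ i * poly i (odd m))
      ≡⟨ lemma (poly i (odd m)) (χ m) (χ i) ⟩
    (1ℤ + χ i * χ m) * poly i (odd m) ∎
    where
    open ≡-Reasoning
    lemma : ∀ p a b → p + a * (b * p) ≡ (1ℤ + b * a) * p
    lemma = solve-∀
    y≡ : y ≡ odd m
    y≡ = trans e (trans (l (+ m)) (sym (odd≡ m)))
      where
      l : ∀ m → + 2 * (1ℤ + m) - 1ℤ ≡ 1ℤ + + 2 * m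
      l = solve-∀
    last≡ : abscissa y (suc (double m)) ≡ - odd m
    last≡ = begin
      abscissa y (suc (double m))                          ≡⟨ abscissa-formula y (suc (double m)) ⟩
      y - + 2 * (1ℤ + + double m)                          ≡⟨ cong₂ (λ a b → a - + 2 * (1ℤ + b)) e (double≡2* m) ⟩
      + 2 * (1ℤ + + m) - 1ℤ - + 2 * (1ℤ + + 2 * + m)       ≡⟨ l (+ m) ⟩
      - (1ℤ + + 2 * + m)                                   ≡⟨ cong -_ (odd≡ m) ⟨
      - odd m                                              ∎
      where
      l : ∀ m → + 2 * (1ℤ + m) - 1ℤ - + 2 * (1ℤ + + 2 * m) ≡ - (1ℤ + + 2 * m)
      l = solve-∀
  fold-F (suc m) y i e (suc t) = fold-F m (y - + 2) i (trans (cong (_- + 2) e) (l (+ m))) t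
    where
    l : ∀ m → + 2 * (1ℤ + m) - 1ℤ - + 2 ≡ + 2 * m - 1ℤ
    l = solve-∀

  -- Elimination replaces folded i by the monic polynomial in odd j of the same parity
  -- that vanishes at odd i′ for all i′ < i with i′ ≡ i mod 2; at the other j the factor
  -- 1 ± χ j vanishes.
  tri : ℕ → ℕ → ℤ
  tri zero          j = 1ℤ + χ j
  tri (suc zero)    j = (1ℤ - χ j) * odd j
  tri (suc (suc i)) j = (odd j * odd j - odd i * odd i) * tri i j

  -- The index is an exclusive bound: `Span p i` contains the combinations of `p 0, …, p (i - 1)`,
  -- compared pointwise.
  data Span (p : ℕ → ℕ → ℤ) : ℕ → (ℕ → ℤ) → Set where
    none : ∀ {v} → (∀ j → v j ≡ 0ℤ) → Span p 0 v
    some : ∀ {i u v} (c : ℤ) → Span p i u → (∀ j → v j ≡ u j + c * p i j) → Span p (suc i) v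

  Span-cong : ∀ {p i u v} → (∀ j → v j ≡ u j) → Span p i u → Span p i v
  Span-cong e (none z)     = none (λ j → trans (e j) (z j))
  Span-cong e (some c s d) = some c s (λ j → trans (e j) (d j))

  Span-suc : ∀ {p i v} → Span p i v → Span p (suc i) v
  Span-suc {p} {i} {v} s = some 0ℤ s (λ j → lemma (v j) (p i j))
    where
    lemma : ∀ x y → x ≡ x + 0ℤ * y
    lemma = solve-∀

  Span-lin : ∀ {p i u v} a b → Span p i u → Span p i v → Span p i (λ j → a * u j + b * v j)
  Span-lin a b (none z) (none w) = none λ j → trans (cong₂ (λ x y → a * x + b * y) (z j) (w j)) (lemma a b)
    where
    lemma : ∀ a b → a * 0ℤ + b * 0ℤ ≡ 0ℤ
    lemma = solve-∀
  Span-lin {p} {suc i} a b (some {u = u} c s e) (some {u = v} d t f) =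
    some (a * c + b * d) (Span-lin a b s t)
         (λ j → trans (cong₂ (λ x y → a * x + b * y) (e j) (f j)) (lemma a b c d (u j) (v j) (p i j)))
    where
    lemma : ∀ a b c d x y z → a * (x + c * z) + b * (y + d * z) ≡ a * x + b * y + (a * c + b * d) * z
    lemma = solve-∀

  Span-zero : ∀ {p} i → Span p i (λ _ → 0ℤ)
  Span-zero zero    = none (λ _ → refl)
  Span-zero (suc i) = Span-suc (Span-zero i)

  Span-last : ∀ {p} i → Span p (suc i) (p i)
  Span-last {p} i = some 1ℤ (Span-zero i) (λ j → lemma (p i j))
    where
    lemma : ∀ x → x ≡ 0ℤ + 1ℤ * x
    lemma = solve-∀

  -- Multiplying `tri i` by the square of `odd j` gives `tri (i + 2)` plus a constant multiple of
  -- `tri i`, so the bound grows by two.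
  Span-square : ∀ {i u} → Span tri i u → Span tri (suc (suc i)) (λ j → odd j * odd j * u j)
  Span-square (none z) = Span-suc (Span-suc (none (λ j → trans (cong (odd j * odd j *_) (z j)) (*-zeroʳ (odd j * odd j)))))
  Span-square {suc i} (some {u = u} c s e) =
    some c (Span-cong (λ j → refl) (Span-lin 1ℤ (odd i * odd i * c) (Span-square s) (Span-suc (Span-last i))))
         (λ j → trans (cong (odd j * odd j *_) (e j)) (lemma (odd j * odd j) (odd i * odd i) (u j) c (tri i j)))
    where
    lemma : ∀ y z u c t → y * (u + c * t) ≡ 1ℤ * (y * u) + z * c * t + c * ((y - z) * t)
    lemma = solve-∀

  Monic : ℕ → Set
  Monic i = Span tri i (λ j → folded i j - tri i j)

  monic-span : ∀ i → Monic i → Span tri (suc i) (folded i)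
  monic-span i s = some 1ℤ s (λ j → lemma (folded i j) (tri i j))
    where
    lemma : ∀ x y → x ≡ x - y + 1ℤ * y
    lemma = solve-∀

  -- Three instances of the recursion of `poly` eliminate the polynomials of the other parity and
  -- express `folded (i + 4)` through `folded (i + 2)`, its multiple by the square of `odd j`, and
  -- `folded i`. A step that reaches back four degrees needs four base cases.
  monic : ∀ i → Monic i
  monic zero = none (λ j → lemma (χ j))
    where
    lemma : ∀ c → (1ℤ + 1ℤ * c) * 1ℤ - (1ℤ + c) ≡ 0ℤ
    lemma = solve-∀
  monic (suc zero) = Span-cong (λ j → lemma (χ j) (odd j)) (Span-zero 1)
    where
    lemma : ∀ c y → (1ℤ + -1ℤ * c) * y - (1ℤ - c) * y ≡ 0ℤ
    lemma = solve-∀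
  monic (suc (suc zero)) =
    -- The coefficient 2 is the difference of `Y² + 1` and `Y² - 1`; in the next case 14 comes from
    -- `Y³ + 5 Y` against `Y (Y² - 9)`.
    Span-cong (λ j → lemma (χ j) (odd j)) (Span-suc (Span-lin (+ 2) 0ℤ (Span-last 0) (Span-last 0)))
    where
    lemma : ∀ c y → (1ℤ + 1ℤ * c) * (y * y + 1ℤ * 1ℤ * 1ℤ) - (y * y - 1ℤ * 1ℤ) * (1ℤ + c) ≡ + 2 * (1ℤ + c) + 0ℤ * (1ℤ + c)
    lemma = solve-∀
  monic (suc (suc (suc zero))) =
    Span-cong (λ j → lemma (χ j) (odd j)) (Span-suc (Span-lin (+ 14) 0ℤ (Span-last 1) (Span-last 1)))
    where
    lemma : ∀ c y → (1ℤ + -1ℤ * c) * (y * (y * y + 1ℤ * 1ℤ * 1ℤ) + + 2 * + 2 * y) - (y * y - + 3 * + 3) * ((1ℤ - c) * y)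
                  ≡ + 14 * ((1ℤ - c) * y) + 0ℤ * ((1ℤ - c) * y)
    lemma = solve-∀
  monic (suc (suc (suc (suc i)))) =
    Span-cong (λ j → lemma (χ i) (χ j) (odd j) (odd (suc (suc i))) (+ i) (poly i (odd j)) (poly (suc i) (odd j)) (tri (suc (suc i)) j))
      (Span-lin 1ℤ 1ℤ
        (Span-square (monic (suc (suc i))))
        (Span-suc
          (Span-lin 1ℤ 1ℤ
            (Span-lin (odd (suc (suc i)) * odd (suc (suc i))) α (Span-last (suc (suc i))) (monic-span (suc (suc i)) (monic (suc (suc i)))))
            (Span-lin β 0ℤ lower lower))))
    where
    x = + suc i
    -- The coefficients in `poly (i + 4) = (Y² + α) poly (i + 2) + β poly i`.
    α = (1ℤ + (1ℤ + x)) * (1ℤ + (1ℤ + x)) + (1ℤ + x) * (1ℤ + x)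
    β = - ((1ℤ + x) * (1ℤ + x) * (x * x))
    lower : Span tri (suc (suc (suc i))) (folded i)
    lower = Span-suc (Span-suc (monic-span i (monic i)))
    lemma : ∀ c d y z i p q t →
      let x  = 1ℤ + i
          f  = y * q + x * x * p
          f′ = y * f + (1ℤ + x) * (1ℤ + x) * q
          F₂ = (1ℤ + - - c * d) * f
          F₀ = (1ℤ + c * d) * p
          α  = (1ℤ + (1ℤ + x)) * (1ℤ + (1ℤ + x)) + (1ℤ + x) * (1ℤ + x)
          β  = - ((1ℤ + x) * (1ℤ + x) * (x * x)) in
      (1ℤ + - - - - c * d) * (y * f′ + (1ℤ + (1ℤ + x)) * (1ℤ + (1ℤ + x)) * f) - (y * y - z * z) * t
      ≡ 1ℤ * (y * y * (F₂ - t)) + 1ℤ * (1ℤ * (z * z * t + α * F₂) + 1ℤ * (β * F₀ + 0ℤ * F₀))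
    lemma = solve-∀

  -- Triangular wedges and their pivots

  W-Ψ-zero : ∀ {n} (G : ℕ → ℕ → ℤ) i k → i < k → (S : State n) → W (G i) (Ψ G k) S ≡ 0ℤ
  W-Ψ-zero G i (suc k) i<k S with ℕₚ.m<1+n⇒m<n∨m≡n i<k
  ... | inj₂ refl = W-square (G i) (Ψ G i) S
  ... | inj₁ i<k′ = begin
    W (G i) (W (G k) (Ψ G k)) S     ≡⟨ W-anticomm (G i) (G k) (Ψ G k) S ⟩
    - W (G k) (W (G i) (Ψ G k)) S   ≡⟨ cong -_ (W-cong (G k) (W-Ψ-zero G i k i<k′) S) ⟩
    - W (G k) (λ _ → 0ℤ) S          ≡⟨ cong -_ (W-zero (G k) S) ⟩
    0ℤ                              ∎
    where open ≡-Reasoning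

  reversed-cong : ∀ m {u v : ℕ → ℤ} → (∀ j → u j ≡ v j) → ∀ t → reversed m u t ≡ reversed m v t
  reversed-cong zero    e t       = refl
  reversed-cong (suc m) e zero    = e m
  reversed-cong (suc m) e (suc t) = reversed-cong m e t

  reversed-lin : ∀ m a (u v : ℕ → ℤ) t → reversed m (λ j → u j + a * v j) t ≡ reversed m u t + a * reversed m v t
  reversed-lin zero    a u v t       = sym (trans (+-identityˡ _) (*-zeroʳ a))
  reversed-lin (suc m) a u v zero    = refl
  reversed-lin (suc m) a u v (suc t) = reversed-lin m a u v t

  reversed-zero : ∀ m {u : ℕ → ℤ} → (∀ j → j < m → u j ≡ 0ℤ) → ∀ t → reversed m u t ≡ 0ℤ
  reversed-zero zero    e t       = refl
  reversed-zero (suc m) e zero    = e m ℕₚ.≤-refl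
  reversed-zero (suc m) e (suc t) = reversed-zero m (λ j j<m → e j (ℕₚ.m<n⇒m<1+n j<m)) t

  module _ (m : ℕ) where

    Wᵣ : (ℕ → ℤ) → Ω m → Ω m
    Wᵣ u = W (reversed m u)

    Ψᵣ : (ℕ → ℕ → ℤ) → ℕ → Ω m
    Ψᵣ p = Ψ (λ i → reversed m (p i))

    W-Span : ∀ {p i u} k → i ℕ.≤ k → Span p i u → ∀ S → Wᵣ u (Ψᵣ p k) S ≡ 0ℤ
    W-Span {p} k i≤k (none z) S = W-zeroˡ (reversed-zero m (λ j _ → z j)) (Ψᵣ p k) S
    W-Span {p} {suc i} {v} k i<k (some {u = u} c s e) S = begin
      Wᵣ v (Ψᵣ p k) S
        ≡⟨ W-congˡ (λ t → trans (reversed-cong m e t) (reversed-lin m c u (p i) t)) (Ψᵣ p k) S ⟩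
      W (λ t → reversed m u t + c * reversed m (p i) t) (Ψᵣ p k) S
        ≡⟨ W-linˡ c (reversed m u) (reversed m (p i)) (Ψᵣ p k) S ⟩
      Wᵣ u (Ψᵣ p k) S + c * Wᵣ (p i) (Ψᵣ p k) S
        ≡⟨ cong₂ (λ x y → x + c * y) (W-Span k (ℕₚ.<⇒≤ i<k) s S) (W-Ψ-zero (λ i → reversed m (p i)) i k i<k S) ⟩
      0ℤ + c * 0ℤ
        ≡⟨ trans (+-identityˡ _) (*-zeroʳ c) ⟩
      0ℤ ∎
      where open ≡-Reasoning

    -- Row operations on a determinant: the correction to the factor `k` lies in the span of the
    -- factors already in the wedge and is annihilated by them.
    Ψᵣ-eliminate : ∀ {p q} → (∀ i → Span p i (λ j → q i j - p i j)) → ∀ k S → Ψᵣ q k S ≡ Ψᵣ p k S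
    Ψᵣ-eliminate s zero    S = refl
    Ψᵣ-eliminate {p} {q} s (suc k) S = begin
      Wᵣ (q k) (Ψᵣ q k) S
        ≡⟨ W-cong (reversed m (q k)) (Ψᵣ-eliminate s k) S ⟩
      Wᵣ (q k) (Ψᵣ p k) S
        ≡⟨ W-congˡ (λ t → trans (reversed-cong m (λ j → lemma (q k j) (p k j)) t)
                                (reversed-lin m 1ℤ (p k) (λ j → q k j - p k j) t)) (Ψᵣ p k) S ⟩
      W (λ t → reversed m (p k) t + 1ℤ * reversed m (λ j → q k j - p k j) t) (Ψᵣ p k) S
        ≡⟨ W-linˡ 1ℤ (reversed m (p k)) _ (Ψᵣ p k) S ⟩
      Wᵣ (p k) (Ψᵣ p k) S + 1ℤ * Wᵣ (λ j → q k j - p k j) (Ψᵣ p k) S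
        ≡⟨ cong (λ x → Wᵣ (p k) (Ψᵣ p k) S + 1ℤ * x) (W-Span k ℕₚ.≤-refl (s k) S) ⟩
      Wᵣ (p k) (Ψᵣ p k) S + 1ℤ * 0ℤ
        ≡⟨ +-identityʳ _ ⟩
      Wᵣ (p k) (Ψᵣ p k) S ∎
      where
      open ≡-Reasoning
      lemma : ∀ x y → x ≡ y + 1ℤ * (x - y)
      lemma = solve-∀

  Ψᵣ-false : ∀ m p k U → Ψᵣ (suc m) p k (false ∷ U) ≡ Ψᵣ m p k U
  Ψᵣ-false m p zero    U = refl
  Ψᵣ-false m p (suc k) U = W-cong (reversed m (p k)) (Ψᵣ-false m p k) U

  -- Expansion along the outermost coordinate: the last factor `p m` vanishes on all the other
  -- coordinates, so only its pivot survives.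
  Ψᵣ-triangular : ∀ p → (∀ i j → j < i → p i j ≡ 0ℤ) → ∀ m →
                  Ψᵣ (suc m) p (suc m) full ≡ p m m * Ψᵣ m p m full
  Ψᵣ-triangular p tr m = begin
    p m m * Ψᵣ (suc m) p m (false ∷ full) - W (reversed m (p m)) (Ψᵣ (suc m) p m at true) full
      ≡⟨ cong₂ (λ x y → p m m * x - y) (Ψᵣ-false m p m full) (W-zeroˡ (reversed-zero m (tr m)) (Ψᵣ (suc m) p m at true) full) ⟩
    p m m * Ψᵣ m p m full - 0ℤ
      ≡⟨ +-identityʳ _ ⟩
    p m m * Ψᵣ m p m full ∎
    where open ≡-Reasoning

  *-zeroʳ-cong : ∀ a {b} → b ≡ 0ℤ → a * b ≡ 0ℤ
  *-zeroʳ-cong a refl = *-zeroʳ a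

  tri-parity : ∀ i j → χ i * χ j ≡ -1ℤ → tri i j ≡ 0ℤ
  tri-parity zero          j e = trans (cong (λ x → 1ℤ + x) (sym (*-identityˡ (χ j)))) (cong (λ x → 1ℤ + x) e)
  tri-parity (suc zero)    j e = cong (_* odd j) (trans (lemma (χ j)) (cong (λ x → 1ℤ + x) e))
    where
    lemma : ∀ c → 1ℤ - c ≡ 1ℤ + -1ℤ * c
    lemma = solve-∀
  tri-parity (suc (suc i)) j e =
    *-zeroʳ-cong (odd j * odd j - odd i * odd i) (tri-parity i j (trans (lemma (χ i) (χ j)) e))
    where
    lemma : ∀ a b → a * b ≡ - - a * b
    lemma = solve-∀

  tri-triangular : ∀ i j → j < i → tri i j ≡ 0ℤ
  tri-triangular (suc zero) zero _ = refl
  tri-triangular (suc zero) (suc j) (s≤s ())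
  tri-triangular (suc (suc i)) j j<2+i with ℕₚ.m<1+n⇒m<n∨m≡n j<2+i
  ... | inj₂ refl = *-zeroʳ-cong (odd (suc i) * odd (suc i) - odd i * odd i)
                      (tri-parity i (suc i) (trans (lemma (χ i)) (cong -_ (χ-square i))))
    where
    lemma : ∀ c → c * - c ≡ - (c * c)
    lemma = solve-∀
  ... | inj₁ j<1+i with ℕₚ.m<1+n⇒m<n∨m≡n j<1+i
  ...   | inj₂ refl = cong (_* tri i i) (i≡j⇒i-j≡0 {odd i * odd i} refl)
  ...   | inj₁ j<i = *-zeroʳ-cong (odd j * odd j - odd i * odd i) (tri-triangular i j j<i)

  superfactorial≢0 : ∀ m → ℕ.NonZero (superfactorial m)
  superfactorial≢0 zero    = _
  superfactorial≢0 (suc m) = ℕₚ.m*n≢0 (m !) (superfactorial m) {{ℕₚ._!≢0 m}} {{superfactorial≢0 m}}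

  -- The value at the empty state is a pairing with `δ`. Transposition moves the rows to `δ`,
  -- folding reduces the boundary functional to one top coefficient, and elimination makes that
  -- determinant triangular.
  selected : ∀ {f} → Selector f → ∀ m → + superfactorial m * + iterD m (f m) empty ≡ Ψᵣ m tri m full
  selected {f} sel m = begin
    + superfactorial m * + iterD m (f m) empty
      ≡⟨ cong (+ superfactorial m *_) (pair-δ (iterD m (f m))) ⟨
    + superfactorial m * pair (iterD m (f m)) δ
      ≡⟨ cong (+ superfactorial m *_) (pair-iterD m (f m) δ) ⟩
    + superfactorial m * pair (f m) (iterR m δ)
      ≡⟨ cong (+ superfactorial m *_) (pair-selector sel m (iterR m δ)) ⟩
    + superfactorial m * Fold m (iterR m δ) full
      ≡⟨ lemma (+ superfactorial m * Fold m (iterR m δ) full) (Fold m (iterR m δ) full) ⟩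
    + superfactorial m * Fold m (iterR m δ) full + 0ℤ * Fold m (iterR m δ) full
      ≡⟨ Fold-lin m (+ superfactorial m) 0ℤ (iterR m δ) (iterR m δ) full ⟨
    Fold m (λ S → + superfactorial m * iterR m δ S + 0ℤ * iterR m δ S) full
      ≡⟨ Fold-cong m (λ S → trans (sym (lemma (+ superfactorial m * iterR m δ S) (iterR m δ S))) (iterR-δ y m S)) full ⟩
    Fold m (Ψ (F y) m) full
      ≡⟨ Fold-Ψ m (F y) m full ⟩
    Ψ (λ i → fold m (F y i)) m full
      ≡⟨ Ψ-cong (λ i → fold-F m y i refl) m full ⟩
    Ψᵣ m folded m full
      ≡⟨ Ψᵣ-eliminate m monic m full ⟩
    Ψᵣ m tri m full ∎
    where
    open ≡-Reasoning
    -- Centres the columns `0, …, 2 m - 1` about 0, as `fold-F` demands.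
    y = + 2 * + m - 1ℤ
    lemma : ∀ x z → x ≡ x + 0ℤ * z
    lemma = solve-∀

  -- Two consecutive determinants differ by the pivot and two consecutive superfactorials by `m !`,
  -- so after cancellation only these two quantities remain.
  selected-ratio : ∀ {f} → Selector f → ∀ m →
    + (m !) * + iterD (suc m) (f (suc m)) empty ≡ tri m m * + iterD m (f m) empty
  selected-ratio {f} sel m = *-cancelˡ-≡ (+ superfactorial m) _ _ {{superfactorial≢0 m}} (begin
    s * (+ (m !) * h′)                        ≡⟨ l₁ s (+ (m !)) h′ ⟩
    + (m !) * s * h′                          ≡⟨ cong (_* h′) (pos-* (m !) (superfactorial m)) ⟨
    + superfactorial (suc m) * h′             ≡⟨ selected sel (suc m) ⟩
    Ψᵣ (suc m) tri (suc m) full               ≡⟨ Ψᵣ-triangular tri tri-triangular m ⟩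
    tri m m * Ψᵣ m tri m full                 ≡⟨ cong (tri m m *_) (selected sel m) ⟨
    tri m m * (s * h)                         ≡⟨ l₂ (tri m m) s h ⟩
    s * (tri m m * h)                         ∎)
    where
    open ≡-Reasoning
    s = + superfactorial m
    h = + iterD m (f m) empty
    h′ = + iterD (suc m) (f (suc m)) empty
    l₁ : ∀ s k h → s * (k * h) ≡ k * s * h
    l₁ = solve-∀
    l₂ : ∀ t s h → t * (s * h) ≡ s * (t * h)
    l₂ = solve-∀

-- Evaluation of the pivots by central binomial coefficients

module ProductFormula where

  open RowTransfer using (double)
  open ExteriorAlgebra using (χ; odd; odd≡; tri; double≡2*)
  open import Data.Nat using (_+_; _*_; _^_; _∸_)
  open import Data.Nat.Properties
  open import Data.Nat.Combinatorics using (_C_; nCk≡n!/k![n-k]!; k![n∸k]!∣n!)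
  open import Data.Nat.DivMod using (_/_; m/n*n≡m)
  open import Data.Nat.Tactic.RingSolver using (solve-∀)
  open import Data.Integer as ℤ using (ℤ; +_; 1ℤ)
  import Data.Integer.Properties as ℤₚ
  import Data.Integer.Tactic.RingSolver as ℤ-Solver

  -- Collects the cofactors that arise when differences of squares are factored: `(4 n + 1)² - (4 k
  -- + 1)² = 8 (n - k) (2 n + 2 k + 1)`.
  oddProduct : ℕ → ℕ → ℕ
  oddProduct n zero    = 1
  oddProduct n (suc k) = (2 * n + 2 * k + 1) * oddProduct n k

  -- The even numbers after `2 n` up to `2 n + 2 k` have product `2 ^ k (n + k)! / n!`; removing
  -- them from `(2 n + 2 k)! / (2 n)!` leaves the odd ones.
  oddProduct-! : ∀ n k → oddProduct n k * ((2 * n) ! * (2 ^ k * (n + k) !)) ≡ (2 * n + 2 * k) ! * n !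
  oddProduct-! n zero rewrite +-identityʳ (2 * n) | +-identityʳ n = lemma ((n + n) !) (n !)
    where
    lemma : ∀ a b → 1 * (a * (1 * b)) ≡ a * b
    lemma = solve-∀
  oddProduct-! n (suc k) = begin
    (2 * n + 2 * k + 1) * oddProduct n k * ((2 * n) ! * (2 * 2 ^ k * (n + suc k) !))
      ≡⟨ cong (λ x → (2 * n + 2 * k + 1) * oddProduct n k * ((2 * n) ! * (2 * 2 ^ k * x !))) (+-suc n k) ⟩
    (2 * n + 2 * k + 1) * oddProduct n k * ((2 * n) ! * (2 * 2 ^ k * (suc (n + k) * (n + k) !)))
      ≡⟨ l₁ n k (oddProduct n k) ((2 * n) !) (2 ^ k) ((n + k) !) ⟩
    (2 + (2 * n + 2 * k)) * ((1 + (2 * n + 2 * k)) * (oddProduct n k * ((2 * n) ! * (2 ^ k * (n + k) !))))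
      ≡⟨ cong (λ x → (2 + (2 * n + 2 * k)) * ((1 + (2 * n + 2 * k)) * x)) (oddProduct-! n k) ⟩
    (2 + (2 * n + 2 * k)) * ((1 + (2 * n + 2 * k)) * ((2 * n + 2 * k) ! * n !))
      ≡⟨ l₂ (2 * n + 2 * k) ((2 * n + 2 * k) !) (n !) ⟩
    (2 + (2 * n + 2 * k)) ! * n !
      ≡⟨ cong (λ x → x ! * n !) (l₃ n k) ⟩
    (2 * n + 2 * suc k) ! * n ! ∎
    where
    open ≡-Reasoning
    l₁ : ∀ n k o a b c → (2 * n + 2 * k + 1) * o * (a * (2 * b * (suc (n + k) * c)))
                       ≡ (2 + (2 * n + 2 * k)) * ((1 + (2 * n + 2 * k)) * (o * (a * (b * c))))
    l₁ = solve-∀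
    l₂ : ∀ m a b → (2 + m) * ((1 + m) * (a * b)) ≡ (2 + m) * ((1 + m) * a) * b
    l₂ = solve-∀
    l₃ : ∀ n k → 2 + (2 * n + 2 * k) ≡ 2 * n + 2 * suc k
    l₃ = solve-∀

  central : ∀ n → ((2 * n) C n) * (n ! * n !) ≡ (2 * n) !
  central n = begin
    ((2 * n) C n) * (n ! * n !)                   ≡⟨ cong (λ x → ((2 * n) C n) * (n ! * x !)) (sym 2n∸n) ⟩
    ((2 * n) C n) * (n ! * (2 * n ∸ n) !)         ≡⟨ cong (_* (n ! * (2 * n ∸ n) !)) (nCk≡n!/k![n-k]! n≤2n) ⟩
    ((2 * n) ! / (n ! * (2 * n ∸ n) !)) {{_}} * (n ! * (2 * n ∸ n) !)
      ≡⟨ m/n*n≡m {{_}} (k![n∸k]!∣n! n≤2n) ⟩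
    (2 * n) ! ∎
    where
    open ≡-Reasoning
    n≤2n = m≤m+n n (n + 0)
    2n∸n : 2 * n ∸ n ≡ n
    2n∸n = trans (m+n∸m≡n n (n + 0)) (+-identityʳ n)

  central-oddProduct : ∀ n → 2 ^ n * oddProduct n n ≡ ((4 * n) C (2 * n)) * n !
  central-oddProduct n = *-cancelʳ-≡ _ _ (a * a) {{m*n≢0 a a {{(2 * n) !≢0}} {{(2 * n) !≢0}}}} (begin
    2 ^ n * oddProduct n n * (a * a)             ≡⟨ l₁ (2 ^ n) (oddProduct n n) a ⟩
    oddProduct n n * (a * (2 ^ n * a))           ≡⟨ cong (λ x → oddProduct n n * (a * (2 ^ n * x !))) (l₂ n) ⟩
    oddProduct n n * (a * (2 ^ n * (n + n) !))   ≡⟨ oddProduct-! n n ⟩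
    (2 * n + 2 * n) ! * n !                      ≡⟨ cong (λ x → x ! * n !) (l₃ n) ⟩
    (2 * (2 * n)) ! * n !                        ≡⟨ cong (_* n !) (sym (central (2 * n))) ⟩
    ((2 * (2 * n)) C (2 * n)) * (a * a) * n !      ≡⟨ cong (λ x → (x C (2 * n)) * (a * a) * n !) (l₄ n) ⟩
    ((4 * n) C (2 * n)) * (a * a) * n !            ≡⟨ l₅ ((4 * n) C (2 * n)) a (n !) ⟩
    ((4 * n) C (2 * n)) * n ! * (a * a)            ∎)
    where
    open ≡-Reasoning
    a = (2 * n) !
    l₁ : ∀ e o a → e * o * (a * a) ≡ o * (a * (e * a))
    l₁ = solve-∀
    l₂ : ∀ n → 2 * n ≡ n + n
    l₂ = solve-∀
    l₃ : ∀ n → 2 * n + 2 * n ≡ 2 * (2 * n)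
    l₃ = solve-∀
    l₄ : ∀ n → 2 * (2 * n) ≡ 4 * n
    l₄ = solve-∀
    l₅ : ∀ c a b → c * (a * a) * b ≡ c * b * (a * a)
    l₅ = solve-∀

  χ-double : ∀ n → χ (double n) ≡ 1ℤ
  χ-double zero    = refl
  χ-double (suc n) = trans (ℤₚ.neg-involutive (χ (double n))) (χ-double n)

  odd-double : ∀ n → odd (double n) ≡ 1ℤ ℤ.+ + 4 ℤ.* + n
  odd-double n = trans (odd≡ (double n)) (trans (cong (λ x → 1ℤ ℤ.+ + 2 ℤ.* x) (double≡2* n)) (lemma (+ n)))
    where
    lemma : ∀ n → 1ℤ ℤ.+ + 2 ℤ.* (+ 2 ℤ.* n) ≡ 1ℤ ℤ.+ + 4 ℤ.* n
    lemma = ℤ-Solver.solve-∀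

  odd-suc-double : ∀ n → odd (suc (double n)) ≡ + 3 ℤ.+ + 4 ℤ.* + n
  odd-suc-double n =
    trans (odd≡ (suc (double n))) (trans (cong (λ x → 1ℤ ℤ.+ + 2 ℤ.* (1ℤ ℤ.+ x)) (double≡2* n)) (lemma (+ n)))
    where
    lemma : ∀ n → 1ℤ ℤ.+ + 2 ℤ.* (1ℤ ℤ.+ + 2 ℤ.* n) ≡ + 3 ℤ.+ + 4 ℤ.* n
    lemma = ℤ-Solver.solve-∀

  pos-oddFactor : ∀ n k → + (2 * n + 2 * k + 1) ≡ + 2 ℤ.* + n ℤ.+ + 2 ℤ.* + k ℤ.+ 1ℤ
  pos-oddFactor n k = trans (ℤₚ.pos-+ (2 * n + 2 * k) 1)
    (cong (ℤ._+ 1ℤ) (trans (ℤₚ.pos-+ (2 * n) (2 * k)) (cong₂ ℤ._+_ (ℤₚ.pos-* 2 n) (ℤₚ.pos-* 2 k))))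

  -- The recursion of `tri` lowers the first index and keeps the second, so the gap `l` grows while
  -- `k` falls. The factors `n - k` of the differences of squares build up `(k + l)! / l!`;
  -- multiplying by `l !` avoids the division.
  tri-double : ∀ k l → + (l !) ℤ.* tri (double k) (double (k + l))
                     ≡ + (2 * 8 ^ k * (k + l) ! * oddProduct (k + l) k)
  tri-double zero l rewrite χ-double l =
    trans (sym (ℤₚ.pos-* (l !) 2)) (cong +_ (lemma (l !)))
    where
    lemma : ∀ x → x * 2 ≡ 2 * 1 * x * 1
    lemma = solve-∀
  tri-double (suc k) l = begin
    + (l !) ℤ.* ((odd j ℤ.* odd j ℤ.- odd (double k) ℤ.* odd (double k)) ℤ.* t)
      ≡⟨ cong₂ (λ x y → + (l !) ℤ.* ((x ℤ.* x ℤ.- y ℤ.* y) ℤ.* t)) (odd-double (suc k + l)) (odd-double k) ⟩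
    + (l !) ℤ.* (((1ℤ ℤ.+ + 4 ℤ.* + n) ℤ.* (1ℤ ℤ.+ + 4 ℤ.* + n) ℤ.- (1ℤ ℤ.+ + 4 ℤ.* + k) ℤ.* (1ℤ ℤ.+ + 4 ℤ.* + k)) ℤ.* t)
      ≡⟨ l₁ (+ (l !)) (+ l) (+ k) t ⟩
    + 8 ℤ.* (+ 2 ℤ.* + n ℤ.+ + 2 ℤ.* + k ℤ.+ 1ℤ) ℤ.* (+ suc l ℤ.* + (l !) ℤ.* t)
      ≡⟨ cong₂ (λ x y → + 8 ℤ.* x ℤ.* (y ℤ.* t)) (pos-oddFactor n k) (ℤₚ.pos-* (suc l) (l !)) ⟨
    + 8 ℤ.* + c ℤ.* (+ (suc l !) ℤ.* t)
      ≡⟨ cong (λ x → + 8 ℤ.* + c ℤ.* (+ (suc l !) ℤ.* tri (double k) (double x))) (+-suc k l) ⟨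
    + 8 ℤ.* + c ℤ.* (+ (suc l !) ℤ.* tri (double k) (double (k + suc l)))
      ≡⟨ cong (+ 8 ℤ.* + c ℤ.*_) (tri-double k (suc l)) ⟩
    + 8 ℤ.* + c ℤ.* + (2 * 8 ^ k * (k + suc l) ! * oddProduct (k + suc l) k)
      ≡⟨ cong (λ x → + 8 ℤ.* + c ℤ.* + (2 * 8 ^ k * x ! * oddProduct x k)) (+-suc k l) ⟩
    + 8 ℤ.* + c ℤ.* + (2 * 8 ^ k * n ! * oddProduct n k)
      ≡⟨ cong (ℤ._* + (2 * 8 ^ k * n ! * oddProduct n k)) (ℤₚ.pos-* 8 c) ⟨
    + (8 * c) ℤ.* + (2 * 8 ^ k * n ! * oddProduct n k)
      ≡⟨ ℤₚ.pos-* (8 * c) (2 * 8 ^ k * n ! * oddProduct n k) ⟨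
    + (8 * c * (2 * 8 ^ k * n ! * oddProduct n k))
      ≡⟨ cong +_ (l₂ c (8 ^ k) (n !) (oddProduct n k)) ⟩
    + (2 * 8 ^ suc k * n ! * oddProduct n (suc k)) ∎
    where
    open ≡-Reasoning
    n = suc k + l
    j = double n
    t = tri (double k) j
    c = 2 * n + 2 * k + 1
    l₁ : ∀ f l k t → let n = 1ℤ ℤ.+ (k ℤ.+ l) in
         f ℤ.* (((1ℤ ℤ.+ + 4 ℤ.* n) ℤ.* (1ℤ ℤ.+ + 4 ℤ.* n) ℤ.- (1ℤ ℤ.+ + 4 ℤ.* k) ℤ.* (1ℤ ℤ.+ + 4 ℤ.* k)) ℤ.* t)
         ≡ + 8 ℤ.* (+ 2 ℤ.* n ℤ.+ + 2 ℤ.* k ℤ.+ 1ℤ) ℤ.* ((1ℤ ℤ.+ l) ℤ.* f ℤ.* t)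
    l₁ = ℤ-Solver.solve-∀
    l₂ : ∀ c e f o → 8 * c * (2 * e * f * o) ≡ 2 * (8 * e) * f * (c * o)
    l₂ = solve-∀

  -- Now `(4 n + 3)² - (4 k + 3)² = 8 (n - k) (2 (n + 1) + 2 k +
  -- 1)`, which shifts the odd product to `n + 1`. The extra factor `4 (k + l) + 3` is the `odd
  -- j` in `tri 1`.
  tri-suc-double : ∀ k l → + (l !) ℤ.* tri (suc (double k)) (suc (double (k + l)))
                         ≡ + (2 * 8 ^ k * (k + l) ! * ((4 * (k + l) + 3) * oddProduct (suc (k + l)) k))
  tri-suc-double zero l rewrite χ-double l = begin
    + (l !) ℤ.* (+ 2 ℤ.* odd (suc (double l)))     ≡⟨ cong (λ x → + (l !) ℤ.* (+ 2 ℤ.* x)) (odd-suc-double l) ⟩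
    + (l !) ℤ.* (+ 2 ℤ.* (+ 3 ℤ.+ + 4 ℤ.* + l))    ≡⟨ cong (λ x → + (l !) ℤ.* (+ 2 ℤ.* (+ 3 ℤ.+ x))) (ℤₚ.pos-* 4 l) ⟨
    + (l !) ℤ.* (+ 2 ℤ.* + (3 + 4 * l))            ≡⟨ cong (+ (l !) ℤ.*_) (ℤₚ.pos-* 2 (3 + 4 * l)) ⟨
    + (l !) ℤ.* + (2 * (3 + 4 * l))                ≡⟨ ℤₚ.pos-* (l !) (2 * (3 + 4 * l)) ⟨
    + (l ! * (2 * (3 + 4 * l)))                    ≡⟨ cong +_ (lemma (l !) l) ⟩
    + (2 * 1 * l ! * ((4 * l + 3) * 1))            ∎
    where
    open ≡-Reasoning
    lemma : ∀ x l → x * (2 * (3 + 4 * l)) ≡ 2 * 1 * x * ((4 * l + 3) * 1)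
    lemma = solve-∀
  tri-suc-double (suc k) l = begin
    + (l !) ℤ.* ((odd j ℤ.* odd j ℤ.- odd (suc (double k)) ℤ.* odd (suc (double k))) ℤ.* t)
      ≡⟨ cong₂ (λ x y → + (l !) ℤ.* ((x ℤ.* x ℤ.- y ℤ.* y) ℤ.* t)) (odd-suc-double (suc k + l)) (odd-suc-double k) ⟩
    + (l !) ℤ.* (((+ 3 ℤ.+ + 4 ℤ.* + n) ℤ.* (+ 3 ℤ.+ + 4 ℤ.* + n) ℤ.- (+ 3 ℤ.+ + 4 ℤ.* + k) ℤ.* (+ 3 ℤ.+ + 4 ℤ.* + k)) ℤ.* t)
      ≡⟨ l₁ (+ (l !)) (+ l) (+ k) t ⟩
    + 8 ℤ.* (+ 2 ℤ.* + suc n ℤ.+ + 2 ℤ.* + k ℤ.+ 1ℤ) ℤ.* (+ suc l ℤ.* + (l !) ℤ.* t)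
      ≡⟨ cong₂ (λ x y → + 8 ℤ.* x ℤ.* (y ℤ.* t)) (pos-oddFactor (suc n) k) (ℤₚ.pos-* (suc l) (l !)) ⟨
    + 8 ℤ.* + c ℤ.* (+ (suc l !) ℤ.* t)
      ≡⟨ cong (λ x → + 8 ℤ.* + c ℤ.* (+ (suc l !) ℤ.* tri (suc (double k)) (suc (double x)))) (+-suc k l) ⟨
    + 8 ℤ.* + c ℤ.* (+ (suc l !) ℤ.* tri (suc (double k)) (suc (double (k + suc l))))
      ≡⟨ cong (+ 8 ℤ.* + c ℤ.*_) (tri-suc-double k (suc l)) ⟩
    + 8 ℤ.* + c ℤ.* + (2 * 8 ^ k * (k + suc l) ! * ((4 * (k + suc l) + 3) * oddProduct (suc (k + suc l)) k))
      ≡⟨ cong (λ x → + 8 ℤ.* + c ℤ.* + (2 * 8 ^ k * x ! * ((4 * x + 3) * oddProduct (suc x) k))) (+-suc k l) ⟩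
    + 8 ℤ.* + c ℤ.* + b
      ≡⟨ cong (ℤ._* + b) (ℤₚ.pos-* 8 c) ⟨
    + (8 * c) ℤ.* + b
      ≡⟨ ℤₚ.pos-* (8 * c) b ⟨
    + (8 * c * b)
      ≡⟨ cong +_ (l₂ c (8 ^ k) (n !) (4 * n + 3) (oddProduct (suc n) k)) ⟩
    + (2 * 8 ^ suc k * n ! * ((4 * n + 3) * oddProduct (suc n) (suc k))) ∎
    where
    open ≡-Reasoning
    n = suc k + l
    j = suc (double n)
    t = tri (suc (double k)) j
    c = 2 * suc n + 2 * k + 1
    b = 2 * 8 ^ k * n ! * ((4 * n + 3) * oddProduct (suc n) k)
    l₁ : ∀ f l k t → let n = 1ℤ ℤ.+ (k ℤ.+ l) in
         f ℤ.* (((+ 3 ℤ.+ + 4 ℤ.* n) ℤ.* (+ 3 ℤ.+ + 4 ℤ.* n) ℤ.- (+ 3 ℤ.+ + 4 ℤ.* k) ℤ.* (+ 3 ℤ.+ + 4 ℤ.* k)) ℤ.* t)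
         ≡ + 8 ℤ.* (+ 2 ℤ.* (1ℤ ℤ.+ n) ℤ.+ + 2 ℤ.* k ℤ.+ 1ℤ) ℤ.* ((1ℤ ℤ.+ l) ℤ.* f ℤ.* t)
    l₁ = ℤ-Solver.solve-∀
    l₂ : ∀ c e f x o → 8 * c * (2 * e * f * (x * o)) ≡ 2 * (8 * e) * f * (x * (c * o))
    l₂ = solve-∀

  tri-even : ∀ n → tri (double n) (double n) ≡ + (2 * 8 ^ n * n ! * oddProduct n n)
  tri-even n = trans (sym (ℤₚ.*-identityˡ _))
    (subst (λ x → + 1 ℤ.* tri (double n) (double x) ≡ + (2 * 8 ^ n * x ! * oddProduct x n)) (+-identityʳ n) (tri-double n 0))

  -- With gap 0 the extra factor `4 n + 3` is just the next factor of the odd product.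
  tri-odd : ∀ n → tri (suc (double n)) (suc (double n)) ≡ + (2 * 8 ^ n * n ! * oddProduct (suc n) (suc n))
  tri-odd n = trans (sym (ℤₚ.*-identityˡ _))
    (trans (subst (λ x → + 1 ℤ.* tri (suc (double n)) (suc (double x)) ≡ + (2 * 8 ^ n * x ! * ((4 * x + 3) * oddProduct (suc x) n)))
                  (+-identityʳ n) (tri-suc-double n 0))
           (cong (λ x → + (2 * 8 ^ n * n ! * (x * oddProduct (suc n) n))) (lemma n)))
    where
    lemma : ∀ n → 4 * n + 3 ≡ 2 * suc n + 2 * n + 1
    lemma = solve-∀

  2*≡double : ∀ n → 2 * n ≡ double n
  2*≡double n = ℤₚ.+-injective (trans (ℤₚ.pos-* 2 n) (sym (double≡2* n)))

  8^≡ : ∀ n → 8 ^ n ≡ 2 ^ n * 2 ^ n * 2 ^ n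
  8^≡ zero    = refl
  8^≡ (suc n) = trans (cong (8 *_) (8^≡ n)) (lemma (2 ^ n))
    where
    lemma : ∀ e → 8 * (e * e * e) ≡ 2 * e * (2 * e) * (2 * e)
    lemma = solve-∀

  2^2* : ∀ n → 2 ^ (2 * n) ≡ 2 ^ n * 2 ^ n
  2^2* n = trans (^-distribˡ-+-* 2 n (n + 0)) (cong (λ x → 2 ^ n * 2 ^ x) (+-identityʳ n))

  -- One `2 ^ n` out of `8 ^ n` turns the odd product into `n !` times a central binomial
  -- coefficient; the two resulting factors `n !`, together with `(2 * n) C n`, form the `(2 * n) !`
  -- that is cancelled.
  ratio-even : ∀ n h h′ → + (double n !) ℤ.* + h′ ≡ tri (double n) (double n) ℤ.* + h →
               h′ * ((2 * n) C n) ≡ 2 ^ (2 * n + 1) * ((4 * n) C (2 * n)) * h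
  ratio-even n h h′ e = *-cancelˡ-≡ _ _ ((2 * n) !) {{(2 * n) !≢0}} (begin
    (2 * n) ! * (h′ * c)                                  ≡⟨ sym (*-assoc ((2 * n) !) h′ c) ⟩
    (2 * n) ! * h′ * c                                    ≡⟨ cong (λ x → x ! * h′ * c) (2*≡double n) ⟩
    double n ! * h′ * c                                   ≡⟨ cong (_* c) relation ⟩
    2 * 8 ^ n * n ! * oddProduct n n * h * c              ≡⟨ cong (λ x → 2 * x * n ! * oddProduct n n * h * c) (8^≡ n) ⟩
    2 * (2 ^ n * 2 ^ n * 2 ^ n) * n ! * oddProduct n n * h * c
      ≡⟨ l₁ (2 ^ n) (n !) (oddProduct n n) h c ⟩
    2 * (2 ^ n * 2 ^ n) * n ! * (2 ^ n * oddProduct n n) * h * c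
      ≡⟨ cong (λ x → 2 * (2 ^ n * 2 ^ n) * n ! * x * h * c) (central-oddProduct n) ⟩
    2 * (2 ^ n * 2 ^ n) * n ! * (d * n !) * h * c         ≡⟨ l₂ (2 ^ n * 2 ^ n) (n !) d h c ⟩
    c * (n ! * n !) * (2 ^ n * 2 ^ n * 2 * d * h)         ≡⟨ cong₂ (λ x y → x * (y * 2 * d * h)) (central n) (sym (2^2* n)) ⟩
    (2 * n) ! * (2 ^ (2 * n) * 2 * d * h)                 ≡⟨ cong (λ x → (2 * n) ! * (x * d * h)) (^-distribˡ-+-* 2 (2 * n) 1) ⟨
    (2 * n) ! * (2 ^ (2 * n + 1) * d * h)                 ∎)
    where
    open ≡-Reasoning
    c = (2 * n) C n
    d = (4 * n) C (2 * n)
    relation : double n ! * h′ ≡ 2 * 8 ^ n * n ! * oddProduct n n * h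
    relation = ℤₚ.+-injective (trans (ℤₚ.pos-* (double n !) h′) (trans e (trans (cong (ℤ._* + h) (tri-even n))
                 (sym (ℤₚ.pos-* (2 * 8 ^ n * n ! * oddProduct n n) h)))))
    l₁ : ∀ e f o h c → 2 * (e * e * e) * f * o * h * c ≡ 2 * (e * e) * f * (e * o) * h * c
    l₁ = solve-∀
    l₂ : ∀ e f d h c → 2 * e * f * (d * f) * h * c ≡ c * (f * f) * (e * 2 * d * h)
    l₂ = solve-∀

  ratio-odd : ∀ k h h′ → + (suc (double k) !) ℤ.* + h′ ≡ tri (suc (double k)) (suc (double k)) ℤ.* + h → let n = suc k in
              h′ * ((2 * n) C n) ≡ 2 ^ (2 * n ∸ 1) * ((4 * n) C (2 * n)) * h
  ratio-odd k h h′ e = *-cancelˡ-≡ _ _ ((2 * n) !) {{(2 * n) !≢0}} (begin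
    (2 * n) ! * (h′ * c)                                       ≡⟨ cong (λ x → x ! * (h′ * c)) (2*≡double n) ⟩
    -- The factor `2 n` completes `(2 k + 1)!` to `(2 n)!`. On the other side its `n` completes
    -- `k !` to `n !`, and its 2 completes `2 ^ k` to `2 ^ n`.
    suc (suc (double k)) * suc (double k) ! * (h′ * c)         ≡⟨ l₀ (suc (suc (double k))) (suc (double k) !) h′ c ⟩
    suc (suc (double k)) * (suc (double k) ! * h′) * c         ≡⟨ cong₂ (λ x y → x * y * c) (sym (2*≡double n)) relation ⟩
    2 * n * (2 * 8 ^ k * k ! * oddProduct n n * h) * c
      ≡⟨ cong (λ x → 2 * n * (2 * x * k ! * oddProduct n n * h) * c) (8^≡ k) ⟩
    2 * n * (2 * (2 ^ k * 2 ^ k * 2 ^ k) * k ! * oddProduct n n * h) * c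
      ≡⟨ l₁ (2 ^ k) n (k !) (oddProduct n n) h c ⟩
    2 * (2 ^ k * 2 ^ k) * n ! * (2 ^ n * oddProduct n n) * h * c
      ≡⟨ cong (λ x → 2 * (2 ^ k * 2 ^ k) * n ! * x * h * c) (central-oddProduct n) ⟩
    2 * (2 ^ k * 2 ^ k) * n ! * (d * n !) * h * c              ≡⟨ l₂ (2 ^ k * 2 ^ k) (n !) d h c ⟩
    c * (n ! * n !) * (2 * (2 ^ k * 2 ^ k) * d * h)            ≡⟨ cong₂ (λ x y → x * (2 * y * d * h)) (central n) (sym (2^2* k)) ⟩
    (2 * n) ! * (2 ^ suc (2 * k) * d * h)                      ≡⟨ cong (λ x → (2 * n) ! * (2 ^ x * d * h)) (sym (+-suc k (k + 0))) ⟩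
    (2 * n) ! * (2 ^ (2 * n ∸ 1) * d * h)                      ∎)
    where
    open ≡-Reasoning
    n = suc k
    c = (2 * n) C n
    d = (4 * n) C (2 * n)
    relation : suc (double k) ! * h′ ≡ 2 * 8 ^ k * k ! * oddProduct n n * h
    relation = ℤₚ.+-injective (trans (ℤₚ.pos-* (suc (double k) !) h′) (trans e (trans (cong (ℤ._* + h) (tri-odd k))
                 (sym (ℤₚ.pos-* (2 * 8 ^ k * k ! * oddProduct n n) h)))))
    l₀ : ∀ a b h c → a * b * (h * c) ≡ a * (b * h) * c
    l₀ = solve-∀
    l₁ : ∀ e n f o h c → 2 * n * (2 * (e * e * e) * f * o * h) * c ≡ 2 * (e * e) * (n * f) * (2 * e * o) * h * c
    l₁ = solve-∀
    l₂ : ∀ e f d h c → 2 * e * f * (d * f) * h * c ≡ c * (f * f) * (2 * e * d * h)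
    l₂ = solve-∀

-- Alternating sign conditions as paths of partial sums

module MatrixSum where

  open RowTransfer
  open ExteriorAlgebra using (Selector)
  open import Defs
  open import Data.Integer as ℤ using (ℤ)
  import Data.Integer.Properties as ℤₚ
  open import Data.List as List using (List; filterᵇ; allFin)
  open import Data.List.Properties using (map-tabulate; map-cong; map-++; map-∘)
  open import Data.Nat using (_+_; _*_; _^_; _∸_; _<ᵇ_; _≡ᵇ_)
  open import Data.Nat.ListAction using (sum)
  open import Data.Nat.ListAction.Properties using (sum-++)
  open import Data.Nat.Properties
  open import Data.Nat.Tactic.RingSolver using (solve-∀)
  open import Data.Vec.Properties using (reverse-∷; reverse-reverse; reverse-involutive; map-∷ʳ; map-reverse; toList-∷ʳ; ∷ʳ-injective; ∷-injective; ≡-dec; tabulate-cong; tabulate-∘; lookup∘tabulate)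

  reverse-∷ʳ : ∀ {A : Set} {n} x (xs : Vec A n) → reverse (xs ∷ʳ x) ≡ x ∷ reverse xs
  reverse-∷ʳ x xs = reverse-reverse (trans (reverse-∷ x (reverse xs)) (cong (_∷ʳ x) (reverse-involutive xs)))

  reverse-ends : ∀ {A : Set} {n} x (xs : Vec A n) y → reverse (x ∷ (xs ∷ʳ y)) ≡ y ∷ (reverse xs ∷ʳ x)
  reverse-ends x xs y = trans (reverse-∷ x (xs ∷ʳ y)) (cong (_∷ʳ x) (reverse-∷ʳ y xs))

  zipWith-∷ʳ : ∀ {A B C : Set} {n} (f : A → B → C) (xs : Vec A n) x ys y →
               zipWith f (xs ∷ʳ x) (ys ∷ʳ y) ≡ zipWith f xs ys ∷ʳ f x y
  zipWith-∷ʳ f []       x []        y = refl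
  zipWith-∷ʳ f (z ∷ xs) x (w ∷ ys)  y = cong (f z w ∷_) (zipWith-∷ʳ f xs x ys y)

  zipWith-reverse : ∀ {A B C : Set} {n} (f : A → B → C) (xs : Vec A n) ys →
                    zipWith f (reverse xs) (reverse ys) ≡ reverse (zipWith f xs ys)
  zipWith-reverse f []       []       = refl
  zipWith-reverse f (x ∷ xs) (y ∷ ys)
    rewrite reverse-∷ x xs | reverse-∷ y ys | reverse-∷ (f x y) (zipWith f xs ys) =
    trans (zipWith-∷ʳ f (reverse xs) x (reverse ys) y) (cong (_∷ʳ f x y) (zipWith-reverse f xs ys))

  -- If S is reached after the top rows of a half-turn invariant matrix, star S is
  -- reached before the corresponding bottom rows.
  star : ∀ {n} → State n → State n
  star S = map not (reverse S)

  star-ends : ∀ {n} a (I : State n) b → star (a ∷ (I ∷ʳ b)) ≡ not b ∷ (star I ∷ʳ not a)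
  star-ends a I b rewrite reverse-ends a I b = cong (not b ∷_) (map-∷ʳ not a (reverse I))

  map-not-involutive : ∀ {n} (S : State n) → map not (map not S) ≡ S
  map-not-involutive []      = refl
  map-not-involutive (b ∷ S) = cong₂ _∷_ (not-involutive b) (map-not-involutive S)

  star-involutive : ∀ {n} (S : State n) → star (star S) ≡ S
  star-involutive S = begin
    map not (reverse (map not (reverse S)))   ≡⟨ cong (map not) (map-reverse not (reverse S)) ⟨
    map not (map not (reverse (reverse S)))   ≡⟨ map-not-involutive _ ⟩
    reverse (reverse S)                       ≡⟨ reverse-involutive S ⟩
    S                                         ∎
    where open ≡-Reasoning

  diff : Bool → Bool → Entry
  diff false false = zer
  diff false true  = pos
  diff true  false = neg
  diff true  true  = zer

  diffV : ∀ {n} → State n → State n → Vec Entry n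
  diffV = zipWith diff

  diff-not : ∀ s t → diff (not t) (not s) ≡ diff s t
  diff-not false false = refl
  diff-not false true  = refl
  diff-not true  false = refl
  diff-not true  true  = refl

  diffV-not : ∀ {n} (S T : State n) → diffV (map not T) (map not S) ≡ diffV S T
  diffV-not []      []      = refl
  diffV-not (s ∷ S) (t ∷ T) = cong₂ _∷_ (diff-not s t) (diffV-not S T)

  diffV-star : ∀ {n} (S T : State n) → reverse (diffV S T) ≡ diffV (star T) (star S)
  diffV-star S T = begin
    reverse (diffV S T)              ≡⟨ zipWith-reverse diff S T ⟨
    diffV (reverse S) (reverse T)    ≡⟨ diffV-not (reverse S) (reverse T) ⟨
    diffV (star T) (star S)          ∎
    where open ≡-Reasoning

  _==_ : Bool → Bool → Bool
  false == b = not b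
  true  == b = b

  -- The partial sums of the list, started at `h`, stay within 0 and 1 and end at `t`. From 0 to 1
  -- this is the alternating sign condition, in a form that can be extended at both ends of the
  -- list.
  runs : Bool → List Entry → Bool → Bool
  runs h     List.[]          t = h == t
  runs h     (zer List.∷ l) t = runs h l t
  runs false (pos List.∷ l) t = runs true l t
  runs true  (pos List.∷ l) t = false
  runs false (neg List.∷ l) t = false
  runs true  (neg List.∷ l) t = runs false l t

  runs-diff : ∀ s s′ l t → runs s (diff s s′ List.∷ l) t ≡ runs s′ l t
  runs-diff false false l t = refl
  runs-diff false true  l t = refl
  runs-diff true  false l t = refl
  runs-diff true  true  l t = refl

  runs-∷ʳ-diff : ∀ s l u v → runs s (l List.∷ʳ diff u v) v ≡ runs s l u
  runs-∷ʳ-diff false List.[] false false = refl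
  runs-∷ʳ-diff false List.[] false true  = refl
  runs-∷ʳ-diff false List.[] true  false = refl
  runs-∷ʳ-diff false List.[] true  true  = refl
  runs-∷ʳ-diff true  List.[] false false = refl
  runs-∷ʳ-diff true  List.[] false true  = refl
  runs-∷ʳ-diff true  List.[] true  false = refl
  runs-∷ʳ-diff true  List.[] true  true  = refl
  runs-∷ʳ-diff s     (zer List.∷ l) u v = runs-∷ʳ-diff s l u v
  runs-∷ʳ-diff false (pos List.∷ l) u v = runs-∷ʳ-diff true l u v
  runs-∷ʳ-diff true  (pos List.∷ l) u v = refl
  runs-∷ʳ-diff false (neg List.∷ l) u v = refl
  runs-∷ʳ-diff true  (neg List.∷ l) u v = runs-∷ʳ-diff false l u v

  Columns : ℕ → Set
  Columns n = Vec (List Entry) n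

  runsV : ∀ {n} → State n → Columns n → State n → Bool
  runsV []      []       []      = true
  runsV (s ∷ S) (c ∷ cs) (t ∷ T) = runs s c t ∧ runsV S cs T

  runsV-diff : ∀ {n} (S S′ : State n) cs T → runsV S (zipWith List._∷_ (diffV S S′) cs) T ≡ runsV S′ cs T
  runsV-diff []      []        []       []      = refl
  runsV-diff (s ∷ S) (s′ ∷ S′) (c ∷ cs) (t ∷ T) = cong₂ _∧_ (runs-diff s s′ c t) (runsV-diff S S′ cs T)

  runsV-∷ʳ-diff : ∀ {n} (S : State n) cs U V → runsV S (zipWith List._∷ʳ_ cs (diffV U V)) V ≡ runsV S cs U
  runsV-∷ʳ-diff []      []       []      []      = refl
  runsV-∷ʳ-diff (s ∷ S) (c ∷ cs) (u ∷ U) (v ∷ V) = cong₂ _∧_ (runs-∷ʳ-diff s c u v) (runsV-∷ʳ-diff S cs U V)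

  steps : Bool → Entry → Bool
  steps false neg = false
  steps true  pos = false
  steps _     _   = true

  stepsV : ∀ {n} → State n → Vec Entry n → Bool
  stepsV []      []      = true
  stepsV (s ∷ S) (e ∷ a) = steps s e ∧ stepsV S a

  runsV-stuck : ∀ {n} (S : State n) a cs T → stepsV S a ≡ false → runsV S (zipWith List._∷_ a cs) T ≡ false
  runsV-stuck []          []        []       []      ()
  runsV-stuck (false ∷ S) (neg ∷ a) (c ∷ cs) (t ∷ T) e = refl
  runsV-stuck (true  ∷ S) (pos ∷ a) (c ∷ cs) (t ∷ T) e = refl
  runsV-stuck (false ∷ S) (zer ∷ a) (c ∷ cs) (t ∷ T) e rewrite runsV-stuck S a cs T e = ∧-zeroʳ _
  runsV-stuck (false ∷ S) (pos ∷ a) (c ∷ cs) (t ∷ T) e rewrite runsV-stuck S a cs T e = ∧-zeroʳ _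
  runsV-stuck (true  ∷ S) (zer ∷ a) (c ∷ cs) (t ∷ T) e rewrite runsV-stuck S a cs T e = ∧-zeroʳ _
  runsV-stuck (true  ∷ S) (neg ∷ a) (c ∷ cs) (t ∷ T) e rewrite runsV-stuck S a cs T e = ∧-zeroʳ _

  -- Summation over rows and over states

  Sum : Set → Set
  Sum A = (A → ℕ) → ℕ

  -- Sums are functionals, so the laws needed below (congruence, homogeneity, collapse to a single
  -- term) pass from entries to rows and from rows to matrices by the same lemmas.
  sumV : ∀ {A : Set} → Sum A → ∀ k → Sum (Vec A k)
  sumV σ zero    φ = φ []
  sumV σ (suc k) φ = σ (λ a → sumV σ k (λ v → φ (a ∷ v)))

  module _ {A : Set} {σ : Sum A} where

    sumV-cong : (∀ {f g} → (∀ a → f a ≡ g a) → σ f ≡ σ g) →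
                ∀ k {f g} → (∀ v → f v ≡ g v) → sumV σ k f ≡ sumV σ k g
    sumV-cong c zero    e = e []
    sumV-cong c (suc k) e = c (λ a → sumV-cong c k (λ v → e (a ∷ v)))

    sumV-snoc : (∀ {f g} → (∀ a → f a ≡ g a) → σ f ≡ σ g) →
                ∀ k φ → sumV σ (suc k) φ ≡ sumV σ k (λ v → σ (λ b → φ (v ∷ʳ b)))
    sumV-snoc c zero    φ = refl
    sumV-snoc c (suc k) φ = c (λ a → sumV-snoc c k (λ v → φ (a ∷ v)))

    sumV-point : (∀ {f} b → (∀ a → a ≢ b → f a ≡ 0) → σ f ≡ f b) → DecidableEquality A →
                 ∀ k {f} w → (∀ v → v ≢ w → f v ≡ 0) → sumV σ k f ≡ f w
    sumV-point p d zero    []      z = refl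
    sumV-point p d (suc k) {f} (b ∷ w) z =
      trans (p b λ a a≢b → trans (sumV-point p d k w λ v _ → z (a ∷ v) (a≢b ∘ proj₁ ∘ ∷-injective)) (z (a ∷ w) (a≢b ∘ proj₁ ∘ ∷-injective)))
            (sumV-point p d k w λ v v≢w → z (b ∷ v) (v≢w ∘ proj₂ ∘ ∷-injective))

    sumV-* : (∀ c f → σ (λ a → c * f a) ≡ c * σ f) → (∀ {f g} → (∀ a → f a ≡ g a) → σ f ≡ σ g) →
             ∀ k c φ → sumV σ k (λ v → c * φ v) ≡ c * sumV σ k φ
    sumV-* m e zero    c φ = refl
    sumV-* m e (suc k) c φ = trans (e (λ a → sumV-* m e k c (λ v → φ (a ∷ v)))) (m c _)

  σE : Sum Entry
  σE f = f neg + (f zer + f pos)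

  σE-cong : ∀ {f g : Entry → ℕ} → (∀ a → f a ≡ g a) → σE f ≡ σE g
  σE-cong e = cong₂ _+_ (e neg) (cong₂ _+_ (e zer) (e pos))

  σE-* : ∀ c f → σE (λ a → c * f a) ≡ c * σE f
  σE-* c f = lemma c (f neg) (f zer) (f pos)
    where
    lemma : ∀ c x y z → c * x + (c * y + c * z) ≡ c * (x + (y + z))
    lemma = solve-∀

  σE-point : ∀ {f} b → (∀ a → a ≢ b → f a ≡ 0) → σE f ≡ f b
  σE-point {f} neg z rewrite z zer (λ ()) | z pos (λ ()) = +-identityʳ (f neg)
  σE-point {f} zer z rewrite z neg (λ ()) | z pos (λ ()) = +-identityʳ (f zer)
  σE-point {f} pos z rewrite z neg (λ ()) | z zer (λ ()) = refl

  _≟ᴱ_ : DecidableEquality Entry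
  neg ≟ᴱ neg = yes refl
  neg ≟ᴱ zer = no λ ()
  neg ≟ᴱ pos = no λ ()
  zer ≟ᴱ neg = no λ ()
  zer ≟ᴱ zer = yes refl
  zer ≟ᴱ pos = no λ ()
  pos ≟ᴱ neg = no λ ()
  pos ≟ᴱ zer = no λ ()
  pos ≟ᴱ pos = yes refl

  Row : ℕ → Set
  Row = Vec Entry

  Rows : ℕ → ℕ → Set
  Rows n k = Vec (Row n) k

  σR : ∀ n → Sum (Row n)
  σR n = sumV σE n

  σR-cong : ∀ {n} {f g : Row n → ℕ} → (∀ a → f a ≡ g a) → σR n f ≡ σR n g
  σR-cong = sumV-cong σE-cong _

  σR-* : ∀ {n} c f → σR n (λ a → c * f a) ≡ c * σR n f
  σR-* = sumV-* σE-* σE-cong _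

  σR-point : ∀ {n} {f : Row n → ℕ} b → (∀ a → a ≢ b → f a ≡ 0) → σR n f ≡ f b
  σR-point = sumV-point σE-point _≟ᴱ_ _

  σS : ∀ {n} → Sum (State n)
  σS {zero}  f = f []
  σS {suc n} f = σS (f at false) + σS (f at true)

  σS-cong : ∀ {n} {f g : State n → ℕ} → (∀ S → f S ≡ g S) → σS f ≡ σS g
  σS-cong {zero}  e = e []
  σS-cong {suc n} e = cong₂ _+_ (σS-cong (λ S → e (false ∷ S))) (σS-cong (λ S → e (true ∷ S)))

  σS-zero : ∀ n → σS {n} (λ _ → 0) ≡ 0
  σS-zero zero    = refl
  σS-zero (suc n) = cong₂ _+_ (σS-zero n) (σS-zero n)

  σS-* : ∀ {n} c (f : State n → ℕ) → σS (λ S → c * f S) ≡ c * σS f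
  σS-* {zero}  c f = refl
  σS-* {suc n} c f = trans (cong₂ _+_ (σS-* c (f at false)) (σS-* c (f at true))) (sym (*-distribˡ-+ c _ _))

  σS-point : ∀ {n} {f : State n → ℕ} U → (∀ T → T ≢ U → f T ≡ 0) → σS f ≡ f U
  σS-point []          z = refl
  σS-point {suc n} (false ∷ U) z =
    trans (cong₂ _+_ (σS-point U (λ T T≢U → z (false ∷ T) (T≢U ∘ proj₂ ∘ ∷-injective)))
                     (trans (σS-cong (λ T → z (true ∷ T) (λ ()))) (σS-zero n)))
          (+-identityʳ _)
  σS-point {suc n} (true ∷ U)  z =
    cong₂ _+_ (trans (σS-cong (λ T → z (false ∷ T) (λ ()))) (σS-zero n))
              (σS-point U (λ T T≢U → z (true ∷ T) (T≢U ∘ proj₂ ∘ ∷-injective)))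

  σR-zero : ∀ n {f : Row n → ℕ} → (∀ a → f a ≡ 0) → σR n f ≡ 0
  σR-zero zero    z = z []
  σR-zero (suc n) z
    rewrite σR-zero n (λ a → z (neg ∷ a)) | σR-zero n (λ a → z (zer ∷ a)) | σR-zero n (λ a → z (pos ∷ a)) = refl

  -- A row that keeps every column sum within 0 and 1 is the difference between `S` and a unique
  -- next state.
  σR-diff : ∀ {n} (S : State n) {g : Row n → ℕ} → (∀ a → stepsV S a ≡ false → g a ≡ 0) →
            σR n g ≡ σS (λ T → g (diffV S T))
  σR-diff []          z = refl
  σR-diff {suc n} (false ∷ S) z
    rewrite σR-zero n (λ a → z (neg ∷ a) refl) =
    cong₂ _+_ (σR-diff S (λ a e → z (zer ∷ a) e)) (σR-diff S (λ a e → z (pos ∷ a) e))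
  σR-diff {suc n} (true ∷ S)  {g} z
    rewrite σR-zero n (λ a → z (pos ∷ a) refl) | +-identityʳ (σR n (λ a → g (zer ∷ a))) =
    cong₂ _+_ (σR-diff S (λ a e → z (neg ∷ a) e)) (σR-diff S (λ a e → z (zer ∷ a) e))

  kernel : ∀ {n} → Bool → Row n → ℕ
  kernel true  []        = 1
  kernel false []        = 0
  kernel h     (zer ∷ a) = kernel h a
  kernel false (pos ∷ a) = kernel true a
  kernel true  (pos ∷ a) = 0
  kernel false (neg ∷ a) = 0
  kernel true  (neg ∷ a) = 2 * kernel false a

  D-kernel : ∀ {n} h (f : State n → ℕ) S → σS (λ T → kernel h (diffV S T) * f T) ≡ D h f S
  D-kernel true  f []          = +-identityʳ (f [])
  D-kernel false f []          = refl
  D-kernel false f (false ∷ S) = cong₂ _+_ (D-kernel false (f at false) S) (D-kernel true (f at true) S)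
  D-kernel {suc n} false f (true ∷ S)  = cong₂ _+_ (σS-zero n) (D-kernel false (f at true) S)
  D-kernel {suc n} true  f (false ∷ S) = trans (cong₂ _+_ (D-kernel true (f at false) S) (σS-zero n)) (+-identityʳ _)
  D-kernel true  f (true ∷ S)  = cong₂ _+_
    (trans (σS-cong (λ T → *-assoc 2 (kernel false (diffV S T)) (f (false ∷ T))))
    (trans (σS-* 2 (λ T → kernel false (diffV S T) * f (false ∷ T)))
           (cong (2 *_) (D-kernel false (f at false) S))))
    (D-kernel true (f at true) S)

  b2n : Bool → ℕ
  b2n b = if b then 1 else 0

  negs : ∀ {n} → Row n → ℕ
  negs []      = 0
  negs (e ∷ a) = b2n (isNeg e) + negs a

  kernel-runs : ∀ {n} h (a : Row n) → kernel h a ≡ (if runs h (toList a) true then 2 ^ negs a else 0)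
  kernel-runs true  []        = refl
  kernel-runs false []        = refl
  kernel-runs true  (zer ∷ a) = kernel-runs true a
  kernel-runs false (zer ∷ a) = kernel-runs false a
  kernel-runs false (pos ∷ a) = kernel-runs true a
  kernel-runs true  (pos ∷ a) = refl
  kernel-runs false (neg ∷ a) = refl
  kernel-runs true  (neg ∷ a) rewrite kernel-runs false a with runs false (toList a) true
  ... | true  = refl
  ... | false = refl

  runs-∷ʳ-stuck-pos : ∀ s l → runs s (l List.∷ʳ pos) false ≡ false
  runs-∷ʳ-stuck-pos false List.[]          = refl
  runs-∷ʳ-stuck-pos true  List.[]          = refl
  runs-∷ʳ-stuck-pos s     (zer List.∷ l) = runs-∷ʳ-stuck-pos s l
  runs-∷ʳ-stuck-pos false (pos List.∷ l) = runs-∷ʳ-stuck-pos true l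
  runs-∷ʳ-stuck-pos true  (pos List.∷ l) = refl
  runs-∷ʳ-stuck-pos false (neg List.∷ l) = refl
  runs-∷ʳ-stuck-pos true  (neg List.∷ l) = runs-∷ʳ-stuck-pos false l

  runs-∷ʳ-stuck-neg : ∀ s l → runs s (l List.∷ʳ neg) true ≡ false
  runs-∷ʳ-stuck-neg false List.[]          = refl
  runs-∷ʳ-stuck-neg true  List.[]          = refl
  runs-∷ʳ-stuck-neg s     (zer List.∷ l) = runs-∷ʳ-stuck-neg s l
  runs-∷ʳ-stuck-neg false (pos List.∷ l) = runs-∷ʳ-stuck-neg true l
  runs-∷ʳ-stuck-neg true  (pos List.∷ l) = refl
  runs-∷ʳ-stuck-neg false (neg List.∷ l) = refl
  runs-∷ʳ-stuck-neg true  (neg List.∷ l) = runs-∷ʳ-stuck-neg false l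

  ==-not : ∀ h t → h == t ≡ not t == not h
  ==-not false false = refl
  ==-not false true  = refl
  ==-not true  false = refl
  ==-not true  true  = refl

  -- Reading backwards reverses the path of partial sums and negates its steps; replacing each
  -- partial sum `x` by `1 - x` restores the steps.
  runs-reverse : ∀ {n} h (a : Row n) t → runs h (toList (reverse a)) t ≡ runs (not t) (toList a) (not h)
  runs-reverse h []      t = ==-not h t
  runs-reverse h (e ∷ a) t rewrite reverse-∷ e a | toList-∷ʳ e (reverse a) = go e t
    where
    l = toList (reverse a)
    go : ∀ e t → runs h (l List.∷ʳ e) t ≡ runs (not t) (e List.∷ toList a) (not h)
    go zer false = trans (runs-∷ʳ-diff h l false false) (runs-reverse h a false)
    go zer true  = trans (runs-∷ʳ-diff h l true true) (runs-reverse h a true)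
    go pos true  = trans (runs-∷ʳ-diff h l false true) (runs-reverse h a false)
    go neg false = trans (runs-∷ʳ-diff h l true false) (runs-reverse h a true)
    go pos false = runs-∷ʳ-stuck-pos h l
    go neg true  = runs-∷ʳ-stuck-neg h l

  good : ∀ {n} → Row n → Bool
  good a = runs false (toList a) true

  rowsGood : ∀ {n k} → Rows n k → Bool
  rowsGood []      = true
  rowsGood (a ∷ M) = good a ∧ rowsGood M

  rowsGood-∷ʳ : ∀ {n k} (M : Rows n k) b → rowsGood (M ∷ʳ b) ≡ rowsGood M ∧ good b
  rowsGood-∷ʳ []      b = ∧-comm (good b) true
  rowsGood-∷ʳ (a ∷ M) b = trans (cong (good a ∧_) (rowsGood-∷ʳ M b)) (sym (∧-assoc (good a) _ _))

  cols : ∀ {n k} → Rows n k → Columns n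
  cols []      = replicate _ List.[]
  cols (a ∷ M) = zipWith List._∷_ a (cols M)

  cols-∷ʳ : ∀ {n k} (M : Rows n k) b → cols (M ∷ʳ b) ≡ zipWith List._∷ʳ_ (cols M) b
  cols-∷ʳ [] b = lemma b
    where
    lemma : ∀ {n} (b : Row n) → zipWith List._∷_ b (replicate n List.[]) ≡ zipWith List._∷ʳ_ (replicate n List.[]) b
    lemma []      = refl
    lemma (e ∷ b) = cong (_ ∷_) (lemma b)
  cols-∷ʳ (a ∷ M) b = trans (cong (zipWith List._∷_ a) (cols-∷ʳ M b)) (lemma a (cols M) b)
    where
    lemma : ∀ {n} (a : Row n) cs b →
            zipWith List._∷_ a (zipWith List._∷ʳ_ cs b) ≡ zipWith List._∷ʳ_ (zipWith List._∷_ a cs) b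
    lemma []      []       []      = refl
    lemma (x ∷ a) (c ∷ cs) (y ∷ b) = cong (_ ∷_) (lemma a cs b)

  -- Half-turn symmetry and orbits of the entries -1

  rot : ∀ {n k} → Rows n k → Rows n k
  rot M = map reverse (reverse M)

  rot-ends : ∀ {n k} a (M : Rows n k) b → rot (a ∷ (M ∷ʳ b)) ≡ reverse b ∷ (rot M ∷ʳ reverse a)
  rot-ends a M b rewrite reverse-ends a M b = cong (reverse b ∷_) (map-∷ʳ reverse a (reverse M))

  _≟ᴹ_ : ∀ {n k} → DecidableEquality (Rows n k)
  _≟ᴹ_ = ≡-dec (≡-dec _≟ᴱ_)

  symmetric : ∀ {n k} → Rows n k → Bool
  symmetric M = does (M ≟ᴹ rot M)

  does-⇔ : ∀ {A B : Set} (a : Dec A) (b : Dec B) → (A → B) → (B → A) → does a ≡ does b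
  does-⇔ (yes a) b f g = sym (dec-true b (f a))
  does-⇔ (no ¬a) b f g = sym (dec-false b (¬a ∘ g))

  symmetric-ends : ∀ {n k} a (M : Rows n k) → symmetric (a ∷ (M ∷ʳ reverse a)) ≡ symmetric M
  symmetric-ends a M = does-⇔ (_ ≟ᴹ _) (M ≟ᴹ rot M) to from
    where
    ends : rot (a ∷ (M ∷ʳ reverse a)) ≡ a ∷ (rot M ∷ʳ reverse a)
    ends = trans (rot-ends a M (reverse a)) (cong (_∷ (rot M ∷ʳ reverse a)) (reverse-involutive a))
    to : a ∷ (M ∷ʳ reverse a) ≡ rot (a ∷ (M ∷ʳ reverse a)) → M ≡ rot M
    to e = proj₁ (∷ʳ-injective M (rot M) (proj₂ (∷-injective (trans e ends))))
    from : M ≡ rot M → a ∷ (M ∷ʳ reverse a) ≡ rot (a ∷ (M ∷ʳ reverse a))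
    from e = trans (cong (λ N → a ∷ (N ∷ʳ reverse a)) e) (sym ends)

  asymmetric-ends : ∀ {n k} a (M : Rows n k) b → b ≢ reverse a → symmetric (a ∷ (M ∷ʳ b)) ≡ false
  asymmetric-ends a M b b≢ = dec-false (_ ≟ᴹ _) λ e →
    b≢ (proj₂ (∷ʳ-injective M (rot M) (proj₂ (∷-injective (trans e (rot-ends a M b))))))

  sumFin : ∀ k → (Fin k → ℕ) → ℕ
  sumFin zero    f = 0
  sumFin (suc k) f = f Fin.zero + sumFin k (f ∘ Fin.suc)

  sumFin-cong : ∀ k {f g} → (∀ i → f i ≡ g i) → sumFin k f ≡ sumFin k g
  sumFin-cong zero    e = refl
  sumFin-cong (suc k) e = cong₂ _+_ (e Fin.zero) (sumFin-cong k (e ∘ Fin.suc))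

  sumFin-zero : ∀ k → sumFin k (λ _ → 0) ≡ 0
  sumFin-zero zero    = refl
  sumFin-zero (suc k) = sumFin-zero k

  sumFin-snoc : ∀ k f → sumFin (suc k) f ≡ sumFin k (f ∘ inject₁) + f (fromℕ k)
  sumFin-snoc zero    f = +-identityʳ _
  sumFin-snoc (suc k) f = trans (cong (f Fin.zero +_) (sumFin-snoc k (f ∘ Fin.suc))) (sym (+-assoc (f Fin.zero) _ _))

  lookup-inject₁ : ∀ {A : Set} {n} (xs : Vec A n) x i → lookup (xs ∷ʳ x) (inject₁ i) ≡ lookup xs i
  lookup-inject₁ (y ∷ xs) x Fin.zero    = refl
  lookup-inject₁ (y ∷ xs) x (Fin.suc i) = lookup-inject₁ xs x i

  toℕ-opposite-fromℕ : ∀ k → toℕ (opposite (fromℕ k)) ≡ 0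
  toℕ-opposite-fromℕ k = trans (opposite-prop (fromℕ k)) (trans (cong (k ∸_) (toℕ-fromℕ k)) (n∸n≡0 k))

  toℕ-opposite-inject₁ : ∀ {k} (i : Fin k) → toℕ (opposite (inject₁ i)) ≡ suc (toℕ (opposite i))
  toℕ-opposite-inject₁ {suc k} Fin.zero    = refl
  toℕ-opposite-inject₁ {suc k} (Fin.suc i) =
    trans (toℕ-inject₁ (opposite (inject₁ i))) (trans (toℕ-opposite-inject₁ i) (cong suc (sym (toℕ-inject₁ (opposite i)))))

  module _ {A : Set} (φ : ℕ → ℕ → A → ℕ) where

    weightedSum : ∀ {k} → Vec A k → ℕ
    weightedSum {k} v = sumFin k (λ i → φ (toℕ i) (toℕ (opposite i)) (lookup v i))

    -- Representatives are chosen by comparing an index with its mirror image. Removing both ends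
    -- lowers both indices by one and keeps the comparison, and the last item counts nothing because
    -- the first represents their common orbits. Serves both for the rows of a matrix and for the
    -- entries of a middle row.
    weightedSum-ends : (∀ i o x → φ (suc i) (suc o) x ≡ φ i o x) → (∀ i x → φ (suc i) 0 x ≡ 0) →
                       ∀ {k} x (v : Vec A k) y → weightedSum (x ∷ (v ∷ʳ y)) ≡ φ 0 (suc k) x + weightedSum v
    weightedSum-ends shift last {k} x v y = begin
      f Fin.zero + sumFin (suc k) (f ∘ Fin.suc)
        ≡⟨ cong (f Fin.zero +_) (sumFin-snoc k (f ∘ Fin.suc)) ⟩
      f Fin.zero + (sumFin k (λ i → f (Fin.suc (inject₁ i))) + f (Fin.suc (fromℕ k)))
        ≡⟨ cong₂ _+_ (cong (λ o → φ 0 o x) (toℕ-fromℕ (suc k)))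
             (cong₂ _+_ (sumFin-cong k middle) end) ⟩
      φ 0 (suc k) x + (weightedSum v + 0)
        ≡⟨ cong (φ 0 (suc k) x +_) (+-identityʳ _) ⟩
      φ 0 (suc k) x + weightedSum v ∎
      where
      open ≡-Reasoning
      f : Fin (suc (suc k)) → ℕ
      f i = φ (toℕ i) (toℕ (opposite i)) (lookup (x ∷ (v ∷ʳ y)) i)
      end : f (Fin.suc (fromℕ k)) ≡ 0
      end rewrite toℕ-inject₁ (opposite (fromℕ k)) | toℕ-opposite-fromℕ k = last _ _
      middle : ∀ i → f (Fin.suc (inject₁ i)) ≡ φ (toℕ i) (toℕ (opposite i)) (lookup v i)
      middle i rewrite toℕ-inject₁ (opposite (inject₁ i)) | toℕ-opposite-inject₁ i | toℕ-inject₁ i | lookup-inject₁ v y i =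
        shift (toℕ i) (toℕ (opposite i)) (lookup v i)

  lex : ℕ → ℕ → ℕ → ℕ → Bool
  lex i j i′ j′ = (i <ᵇ i′) ∨ ((i ≡ᵇ i′) ∧ ((j <ᵇ j′) ∨ (j ≡ᵇ j′)))

  rowNegs : ∀ {n} → ℕ → ℕ → Row n → ℕ
  rowNegs i i′ = weightedSum (λ j j′ e → b2n (isNeg e ∧ lex i j i′ j′))

  orbits : ∀ {n k} → Rows n k → ℕ
  orbits = weightedSum rowNegs

  rowNegs-top : ∀ {n} o (a : Row n) → rowNegs 0 (suc o) a ≡ negs a
  rowNegs-top {n} o a = trans (sumFin-cong n (λ j → cong b2n (∧-identityʳ (isNeg (lookup a j))))) (lemma a)
    where
    lemma : ∀ {n} (a : Row n) → sumFin n (λ j → b2n (isNeg (lookup a j))) ≡ negs a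
    lemma []      = refl
    lemma (e ∷ a) = cong (b2n (isNeg e) +_) (lemma a)

  rowNegs-bottom : ∀ {n} i (a : Row n) → rowNegs (suc i) 0 a ≡ 0
  rowNegs-bottom {n} i a = trans (sumFin-cong n (λ j → cong b2n (∧-zeroʳ (isNeg (lookup a j))))) (sumFin-zero n)

  orbits-ends : ∀ {n k} a (M : Rows n k) b → orbits (a ∷ (M ∷ʳ b)) ≡ negs a + orbits M
  orbits-ends {k = k} a M b =
    trans (weightedSum-ends rowNegs (λ _ _ _ → refl) rowNegs-bottom a M b) (cong (_+ orbits M) (rowNegs-top k a))

  -- The weight of the k rows of a half-turn invariant matrix that remain between the
  -- states S and star S.
  weightFrom : ∀ {n k} → State n → Rows n k → ℕ
  weightFrom S M = if runsV S (cols M) (star S) ∧ (rowsGood M ∧ symmetric M) then 2 ^ orbits M else 0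

  weightFrom-stuck : ∀ {n k} (S : State n) a (M : Rows n k) → stepsV S a ≡ false → weightFrom S (a ∷ M) ≡ 0
  weightFrom-stuck S a M e rewrite runsV-stuck S a (cols M) (star S) e = refl

  weightFrom-asymmetric : ∀ {n k} (S : State n) a (M : Rows n k) b → b ≢ reverse a → weightFrom S (a ∷ (M ∷ʳ b)) ≡ 0
  weightFrom-asymmetric S a M b b≢ rewrite asymmetric-ends a M b b≢ | ∧-zeroʳ (rowsGood (a ∷ (M ∷ʳ b)))
    | ∧-zeroʳ (runsV S (cols (a ∷ (M ∷ʳ b))) (star S)) = refl

  -- The first row leads from `S` to `T`; its reversal, as last row, leads from `star T` to
  -- `star S`, so the inner rows lead from `T` to `star T`. Both outer rows are good together, and
  -- each orbit in them is counted in the upper one.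
  weightFrom-ends : ∀ {n k} (S T : State n) (M : Rows n k) → let a = diffV S T in
            weightFrom S (a ∷ (M ∷ʳ reverse a)) ≡ kernel false a * weightFrom T M
  weightFrom-ends S T M
    rewrite orbits-ends (diffV S T) M (reverse (diffV S T)) | symmetric-ends (diffV S T) M
          | rowsGood-∷ʳ M (reverse (diffV S T)) | runs-reverse false (diffV S T) true
          | cols-∷ʳ M (reverse (diffV S T))
          | runsV-diff S T (zipWith List._∷ʳ_ (cols M) (reverse (diffV S T))) (star S)
          | diffV-star S T | runsV-∷ʳ-diff T (cols M) (star T) (star S)
          | kernel-runs false (diffV S T) =
    lemma (good (diffV S T)) (runsV T (cols M) (star T)) (rowsGood M) (symmetric M) (negs (diffV S T)) (orbits M)
    where
    lemma : ∀ g x r h p q → (if x ∧ ((g ∧ (r ∧ g)) ∧ h) then 2 ^ (p + q) else 0)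
                          ≡ (if g then 2 ^ p else 0) * (if x ∧ (r ∧ h) then 2 ^ q else 0)
    lemma false false r     h     p q = refl
    lemma false true  r     h     p q = refl
    lemma true  false r     h     p q = sym (*-zeroʳ (2 ^ p))
    lemma true  true  false h     p q = sym (*-zeroʳ (2 ^ p))
    lemma true  true  true  false p q = sym (*-zeroʳ (2 ^ p))
    lemma true  true  true  true  p q = ^-distribˡ-+-* 2 p q

  -- Removing the outer rows, and the boundary functional in even size

  partialSum : ∀ {n} k → State n → ℕ
  partialSum {n} k S = sumV (σR n) k (weightFrom S)

  partialSum-step : ∀ {n} k (S : State n) → partialSum (suc (suc k)) S ≡ D false (partialSum k) S
  partialSum-step {n} k S = begin
    σR n (λ a → sumV (σR n) (suc k) (λ M → weightFrom S (a ∷ M)))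
      ≡⟨ σR-cong (λ a → sumV-snoc σR-cong k (λ M → weightFrom S (a ∷ M))) ⟩
    σR n (λ a → sumV (σR n) k (λ M → σR n (λ b → weightFrom S (a ∷ (M ∷ʳ b)))))
      -- Half-turn invariance leaves a single choice for the last row.
      ≡⟨ σR-cong (λ a → sumV-cong σR-cong k (λ M → σR-point (reverse a) (weightFrom-asymmetric S a M))) ⟩
    σR n (λ a → sumV (σR n) k (λ M → weightFrom S (a ∷ (M ∷ʳ reverse a))))
      ≡⟨ σR-diff S (λ a e → trans (sumV-cong σR-cong k (λ M → weightFrom-stuck S a (M ∷ʳ reverse a) e)) (sumV-zero k)) ⟩
    σS (λ T → sumV (σR n) k (λ M → weightFrom S (diffV S T ∷ (M ∷ʳ reverse (diffV S T)))))
      ≡⟨ σS-cong (λ T → sumV-cong σR-cong k (λ M → weightFrom-ends S T M)) ⟩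
    σS (λ T → sumV (σR n) k (λ M → kernel false (diffV S T) * weightFrom T M))
      ≡⟨ σS-cong (λ T → sumV-* σR-* σR-cong k (kernel false (diffV S T)) (weightFrom T)) ⟩
    σS (λ T → kernel false (diffV S T) * partialSum k T)
      ≡⟨ D-kernel false (partialSum k) S ⟩
    D false (partialSum k) S ∎
    where
    open ≡-Reasoning
    sumV-zero : ∀ k → sumV (σR n) k (λ _ → 0) ≡ 0
    sumV-zero zero    = refl
    sumV-zero (suc k) = σR-zero n (λ _ → sumV-zero k)

  -- With no row left the columns must already match: the indicator of `S ≡ star S`, which says that
  -- of each column and its mirror image exactly one is occupied.
  fixedByStar : ∀ {n} → State n → ℕ
  fixedByStar S = weightFrom S []

  runsV-∷ʳ : ∀ {n} (S : State n) s cs c T t → runsV (S ∷ʳ s) (cs ∷ʳ c) (T ∷ʳ t) ≡ runsV S cs T ∧ runs s c t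
  runsV-∷ʳ []      s []       c []      t = ∧-comm (runs s c t) true
  runsV-∷ʳ (x ∷ S) s (y ∷ cs) c (z ∷ T) t = trans (cong (runs x y z ∧_) (runsV-∷ʳ S s cs c T t)) (sym (∧-assoc (runs x y z) _ _))

  replicate-∷ʳ : ∀ {A : Set} n (x : A) → replicate (suc n) x ≡ replicate n x ∷ʳ x
  replicate-∷ʳ zero    x = refl
  replicate-∷ʳ (suc n) x = cong (x ∷_) (replicate-∷ʳ n x)

  runsV-[]-ends : ∀ {n} a (I : State n) b →
                  runsV (a ∷ (I ∷ʳ b)) (replicate (suc (suc n)) List.[]) (star (a ∷ (I ∷ʳ b)))
                  ≡ (a == not b) ∧ (runsV I (replicate n List.[]) (star I) ∧ (b == not a))
  runsV-[]-ends {n} a I b =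
    trans (cong₂ (λ cs T → runsV (a ∷ (I ∷ʳ b)) (List.[] ∷ cs) T) (replicate-∷ʳ n List.[]) (star-ends a I b))
          (cong ((a == not b) ∧_) (runsV-∷ʳ I b (replicate n List.[]) List.[] (star I) (not a)))

  fixedByStar-ends : ∀ {n} a (I : State n) b → fixedByStar (a ∷ (I ∷ʳ b)) ≡ (if a == not b then fixedByStar I else 0)
  fixedByStar-ends {n} a I b =
    trans (cong (λ x → if x ∧ true then 1 else 0) (runsV-[]-ends a I b))
          (lemma a b (runsV I (replicate n List.[]) (star I)))
    where
    lemma : ∀ a b x → (if ((a == not b) ∧ (x ∧ (b == not a))) ∧ true then 1 else 0) ≡ (if a == not b then (if x ∧ true then 1 else 0) else 0)
    lemma false false x     = refl
    lemma false true  false = refl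
    lemma false true  true  = refl
    lemma true  false false = refl
    lemma true  false true  = refl
    lemma true  true  x     = refl

  fixedByStar-selector : Selector (λ m → fixedByStar {double m})
  fixedByStar-selector = record
    { base = refl
    ; ff   = λ m I → fixedByStar-ends false I false
    ; ft   = λ m I → fixedByStar-ends false I true
    ; tf   = λ m I → fixedByStar-ends true I false
    ; tt   = λ m I → fixedByStar-ends true I true
    }

  -- The middle row in odd size, and hopping into it

  runsV-[]-refl : ∀ {n} (S : State n) → runsV S (replicate n List.[]) S ≡ true
  runsV-[]-refl []          = refl
  runsV-[]-refl (false ∷ S) = runsV-[]-refl S
  runsV-[]-refl (true ∷ S)  = runsV-[]-refl S

  runsV-[]-≢ : ∀ {n} (S T : State n) → S ≢ T → runsV S (replicate n List.[]) T ≡ false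
  runsV-[]-≢ []          []          ne = contradiction refl ne
  runsV-[]-≢ (false ∷ S) (true ∷ T)  ne = refl
  runsV-[]-≢ (true ∷ S)  (false ∷ T) ne = refl
  runsV-[]-≢ (false ∷ S) (false ∷ T) ne = runsV-[]-≢ S T (ne ∘ cong (false ∷_))
  runsV-[]-≢ (true ∷ S)  (true ∷ T)  ne = runsV-[]-≢ S T (ne ∘ cong (true ∷_))

  middle : ∀ {n} → State n → Row n
  middle S = diffV S (star S)

  -- The weight of a middle row; by symmetry it runs from the partial sum h to not h
  -- between two mirror image columns.
  middleWeight : ∀ {n} → Bool → State n → ℕ
  middleWeight h S = if runs h (toList (middle S)) (not h) then 2 ^ rowNegs 0 0 (middle S) else 0

  -- The remaining row must lead from `S` to `star S`, which determines it; since `star` is an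
  -- involution this row is automatically a palindrome.
  partialSum-one : ∀ {n} (S : State n) → partialSum 1 S ≡ middleWeight false S
  partialSum-one {n} S = begin
    σR n (λ a → weightFrom S (a ∷ []))                ≡⟨ σR-diff S (λ a → weightFrom-stuck S a []) ⟩
    σS (λ T → weightFrom S (diffV S T ∷ []))          ≡⟨ σS-point (star S) off ⟩
    weightFrom S (middle S ∷ [])                      ≡⟨ on ⟩
    middleWeight false S                                 ∎
    where
    open ≡-Reasoning
    off : ∀ T → T ≢ star S → weightFrom S (diffV S T ∷ []) ≡ 0
    off T ne rewrite runsV-diff S T (replicate n List.[]) (star S) | runsV-[]-≢ T (star S) ne = refl
    palindrome : middle S ∷ [] ≡ rot (middle S ∷ [])
    palindrome = cong (_∷ []) (sym (trans (diffV-star S (star S)) (cong (λ U → diffV U (star S)) (star-involutive S))))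
    on : weightFrom S (middle S ∷ []) ≡ middleWeight false S
    on rewrite runsV-diff S (star S) (replicate n List.[]) (star S) | runsV-[]-refl (star S)
             | dec-true ((middle S ∷ []) ≟ᴹ rot (middle S ∷ [])) palindrome
             | ∧-identityʳ (good (middle S)) | ∧-identityʳ (good (middle S))
             | +-identityʳ (rowNegs 0 0 (middle S)) = refl

  middle-ends : ∀ {n} b (I : State n) c → middle (b ∷ (I ∷ʳ c)) ≡ diff b (not c) ∷ (middle I ∷ʳ diff c (not b))
  middle-ends b I c rewrite star-ends b I c = cong (diff b (not c) ∷_) (zipWith-∷ʳ diff I c (star I) (not b))

  rowNegs-ends : ∀ {n} x (a : Row n) y → rowNegs 0 0 (x ∷ (a ∷ʳ y)) ≡ b2n (isNeg x) + rowNegs 0 0 a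
  rowNegs-ends {n} x a y =
    trans (weightedSum-ends (λ j j′ e → b2n (isNeg e ∧ lex 0 j 0 j′)) (λ _ _ _ → refl)
            (λ _ e → cong b2n (∧-zeroʳ (isNeg e))) x a y)
          (cong (λ b → b2n b + rowNegs 0 0 a) (∧-identityʳ (isNeg x)))

  module _ {n} (I : State n) where

    private
      l = toList (middle I)

    middleWeight-ends : ∀ h b c → middleWeight h (b ∷ (I ∷ʳ c)) ≡
             (if runs h (diff b (not c) List.∷ (l List.∷ʳ diff c (not b))) (not h)
              then 2 ^ (b2n (isNeg (diff b (not c))) + rowNegs 0 0 (middle I)) else 0)
    middleWeight-ends h b c
      rewrite middle-ends b I c | rowNegs-ends (diff b (not c)) (middle I) (diff c (not b))
            | toList-∷ʳ (diff c (not b)) (middle I) = refl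

    middleWeight-false-ff : middleWeight false (false ∷ (I ∷ʳ false)) ≡ middleWeight true I
    middleWeight-false-ff rewrite middleWeight-ends false false false | runs-∷ʳ-diff true l false true = refl

    middleWeight-true-ff : middleWeight true (false ∷ (I ∷ʳ false)) ≡ 0
    middleWeight-true-ff = middleWeight-ends true false false

    middleWeight-false-tt : middleWeight false (true ∷ (I ∷ʳ true)) ≡ 0
    middleWeight-false-tt = middleWeight-ends false true true

    -- Both end entries are -1 and form one orbit, hence a single factor 2.
    middleWeight-true-tt : middleWeight true (true ∷ (I ∷ʳ true)) ≡ middleWeight false I + middleWeight false I
    middleWeight-true-tt rewrite middleWeight-ends true true true | runs-∷ʳ-diff false l true false with runs false l true
    ... | true  = cong (2 ^ rowNegs 0 0 (middle I) +_) (+-identityʳ _)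
    ... | false = refl

    middleWeight-ft : ∀ h → middleWeight h (false ∷ (I ∷ʳ true)) ≡ middleWeight h I
    middleWeight-ft false rewrite middleWeight-ends false false true | runs-∷ʳ-diff false l true true = refl
    middleWeight-ft true  rewrite middleWeight-ends true false true | runs-∷ʳ-diff true l false false = refl

    middleWeight-tf : ∀ h → middleWeight h (true ∷ (I ∷ʳ false)) ≡ middleWeight h I
    middleWeight-tf false rewrite middleWeight-ends false true false | runs-∷ʳ-diff false l true true = refl
    middleWeight-tf true  rewrite middleWeight-ends true true false | runs-∷ʳ-diff true l false false = refl

  -- The functional `g` prescribes the occupancy `v` of the last midpoint. As `P` consumes the sites
  -- from the left, the right half of a mirror pair is treated by the lemmas that follow.
  record Ends {n} (v : Bool) (g : State (suc n) → ℕ) (g′ : State n → ℕ) : Set where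
    constructor ends
    field
      same  : ∀ T → g (T ∷ʳ v) ≡ g′ T
      other : ∀ T → g (T ∷ʳ not v) ≡ 0

  Ends-at : ∀ {n v} {g : State (suc (suc n)) → ℕ} {g′} → Ends v g g′ → ∀ b → Ends v (g at b) (g′ at b)
  Ends-at (ends p q) b = ends (λ T → p (b ∷ T)) (λ T → q (b ∷ T))

  P-match : ∀ v {n} c (S : State n) b {g g′} → Ends v g g′ → P c g ((S ∷ʳ b) ∷ʳ v) ≡ P c g′ (S ∷ʳ b)
  P-match false true  []          false (ends p q) = p (true ∷ [])
  P-match false true  []          true  (ends p q) = q (true ∷ [])
  P-match false false []          false (ends p q) = p (false ∷ [])
  P-match false false []          true  (ends p q) = cong₂ _+_ (q (false ∷ [])) (p (true ∷ []))
  P-match true  true  []          false (ends p q) = p (true ∷ [])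
  P-match true  true  []          true  (ends p q) = refl
  P-match true  false []          false (ends p q) = p (false ∷ [])
  P-match true  false []          true  (ends p q) = p (true ∷ [])
  P-match v true  (x ∷ S)     b e = P-match v x S b (Ends-at e true)
  P-match v false (false ∷ S) b e = P-match v false S b (Ends-at e false)
  P-match v false (true ∷ S)  b e = cong₂ _+_ (P-match v true S b (Ends-at e false)) (P-match v false S b (Ends-at e true))

  -- A particle on the last site has nowhere to go but the last midpoint, which must stay empty.
  P-blocked : ∀ {n} c (S : State n) b {g g′} → Ends false g g′ → P c g ((S ∷ʳ b) ∷ʳ true) ≡ 0
  P-blocked true  []          false (ends p q) = q (true ∷ [])
  P-blocked true  []          true  (ends p q) = refl
  P-blocked false []          false (ends p q) = q (false ∷ [])
  P-blocked false []          true  (ends p q) = q (true ∷ [])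
  P-blocked true  (x ∷ S)     b e = P-blocked x S b (Ends-at e true)
  P-blocked false (false ∷ S) b e = P-blocked false S b (Ends-at e false)
  P-blocked false (true ∷ S)  b e = cong₂ _+_ (P-blocked true S b (Ends-at e false)) (P-blocked false S b (Ends-at e true))

  -- The last site is empty, so only the particle on the site before it can fill the last midpoint;
  -- for the other midpoints that particle might as well be absent.
  P-forced-true : ∀ {n} c (S : State n) {g g′} → Ends true g g′ → P c g ((S ∷ʳ true) ∷ʳ false) ≡ P c g′ (S ∷ʳ false)
  P-forced-true true  []          (ends p q) = p (true ∷ [])
  P-forced-true false []          (ends p q) = trans (cong₂ _+_ (p (false ∷ [])) (q (true ∷ []))) (+-identityʳ _)
  P-forced-true true  (x ∷ S)     e = P-forced-true x S (Ends-at e true)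
  P-forced-true false (false ∷ S) e = P-forced-true false S (Ends-at e false)
  P-forced-true false (true ∷ S)  e = cong₂ _+_ (P-forced-true true S (Ends-at e false)) (P-forced-true false S (Ends-at e true))

  P-forced-false : ∀ {n} c (S : State n) {g g′} → Ends true g g′ → P c g ((S ∷ʳ false) ∷ʳ false) ≡ 0
  P-forced-false true  []          (ends p q) = q (true ∷ [])
  P-forced-false false []          (ends p q) = q (false ∷ [])
  P-forced-false true  (x ∷ S)     e = P-forced-false x S (Ends-at e true)
  P-forced-false false (false ∷ S) e = P-forced-false false S (Ends-at e false)
  P-forced-false false (true ∷ S)  e = cong₂ _+_ (P-forced-false true S (Ends-at e false)) (P-forced-false false S (Ends-at e true))

  ends-false : ∀ {n} → Ends true (fixedByStar at false) (fixedByStar {n})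
  ends-false = ends (λ T → fixedByStar-ends false T true) (λ T → fixedByStar-ends false T false)

  ends-true : ∀ {n} → Ends false (fixedByStar at true) (fixedByStar {n})
  ends-true = ends (λ T → fixedByStar-ends true T false) (λ T → fixedByStar-ends true T true)

  -- The field names give the occupancies of the two sites just outside `I`. In `tt` both outer
  -- particles are forced inwards and fill both outermost midpoints, which `fixedByStar` forbids.
  record FoldedHop {n} (I : State n) : Set where
    field
      ff : P false fixedByStar (I ∷ʳ false) ≡ middleWeight true I
      tf : P true fixedByStar (I ∷ʳ false) ≡ middleWeight false I
      ft : P false fixedByStar (I ∷ʳ true) ≡ middleWeight false I
      tt : P true fixedByStar (I ∷ʳ true) ≡ 0

  -- A pair of mirror image columns is processed at once: the pair of particles waiting
  -- on the two sides plays the role of the partial sum h of the middle row.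
  foldedHop : ∀ m (I : State (suc (double m))) → FoldedHop I
  foldedHop zero (false ∷ []) = record { ff = refl ; tf = refl ; ft = refl ; tt = refl }
  foldedHop zero (true ∷ [])  = record { ff = refl ; tf = refl ; ft = refl ; tt = refl }
  foldedHop (suc m) (b ∷ J) with initLast J
  ... | I , b′ , refl = go b b′
    where
    open FoldedHop (foldedHop m I)
    go : ∀ b b′ → FoldedHop (b ∷ (I ∷ʳ b′))
    go false false = record
      { ff = trans (P-forced-false false I ends-false) (sym (middleWeight-true-ff I))
      ; tf = trans (P-match false false I false ends-true) (trans ff (sym (middleWeight-false-ff I)))
      ; ft = trans (P-match true false I false ends-false) (trans ff (sym (middleWeight-false-ff I)))
      ; tt = P-blocked false I false ends-true
      }
    go false true = record
      { ff = trans (P-forced-true false I ends-false) (trans ff (sym (middleWeight-ft I true)))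
      ; tf = trans (P-match false false I true ends-true) (trans ft (sym (middleWeight-ft I false)))
      ; ft = trans (P-match true false I true ends-false) (trans ft (sym (middleWeight-ft I false)))
      ; tt = P-blocked false I true ends-true
      }
    go true false = record
      { ff = trans (cong₂ _+_ (P-forced-false true I ends-false) (P-match false false I false ends-true))
                   (trans ff (sym (middleWeight-tf I true)))
      ; tf = trans (P-match false true I false ends-true) (trans tf (sym (middleWeight-tf I false)))
      ; ft = trans (cong₂ _+_ (P-match true true I false ends-false) (P-blocked false I false ends-true))
                   (trans (+-identityʳ _) (trans tf (sym (middleWeight-tf I false))))
      ; tt = P-blocked true I false ends-true
      }
    go true true = record
      { ff = trans (cong₂ _+_ (P-forced-true true I ends-false) (P-match false false I true ends-true))
                   (trans (cong₂ _+_ tf ft) (sym (middleWeight-true-tt I)))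
      ; tf = trans (P-match false true I true ends-true) (trans tt (sym (middleWeight-false-tt I)))
      ; ft = trans (cong₂ _+_ (P-match true true I true ends-false) (P-blocked false I true ends-true))
                   (trans (+-identityʳ _) (trans tt (sym (middleWeight-false-tt I))))
      ; tt = P-blocked true I true ends-true
      }

  -- At the two ends of the whole row a particle can only move inwards, so the end sites play the
  -- part of the outer particles in `FoldedHop`.
  hop-fixedByStar : ∀ m (S : State (suc (double m))) → hop fixedByStar S ≡ middleWeight false S
  hop-fixedByStar zero    (false ∷ []) = refl
  hop-fixedByStar zero    (true ∷ [])  = refl
  hop-fixedByStar (suc m) (b ∷ J) with initLast J
  ... | I , b′ , refl = go b b′
    where
    open FoldedHop (foldedHop m I)
    go : ∀ b b′ → P b fixedByStar (I ∷ʳ b′) ≡ middleWeight false (b ∷ (I ∷ʳ b′))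
    go false false = trans ff (sym (middleWeight-false-ff I))
    go false true  = trans ft (sym (middleWeight-ft I false))
    go true  false = trans tf (sym (middleWeight-tf I false))
    go true  true  = trans tt (sym (middleWeight-false-tt I))

  partialSum-double : ∀ {n} m (S : State n) → partialSum (double m) S ≡ iterD m (partialSum 0) S
  partialSum-double zero    S = refl
  partialSum-double (suc m) S = trans (partialSum-step (double m) S) (D-cong false (partialSum-double m) S)

  partialSum-suc-double : ∀ {n} m (S : State n) → partialSum (suc (double m)) S ≡ iterD m (partialSum 1) S
  partialSum-suc-double zero    S = refl
  partialSum-suc-double (suc m) S = trans (partialSum-step (suc (double m)) S) (D-cong false (partialSum-suc-double m) S)

  partialSum-odd : ∀ m → partialSum (suc (double m)) (empty {suc (double m)}) ≡ 2 ^ m * partialSum (double m) (empty {double m})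
  partialSum-odd m = begin
    partialSum (suc (double m)) odd                ≡⟨ partialSum-suc-double m odd ⟩
    iterD m (partialSum 1) odd                     ≡⟨ iterD-cong m (λ S → trans (partialSum-one S) (sym (hop-fixedByStar m S))) odd ⟩
    iterD m (hop fixedByStar) odd         ≡⟨ iterD-hop-empty m fixedByStar ⟩
    2 ^ m * iterD m fixedByStar even      ≡⟨ cong (2 ^ m *_) (partialSum-double m even) ⟨
    2 ^ m * partialSum (double m) even             ∎
    where
    open ≡-Reasoning
    odd : State (suc (double m))
    odd = empty
    even : State (double m)
    even = empty

  -- Equivalence of the defined line condition with paths of partial sums

  bval : Bool → ℤ
  bval false = ℤ.+ 0
  bval true  = ℤ.+ 1

  -- The sign of the latest nonzero entry once the partial sum has the given value; putting it in
  -- front of a list encodes the starting point of a path as part of the alternation.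
  lastSign : Bool → Entry
  lastSign false = neg
  lastSign true  = pos

  nonzeros : List Entry → List Entry
  nonzeros = filterᵇ (λ e → not (isZer e))

  runs-lineSum : ∀ s l t → runs s l t ≡ true → bval s ℤ.+ lineSum l ≡ bval t
  runs-lineSum false List.[]          false e = refl
  runs-lineSum true  List.[]          true  e = refl
  runs-lineSum s     (zer List.∷ l) t e = trans (cong (λ x → bval s ℤ.+ x) (ℤₚ.+-identityˡ (lineSum l))) (runs-lineSum s l t e)
  runs-lineSum false (pos List.∷ l) t e = trans (ℤₚ.+-identityˡ (ℤ.+ 1 ℤ.+ lineSum l)) (runs-lineSum true l t e)
  runs-lineSum true  (neg List.∷ l) t e =
    trans (sym (ℤₚ.+-assoc (ℤ.+ 1) ℤ.-[1+ 0 ] (lineSum l))) (runs-lineSum false l t e)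

  runs-alternates : ∀ s l t → runs s l t ≡ true → alternates (lastSign s List.∷ nonzeros l) ≡ true
  runs-alternates s     List.[]          t e = refl
  runs-alternates s     (zer List.∷ l) t e = runs-alternates s l t e
  runs-alternates false (pos List.∷ l) t e = runs-alternates true l t e
  runs-alternates true  (neg List.∷ l) t e = runs-alternates false l t e

  alternates-runs : ∀ s l → alternates (lastSign s List.∷ nonzeros l) ≡ true → ∃ λ t → runs s l t ≡ true
  alternates-runs false List.[]          e = false , refl
  alternates-runs true  List.[]          e = true , refl
  alternates-runs s     (zer List.∷ l) e = alternates-runs s l e
  alternates-runs false (pos List.∷ l) e = alternates-runs true l e
  alternates-runs true  (neg List.∷ l) e = alternates-runs false l e

  alternates-tail : ∀ x xs → alternates (x List.∷ xs) ≡ true → alternates xs ≡ true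
  alternates-tail x List.[]         e = refl
  alternates-tail x (y List.∷ xs) e with sameSign x y
  ... | false = e

  alternates-start : ∀ xs → alternates xs ≡ true → ∃ λ s → alternates (lastSign s List.∷ xs) ≡ true
  alternates-start List.[]           e = false , refl
  alternates-start (neg List.∷ xs) e = true , e
  alternates-start (zer List.∷ xs) e = false , e
  alternates-start (pos List.∷ xs) e = false , e

  Bool-⇔ : ∀ {a b} → (a ≡ true → b ≡ true) → (b ≡ true → a ≡ true) → a ≡ b
  Bool-⇔ {false} {false} f g = refl
  Bool-⇔ {true}  {true}  f g = refl
  Bool-⇔ {false} {true}  f g with g refl
  ... | ()
  Bool-⇔ {true}  {false} f g with f refl
  ... | ()

  -- Alternation confines the partial sums to two adjacent values, which yields a path from some `s`
  -- to some `t`; a total of 1 leaves only the path from 0 to 1.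
  goodLine-runs : ∀ l → goodLine l ≡ runs false l true
  goodLine-runs l with lineSum l ℤ.≟ ℤ.+ 1
  ... | no  ≢1 = Bool-⇔ (λ ()) (λ e → contradiction (trans (sym (ℤₚ.+-identityˡ (lineSum l))) (runs-lineSum false l true e)) ≢1)
  ... | yes ≡1 = Bool-⇔ to (λ e → alternates-tail neg (nonzeros l) (runs-alternates false l true e))
    where
    close : ∀ s t → runs s l t ≡ true → runs false l true ≡ true
    close s t e with trans (sym (cong (λ x → bval s ℤ.+ x) ≡1)) (runs-lineSum s l t e)
    close false true  e | _ = e
    close false false e | ()
    close true  true  e | ()
    close true  false e | ()
    to : alternates (nonzeros l) ≡ true → runs false l true ≡ true
    to e with alternates-start (nonzeros l) e
    ... | s , e′ with alternates-runs s l e′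
    ...   | t , e″ = close s t e″

  -- Translation of matrices, their tests and their weights into vectors of rows

  allF : ∀ n → (Fin n → Bool) → Bool
  allF zero    p = true
  allF (suc n) p = p Fin.zero ∧ allF n (p ∘ Fin.suc)

  allF-cong : ∀ n {p q} → (∀ i → p i ≡ q i) → allF n p ≡ allF n q
  allF-cong zero    e = refl
  allF-cong (suc n) e = cong₂ _∧_ (e Fin.zero) (allF-cong n (e ∘ Fin.suc))

  allᵇ-tabulate : ∀ {B : Set} n (p : B → Bool) (g : Fin n → B) → allᵇ p (List.tabulate g) ≡ allF n (p ∘ g)
  allᵇ-tabulate zero    p g = refl
  allᵇ-tabulate (suc n) p g = cong (p (g Fin.zero) ∧_) (allᵇ-tabulate n p (g ∘ Fin.suc))

  line-tabulate : ∀ {n} (f : Fin n → Entry) → line f ≡ toList (tabulate f)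
  line-tabulate f = trans (map-tabulate id f) (lemma f)
    where
    lemma : ∀ {n} (f : Fin n → Entry) → List.tabulate f ≡ toList (tabulate f)
    lemma {zero}  f = refl
    lemma {suc n} f = cong (f Fin.zero List.∷_) (lemma (f ∘ Fin.suc))

  goodLine-tabulate : ∀ {n} (f : Fin n → Entry) → goodLine (line f) ≡ good (tabulate f)
  goodLine-tabulate f = trans (cong goodLine (line-tabulate f)) (goodLine-runs (toList (tabulate f)))

  table : ∀ {n k} → (Fin k → Fin n → Entry) → Rows n k
  table A = tabulate (λ i → tabulate (A i))

  rowsGood-table : ∀ {n k} (A : Fin k → Fin n → Entry) → allF k (λ i → goodLine (line (A i))) ≡ rowsGood (table A)
  rowsGood-table {k = zero}  A = refl
  rowsGood-table {k = suc k} A =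
    cong₂ _∧_ (goodLine-tabulate (A Fin.zero)) (rowsGood-table (A ∘ Fin.suc))

  zipWith-tabulate : ∀ {A B C : Set} {n} (h : A → B → C) (f : Fin n → A) (g : Fin n → B) →
                     zipWith h (tabulate f) (tabulate g) ≡ tabulate (λ i → h (f i) (g i))
  zipWith-tabulate {n = zero}  h f g = refl
  zipWith-tabulate {n = suc n} h f g = cong (_ ∷_) (zipWith-tabulate h (f ∘ Fin.suc) (g ∘ Fin.suc))

  cols-table : ∀ {n k} (A : Fin k → Fin n → Entry) → cols (table A) ≡ tabulate (λ j → toList (tabulate (λ i → A i j)))
  cols-table {n} {zero} A = lemma n
    where
    lemma : ∀ n → replicate n (List.[] {A = Entry}) ≡ tabulate (λ _ → List.[])
    lemma zero    = refl
    lemma (suc n) = cong (List.[] ∷_) (lemma n)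
  cols-table {n} {suc k} A =
    trans (cong (zipWith List._∷_ (tabulate (A Fin.zero))) (cols-table (A ∘ Fin.suc)))
          (zipWith-tabulate List._∷_ (A Fin.zero) _)

  runsV-tabulate : ∀ n (c : Fin n → List Entry) →
                   runsV empty (tabulate c) (replicate n true) ≡ allF n (λ j → runs false (c j) true)
  runsV-tabulate zero    c = refl
  runsV-tabulate (suc n) c = cong (runs false (c Fin.zero) true ∧_) (runsV-tabulate n (c ∘ Fin.suc))

  reverse-replicate : ∀ {A : Set} n (x : A) → reverse (replicate n x) ≡ replicate n x
  reverse-replicate zero    x = refl
  reverse-replicate (suc n) x =
    trans (reverse-∷ x (replicate n x)) (trans (cong (_∷ʳ x) (reverse-replicate n x)) (sym (replicate-∷ʳ n x)))

  star-empty : ∀ n → star (empty {n}) ≡ replicate n true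
  star-empty n = trans (cong (map not) (reverse-replicate n false)) (lemma n)
    where
    lemma : ∀ n → map not (replicate n false) ≡ replicate n true
    lemma zero    = refl
    lemma (suc n) = cong (true ∷_) (lemma n)

  columnsGood-table : ∀ {n k} (A : Fin k → Fin n → Entry) →
    allF n (λ j → goodLine (line (λ i → A i j))) ≡ runsV empty (cols (table A)) (star empty)
  columnsGood-table {n} A = begin
    allF n (λ j → goodLine (line (λ i → A i j)))
      ≡⟨ allF-cong n (λ j → goodLine-tabulate (λ i → A i j)) ⟩
    allF n (λ j → runs false (toList (tabulate (λ i → A i j))) true)
      ≡⟨ runsV-tabulate n (λ j → toList (tabulate (λ i → A i j))) ⟨
    runsV empty (tabulate (λ j → toList (tabulate (λ i → A i j)))) (replicate n true)
      ≡⟨ cong₂ (runsV empty) (cols-table A) (star-empty n) ⟨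
    runsV empty (cols (table A)) (star empty) ∎
    where open ≡-Reasoning

  tabulate-∷ʳ : ∀ {A : Set} n (g : Fin (suc n) → A) → tabulate g ≡ tabulate (g ∘ inject₁) ∷ʳ g (fromℕ n)
  tabulate-∷ʳ zero    g = refl
  tabulate-∷ʳ (suc n) g = cong (g Fin.zero ∷_) (tabulate-∷ʳ n (g ∘ Fin.suc))

  reverse-tabulate : ∀ {A : Set} n (f : Fin n → A) → reverse (tabulate f) ≡ tabulate (f ∘ opposite)
  reverse-tabulate zero    f = refl
  reverse-tabulate (suc n) f = begin
    reverse (f Fin.zero ∷ tabulate (f ∘ Fin.suc))
      ≡⟨ reverse-∷ (f Fin.zero) (tabulate (f ∘ Fin.suc)) ⟩
    reverse (tabulate (f ∘ Fin.suc)) ∷ʳ f Fin.zero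
      ≡⟨ cong (_∷ʳ f Fin.zero) (reverse-tabulate n (f ∘ Fin.suc)) ⟩
    tabulate (f ∘ Fin.suc ∘ opposite) ∷ʳ f Fin.zero
      ≡⟨ cong₂ _∷ʳ_ (tabulate-cong (λ i → cong f (toℕ-injective (toℕ-opposite-inject₁ i))))
                    (cong f (toℕ-injective (toℕ-opposite-fromℕ n))) ⟨
    tabulate (f ∘ opposite ∘ inject₁) ∷ʳ f (opposite (fromℕ n))
      ≡⟨ tabulate-∷ʳ n (f ∘ opposite) ⟨
    tabulate (f ∘ opposite) ∎
    where open ≡-Reasoning

  rot-table : ∀ {n k} (A : Fin k → Fin n → Entry) → rot (table A) ≡ table (λ i j → A (opposite i) (opposite j))
  rot-table {n} {k} A = begin
    map reverse (reverse (table A))                            ≡⟨ cong (map reverse) (reverse-tabulate k _) ⟩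
    map reverse (tabulate (λ i → tabulate (A (opposite i))))   ≡⟨ tabulate-∘ reverse _ ⟨
    tabulate (λ i → reverse (tabulate (A (opposite i))))       ≡⟨ tabulate-cong (λ i → reverse-tabulate n (A (opposite i))) ⟩
    table (λ i j → A (opposite i) (opposite j))                ∎
    where open ≡-Reasoning

  ≡-dec-tabulate : ∀ {A : Set} (_≟_ : DecidableEquality A) n (f g : Fin n → A) →
                   does (≡-dec _≟_ (tabulate f) (tabulate g)) ≡ allF n (λ i → does (f i ≟ g i))
  ≡-dec-tabulate _≟_ zero    f g = refl
  ≡-dec-tabulate _≟_ (suc n) f g = cong (does (f Fin.zero ≟ g Fin.zero) ∧_) (≡-dec-tabulate _≟_ n (f ∘ Fin.suc) (g ∘ Fin.suc))

  ≟ᴱ-eqEntry : ∀ x y → does (x ≟ᴱ y) ≡ eqEntry x y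
  ≟ᴱ-eqEntry neg neg = refl
  ≟ᴱ-eqEntry neg zer = refl
  ≟ᴱ-eqEntry neg pos = refl
  ≟ᴱ-eqEntry zer neg = refl
  ≟ᴱ-eqEntry zer zer = refl
  ≟ᴱ-eqEntry zer pos = refl
  ≟ᴱ-eqEntry pos neg = refl
  ≟ᴱ-eqEntry pos zer = refl
  ≟ᴱ-eqEntry pos pos = refl

  symmetric-table : ∀ {n} (A : Matrix n) → isHalfTurnSym A ≡ symmetric (table A)
  symmetric-table {n} A = begin
    isHalfTurnSym A
      ≡⟨ allᵇ-tabulate n _ id ⟩
    allF n (λ i → allᵇ (λ j → eqEntry (A i j) (B i j)) (allFin n))
      ≡⟨ allF-cong n (λ i → allᵇ-tabulate n _ id) ⟩
    allF n (λ i → allF n (λ j → eqEntry (A i j) (B i j)))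
      ≡⟨ allF-cong n (λ i → allF-cong n (λ j → ≟ᴱ-eqEntry (A i j) (B i j))) ⟨
    allF n (λ i → allF n (λ j → does (A i j ≟ᴱ B i j)))
      ≡⟨ allF-cong n (λ i → ≡-dec-tabulate _≟ᴱ_ n (A i) (B i)) ⟨
    allF n (λ i → does (≡-dec _≟ᴱ_ (tabulate (A i)) (tabulate (B i))))
      ≡⟨ ≡-dec-tabulate (≡-dec _≟ᴱ_) n _ _ ⟨
    does (table A ≟ᴹ table B)
      ≡⟨ cong (λ N → does (table A ≟ᴹ N)) (rot-table A) ⟨
    symmetric (table A) ∎
    where
    open ≡-Reasoning
    B : Matrix n
    B i j = A (opposite i) (opposite j)

  -- Here, and in the summation lemmas on lists below, `middleWeight` stands for an arbitrary type
  -- and not for the weight of a middle row. The counting is generic because `r` counts positions in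
  -- a type local to it.
  module _ {middleWeight : Set} (p : middleWeight → Bool) where

    count : List middleWeight → ℕ
    count xs = List.length (filterᵇ p xs)

    count-∷ : ∀ x xs → count (x List.∷ xs) ≡ b2n (p x) + count xs
    count-∷ x xs with p x
    ... | true  = refl
    ... | false = refl

    count-++ : ∀ xs ys → count (xs List.++ ys) ≡ count xs + count ys
    count-++ List.[]         ys = refl
    count-++ (x List.∷ xs) ys = begin
      count (x List.∷ (xs List.++ ys))      ≡⟨ count-∷ x (xs List.++ ys) ⟩
      b2n (p x) + count (xs List.++ ys)     ≡⟨ cong (b2n (p x) +_) (count-++ xs ys) ⟩
      b2n (p x) + (count xs + count ys)     ≡⟨ +-assoc (b2n (p x)) (count xs) (count ys) ⟨
      b2n (p x) + count xs + count ys       ≡⟨ cong (_+ count ys) (count-∷ x xs) ⟨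
      count (x List.∷ xs) + count ys        ∎
      where open ≡-Reasoning

    count-tabulate : ∀ n (f : Fin n → middleWeight) → count (List.tabulate f) ≡ sumFin n (λ j → b2n (p (f j)))
    count-tabulate zero    f = refl
    count-tabulate (suc n) f =
      trans (count-∷ (f Fin.zero) _) (cong (b2n (p (f Fin.zero)) +_) (count-tabulate n (f ∘ Fin.suc)))

    count-concatMap : ∀ {B : Set} k (g : B → List middleWeight) (h : Fin k → B) →
                      count (List.concatMap g (List.tabulate h)) ≡ sumFin k (λ i → count (g (h i)))
    count-concatMap zero    g h = refl
    count-concatMap (suc k) g h =
      trans (count-++ (g (h Fin.zero)) _) (cong (count (g (h Fin.zero)) +_) (count-concatMap k g (h ∘ Fin.suc)))

    count-grid : ∀ n k (f : Fin k → Fin n → middleWeight) →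
                 count (List.concatMap (λ i → List.map (λ j → f i j) (allFin n)) (allFin k))
                 ≡ sumFin k (λ i → sumFin n (λ j → b2n (p (f i j))))
    count-grid n k f =
      trans (count-concatMap k (λ i → List.map (f i) (allFin n)) id)
            (sumFin-cong k (λ i → trans (cong count (map-tabulate id (f i))) (count-tabulate n (f i))))

  r-table : ∀ {n} (A : Matrix n) → r A ≡ orbits (table A)
  r-table {n} A = trans (count-grid _ n n _) (sumFin-cong n (λ i → sumFin-cong n (λ j →
    cong (λ e → b2n (isNeg e ∧ lex (toℕ i) (toℕ j) (toℕ (opposite i)) (toℕ (opposite j)))) (sym (entry i j)))))
    where
    entry : ∀ i j → lookup (lookup (table A) i) j ≡ A i j
    entry i j = trans (cong (λ v → lookup v j) (lookup∘tabulate (λ i → tabulate (A i)) i)) (lookup∘tabulate (A i) j)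

  weight : ∀ {n} → Matrix n → ℕ
  weight A = if isASM A ∧ isHalfTurnSym A then 2 ^ r A * 1 ^ s A else 0

  weight-table : ∀ {n} (A : Matrix n) → weight A ≡ weightFrom empty (table A)
  weight-table {n} A = cong₂ (λ b x → if b then x else 0) condition
    -- At `y = 1` the position of the 1 in the top row drops out of the weight.
    (trans (cong (2 ^ r A *_) (^-zeroˡ (s A))) (trans (*-identityʳ _) (cong (2 ^_) (r-table A))))
    where
    open ≡-Reasoning
    M = table A
    C = runsV empty (cols M) (star empty)
    condition : isASM A ∧ isHalfTurnSym A ≡ C ∧ (rowsGood M ∧ symmetric M)
    condition = begin
      isASM A ∧ isHalfTurnSym A
        ≡⟨ cong₂ _∧_ (cong₂ _∧_ (trans (allᵇ-tabulate n _ id) (rowsGood-table A))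
                                (trans (allᵇ-tabulate n _ id) (columnsGood-table A)))
                     (symmetric-table A) ⟩
      (rowsGood M ∧ C) ∧ symmetric M   ≡⟨ cong (_∧ symmetric M) (∧-comm (rowsGood M) C) ⟩
      (C ∧ rowsGood M) ∧ symmetric M   ≡⟨ ∧-assoc C (rowsGood M) (symmetric M) ⟩
      C ∧ (rowsGood M ∧ symmetric M)   ∎

  sum-filterᵇ : ∀ {middleWeight : Set} (p : middleWeight → Bool) (g : middleWeight → ℕ) xs →
                sum (List.map g (filterᵇ p xs)) ≡ sum (List.map (λ x → if p x then g x else 0) xs)
  sum-filterᵇ p g List.[]         = refl
  sum-filterᵇ p g (x List.∷ xs) with p x
  ... | true  = cong (g x +_) (sum-filterᵇ p g xs)
  ... | false = sum-filterᵇ p g xs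

  sum-concatMap : ∀ {middleWeight Y : Set} (φ : Y → ℕ) (g : middleWeight → List Y) xs →
                  sum (List.map φ (List.concatMap g xs)) ≡ sum (List.map (λ x → sum (List.map φ (g x))) xs)
  sum-concatMap φ g List.[]         = refl
  sum-concatMap φ g (x List.∷ xs) =
    trans (cong sum (map-++ φ (g x) (List.concatMap g xs)))
    (trans (sum-++ (List.map φ (g x)) _) (cong (sum (List.map φ (g x)) +_) (sum-concatMap φ g xs)))

  -- The summand sees a function only through its table, so a sum over listed functions becomes an
  -- iterated sum over vectors; applied once to the entries of a row and once to the rows of a
  -- matrix.
  sum-allFuns : ∀ {middleWeight Y : Set} (xs : List middleWeight) (encode : middleWeight → Y) (σ : Sum Y) →
                (∀ g → sum (List.map (λ x → g (encode x)) xs) ≡ σ g) →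
                ∀ k (ψ : Vec Y k → ℕ) → sum (List.map (λ f → ψ (tabulate (encode ∘ f))) (allFuns xs k)) ≡ sumV σ k ψ
  sum-allFuns xs encode σ h zero    ψ = +-identityʳ (ψ [])
  sum-allFuns xs encode σ h (suc k) ψ =
    trans (sum-concatMap (λ f → ψ (tabulate (encode ∘ f))) _ xs)
    (trans (cong sum (map-cong (λ x → trans (cong sum (sym (map-∘ (allFuns xs k))))
                                            (sum-allFuns xs encode σ h k (λ v → ψ (encode x ∷ v)))) xs))
           (h (λ y → sumV σ k (λ v → ψ (y ∷ v)))))

  H-partialSum : ∀ n → H n 2 1 ≡ partialSum n (empty {n})
  H-partialSum n = begin
    H n 2 1
      ≡⟨ sum-filterᵇ (λ A → isASM A ∧ isHalfTurnSym A) (λ A → 2 ^ r A * 1 ^ s A) (allMatrices n) ⟩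
    sum (List.map weight (allMatrices n))
      ≡⟨ cong sum (map-cong weight-table (allMatrices n)) ⟩
    sum (List.map (λ A → weightFrom empty (table A)) (allMatrices n))
      ≡⟨ sum-allFuns (allFuns entries n) tabulate (σR n) (sum-allFuns entries id σE entries-sum n) n (weightFrom empty) ⟩
    partialSum n empty ∎
    where
    open ≡-Reasoning
    entries = neg List.∷ zer List.∷ pos List.∷ List.[]
    entries-sum : ∀ g → sum (List.map (λ e → g e) entries) ≡ σE g
    entries-sum g = cong (λ x → g neg + (g zer + x)) (+-identityʳ (g pos))

-- Assembly of the three identities

open import Defs
open import Data.Nat using (ℕ; suc; _+_; _*_; _^_)
open import Data.Nat.Combinatorics using (_C_)
open import Data.Nat.Properties using (+-comm)
open import Data.Nat.Tactic.RingSolver using (solve-∀)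
open RowTransfer
open ExteriorAlgebra using (selected-ratio)
open ProductFormula using (ratio-even; ratio-odd; 2*≡double)
open MatrixSum

H-double : ∀ m → H (double m) 2 1 ≡ iterD m fixedByStar (empty {double m})
H-double m = trans (H-partialSum (double m)) (partialSum-double m (empty {double m}))

4*≡double : ∀ n → 4 * n ≡ double (double n)
4*≡double n = trans (lemma n) (trans (cong (2 *_) (2*≡double n)) (2*≡double (double n)))
  where
  lemma : ∀ n → 4 * n ≡ 2 * (2 * n)
  lemma = solve-∀

theorem4 : (n : ℕ) → 1 Data.Nat.≤ n →
    (H (4 * n) 2 1 * ((2 * n) C n) ≡ 2 ^ (2 * n Data.Nat.∸ 1) * ((4 * n) C (2 * n)) * H (4 * n Data.Nat.∸ 2) 2 1)
    × (H (4 * n + 2) 2 1 * ((2 * n) C n) ≡ 2 ^ (2 * n + 1) * ((4 * n) C (2 * n)) * H (4 * n) 2 1)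
    × (H (2 * n + 1) 2 1 ≡ 2 ^ n * H (2 * n) 2 1)
theorem4 n@(suc k) _ = first , second , third
  where
  open ≡-Reasoning
  h : ℕ → ℕ
  h m = iterD m fixedByStar (empty {double m})
  size-4n : H (4 * n) 2 1 ≡ h (double n)
  size-4n = trans (cong (λ x → H x 2 1) (4*≡double n)) (H-double (double n))
  size-4n-2 : H (4 * n Data.Nat.∸ 2) 2 1 ≡ h (suc (double k))
  size-4n-2 = trans (cong (λ x → H (x Data.Nat.∸ 2) 2 1) (4*≡double n)) (H-double (suc (double k)))
  size-4n+2 : H (4 * n + 2) 2 1 ≡ h (suc (double n))
  size-4n+2 = trans (cong (λ x → H x 2 1) (trans (cong (_+ 2) (4*≡double n)) (+-comm (double (double n)) 2)))
                    (H-double (suc (double n)))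
  first : H (4 * n) 2 1 * ((2 * n) C n) ≡ 2 ^ (2 * n Data.Nat.∸ 1) * ((4 * n) C (2 * n)) * H (4 * n Data.Nat.∸ 2) 2 1
  first = begin
    H (4 * n) 2 1 * ((2 * n) C n)
      ≡⟨ cong (_* ((2 * n) C n)) size-4n ⟩
    h (double n) * ((2 * n) C n)
      -- The upper halves have `2 n - 1 = suc (double k)` and `2 n` rows, so the pivot has odd
      -- index; in `second` it has the even index `2 n`.
      ≡⟨ ratio-odd k (h (suc (double k))) (h (double n)) (selected-ratio fixedByStar-selector (suc (double k))) ⟩
    2 ^ (2 * n Data.Nat.∸ 1) * ((4 * n) C (2 * n)) * h (suc (double k))
      ≡⟨ cong (2 ^ (2 * n Data.Nat.∸ 1) * ((4 * n) C (2 * n)) *_) size-4n-2 ⟨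
    2 ^ (2 * n Data.Nat.∸ 1) * ((4 * n) C (2 * n)) * H (4 * n Data.Nat.∸ 2) 2 1 ∎
  second : H (4 * n + 2) 2 1 * ((2 * n) C n) ≡ 2 ^ (2 * n + 1) * ((4 * n) C (2 * n)) * H (4 * n) 2 1
  second = begin
    H (4 * n + 2) 2 1 * ((2 * n) C n)
      ≡⟨ cong (_* ((2 * n) C n)) size-4n+2 ⟩
    h (suc (double n)) * ((2 * n) C n)
      ≡⟨ ratio-even n (h (double n)) (h (suc (double n))) (selected-ratio fixedByStar-selector (double n)) ⟩
    2 ^ (2 * n + 1) * ((4 * n) C (2 * n)) * h (double n)
      ≡⟨ cong (2 ^ (2 * n + 1) * ((4 * n) C (2 * n)) *_) size-4n ⟨
    2 ^ (2 * n + 1) * ((4 * n) C (2 * n)) * H (4 * n) 2 1 ∎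
  third : H (2 * n + 1) 2 1 ≡ 2 ^ n * H (2 * n) 2 1
  third = begin
    H (2 * n + 1) 2 1                          ≡⟨ cong (λ x → H x 2 1) (trans (+-comm (2 * n) 1) (cong suc (2*≡double n))) ⟩
    H (suc (double n)) 2 1                     ≡⟨ H-partialSum (suc (double n)) ⟩
    partialSum (suc (double n)) (empty {suc (double n)}) ≡⟨ partialSum-odd n ⟩
    2 ^ n * partialSum (double n) (empty {double n})    ≡⟨ cong (2 ^ n *_) (H-partialSum (double n)) ⟨
    2 ^ n * H (double n) 2 1                   ≡⟨ cong (λ x → 2 ^ n * H x 2 1) (2*≡double n) ⟨
    2 ^ n * H (2 * n) 2 1                      ∎
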